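{- Let $m$ and $n$ be positive integers and let $\kappa=m+n$. For $r\ge0$ let $(m^r)$ denote the partition with $r$ parts all equal to $m$. Then, as formal power series in $q$, \[ \lim_{r\to\infty} q^{ -m\binom{r}{2}} P_{(m^r)}(1,q,q^2,\dots;q^n) =\frac{(q^{\kappa};q^{\kappa})_{\infty}^{n-1}}{(q;q)_{\infty}^n} \prod_{1\leq i<j\leq n} \theta(q^{j-i};q^{\kappa}) =\frac{(q^{\kappa};q^{\kappa})_{\infty}^{m-1}}{(q;q)_{\infty}^m} \prod_{1\leq i<j\leq m} \theta(q^{j-i};q^{\kappa}). \]
   Context: For a partition $\lambda=(\lambda_1,\lambda_2,\dots)$, $l(\lambda)$ is the number of positive parts and $m_i=m_i(\lambda)$ is the multiplicity of parts equal to $i$. Notation: $(a;q)_k=(1-a)(1-aq)\cdots(1-aq^{k-1})$ for $k\in\{0,1,2,\dots\}\cup\{\infty\}$; $\theta(a;q)=(a;q)_\infty(q/a;q)_\infty$. The Hall–Littlewood polynomial in $N$ variables $x=(x_1,\dots,x_N)$ with parameter $t$ is $P_\lambda(x;t)=\frac{1}{v_\lambda(t)}\sum_{w\in S_N} w\Big(x_1^{\lambda_1}\cdots x_N^{\lambda_N}\prod_{i<j}\frac{x_i-tx_j}{x_i-x_j}\Big)$ for $l(\lambda)\le N$, where $S_N$ permutes the variables and $v_\lambda(t)=\prod_{i=0}^N (t;t)_{m_i}/(1-t)^{m_i}$ with $m_0=N-l(\lambda)$; $P_\lambda(x;t)=0$ if $l(\lambda)>N$. These are stable under setting $x_N=0$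 and so define symmetric functions in infinitely many variables; $P_\lambda(1,q,q^2,\dots;t)$ denotes the specialisation $x_i=q^{i-1}$ ($i\ge1$), a formal power series in $q$. The limit is in the sense of formal power series (coefficientwise stabilisation). -}

module Defs where

open import Data.Nat as ℕ using (ℕ; zero; suc; _∸_; _⊓_; _⊔_; _<ᵇ_; _≡ᵇ_; _≤ᵇ_; _≤_)
open import Data.Nat.Divisibility using (_∣?_)
open import Data.Integer as ℤ using (ℤ; +_; -[1+_])
open import Data.Fin using (Fin; zero; suc; toℕ; punchIn)
open import Data.List using (List; []; _∷_; map; foldr; concatMap; allFin; upTo; length; replicate; filter)
open import Data.Bool using (if_then_else_)
open import Data.Product using (_×_; _,_; ∃-syntax)
open import Relation.Nullary.Decidable using (⌊_⌋)
open import Relation.Binary.PropositionalEquality using (_≡_)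

Series : Set
Series = ℕ → ℤ

0ₛ : Series
0ₛ _ = + 0

1ₛ : Series
1ₛ zero    = + 1
1ₛ (suc _) = + 0

mono : ℕ → Series
mono k d = if d ≡ᵇ k then + 1 else + 0

infixl 6 _+ₛ_ _-ₛ_
infixl 7 _*ₛ_

_+ₛ_ : Series → Series → Series
(f +ₛ g) d = f d ℤ.+ g d

_-ₛ_ : Series → Series → Series
(f -ₛ g) d = f d ℤ.- g d

negₛ : Series → Series
negₛ f d = ℤ.- f d

sumTo : ℕ → (ℕ → ℤ) → ℤ
sumTo zero    f = + 0
sumTo (suc n) f = sumTo n f ℤ.+ f n

_*ₛ_ : Series → Series → Series
(f *ₛ g) d = sumTo (suc d) (λ i → f i ℤ.* g (d ∸ i))

prodₛ : List Series → Series
prodₛ = foldr _*ₛ_ 1ₛ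

sumₛ : List Series → Series
sumₛ = foldr _+ₛ_ 0ₛ

powₛ : Series → ℕ → Series
powₛ f zero    = 1ₛ
powₛ f (suc k) = f *ₛ powₛ f k

-- geom d = 1/(1 - q^d) = Σ_k q^(d k)   (used only for d ≥ 1)
geom : ℕ → Series
geom d k = if ⌊ d ∣? k ⌋ then + 1 else + 0

-- Infinite product ∏_{k≥0} F k, for factors with F k ≡ 1 mod q^(k+1):
-- the coefficient of q^d is that of the finite product ∏_{k≤d} F k.
prodInf : (ℕ → Series) → Series
prodInf F d = prodₛ (map F (upTo (suc d))) d

-- (q^b ; q^c)_∞ = ∏_{k≥0} (1 - q^(b + c k))   (for b ≥ 1, c ≥ 1)
pochInf : ℕ → ℕ → Series
pochInf b c = prodInf (λ k → 1ₛ -ₛ mono (b ℕ.+ c ℕ.* k))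

invPochQ : Series
invPochQ = prodInf (λ k → geom (suc k))

-- θ(q^a ; q^c) = (q^a;q^c)_∞ (q^c/q^a;q^c)_∞   (for 0 < a < c)
thetaₛ : ℕ → ℕ → Series
thetaₛ a c = pochInf a c *ₛ pochInf (c ∸ a) c

pairsLt : ℕ → List (ℕ × ℕ)
pairsLt a = concatMap (λ i → concatMap (λ j → if i <ᵇ j then (i , j) ∷ [] else [])
                                       (map suc (upTo a)))
                      (map suc (upTo a))

rhsₛ : ℕ → ℕ → Series
rhsₛ a κ = powₛ (pochInf κ κ) (a ∸ 1) *ₛ powₛ invPochQ a
           *ₛ prodₛ (map (λ p → thetaₛ (Data.Product.proj₂ p ∸ Data.Product.proj₁ p) κ) (pairsLt a))

-- f / (q^a - q^b) for a ≠ b, when q^(min a b) divides f: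
-- q^a - q^b = ε q^c (1 - q^d), c = min a b, d = |a-b|, ε = +1 if a<b, -1 if a>b.
divBinom : ℕ → ℕ → Series → Series
divBinom a b f = if a <ᵇ b then g else negₛ g
  where
    c = a ⊓ b
    g : Series
    g = (λ k → f (k ℕ.+ c)) *ₛ geom (ℕ.∣ a - b ∣)

part : List ℕ → ℕ → ℕ
part []       _       = 0
part (x ∷ xs) zero    = x
part (x ∷ xs) (suc i) = part xs i

insertPerm : {n : ℕ} → Fin (suc n) → (Fin n → Fin n) → Fin (suc n) → Fin (suc n)
insertPerm k σ zero    = k
insertPerm k σ (suc i) = punchIn k (σ i)

perms : (n : ℕ) → List (Fin n → Fin n)
perms zero    = (λ ()) ∷ []
perms (suc n) = concatMap (λ σ → map (λ k → insertPerm k σ) (allFin (suc n))) (perms n)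

pairsFin : (N : ℕ) → List (Fin N × Fin N)
pairsFin N = concatMap (λ i → concatMap (λ j → if toℕ i <ᵇ toℕ j then (i , j) ∷ [] else [])
                                        (allFin N))
                       (allFin N)

sumFin : (N : ℕ) → (Fin N → ℕ) → ℕ
sumFin N f = foldr ℕ._+_ 0 (map f (allFin N))

-- m_i(λ) computed on λ padded with zeros to length N (so m_0 = N - l(λ))
mult : List ℕ → ℕ → ℕ → ℕ
mult λ' N i = sumFin N (λ k → if part λ' (toℕ k) ≡ᵇ i then 1 else 0)

-- 1 / v_λ(t) with t = q^s, where
-- v_λ(t) = ∏_{i≥0} (t;t)_{m_i}/(1-t)^{m_i} = ∏_i ∏_{j=1}^{m_i} (1-t^j)/(1-t)
invV : List ℕ → ℕ → ℕ → Series
invV λ' N s = prodₛ (concatMap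
  (λ i → map (λ j → (1ₛ -ₛ mono s) *ₛ geom (s ℕ.* suc j)) (upTo (mult λ' N i)))
  (upTo (suc (foldr _⊔_ 0 λ'))))

-- w( x^λ ∏_{i<j} (x_i - t x_j)/(x_i - x_j) ) at x_k = q^(k-1), t = q^s
hlTerm : List ℕ → (N : ℕ) → ℕ → (Fin N → Fin N) → Series
hlTerm λ' N s w =
  mono (sumFin N (λ k → part λ' (toℕ k) ℕ.* toℕ (w k)))
  *ₛ prodₛ (map (λ p → let a = toℕ (w (Data.Product.proj₁ p))
                           b = toℕ (w (Data.Product.proj₂ p))
                       in divBinom a b (mono a -ₛ mono (b ℕ.+ s)))
                (pairsFin N))

HLspec : List ℕ → ℕ → ℕ → Series
HLspec λ' N s = if length λ' ≤ᵇ N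
                then invV λ' N s *ₛ sumₛ (map (hlTerm λ' N s) (perms N))
                else 0ₛ

rect : ℕ → ℕ → List ℕ
rect m r = replicate r m

Converges : (ℕ → Series) → Series → Set
Converges F L = ∀ d → ∃[ N₀ ] (∀ N → N₀ ≤ N → F N d ≡ L d)

Laurent : Set
Laurent = ℤ → ℤ

embed : Series → Laurent
embed f (+ k)      = f k
embed f -[1+ _ ]   = + 0

shiftL : ℕ → Series → Laurent
shiftL e f j = embed f (j ℤ.+ + e)

ConvergesL : (ℕ → Laurent) → Laurent → Set
ConvergesL F L = ∀ (j : ℤ) → ∃[ R ] (∀ r → R ≤ r → F r j ≡ L j)

{-# OPTIONS --safe #-}

-- Proof idea. Put t = q^n. Choosing the variables that carry the exponent m one at a time, the factor
-- x_i - t x_j kills every choice except the smallest unused element of one of the n residue classes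
-- modulo n, so only tuples k = (k_a) of strands {a, a + n, …, a + (k_a - 1)n} survive, and a partial
-- fraction identity sums the paths leading to k: P_{(m^r)} is a sum over |k| = r of a monomial times an
-- explicit product T(k). Now T(k) U(k) = ± (monomial) ∏_{a<b} (q^{a + n k_a} - q^{b + n k_b}) for a product
-- U(k) tending to (q; q)_∞^n. Expanding the Vandermonde factor, the sum over |k| = r becomes the
-- coefficient of z^r in an n × n determinant of power series in z. Its transpose arises in the same way
-- from n strands modulo κ and exponent m = 0, and there partial fractions give ∑_k T(k) = 1/(q^κ; q^κ)_r,
-- while U(k) tends to (q^κ; q^κ)_∞^n ∏ θ(q^{j-i}; q^κ). This proves the first formula. For its symmetry, let
-- A_j = ∏_{1≤d≤j} (q^d; q^κ)_∞ and B_j = ∏_{1≤d≤j} (q^{κ-d}; q^κ)_∞; the theta product is ∏_{j<n} A_j B_j, and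
-- A_j B_{κ-1-j} = (q; q)_∞ / (q^κ; q^κ)_∞ pairs off the factors with m ≤ j < n.
module Submission where

open import Defs
open import Algebra.Bundles using (CommutativeRing)
open import Level using (0ℓ)
open import Data.Nat using (ℕ; zero; suc; _∸_; _≤_; s≤s; z≤n; _<_; _<ᵇ_; _≡ᵇ_; _⊔_; _⊓_)
import Data.Nat as ℕ
import Data.Nat.Properties as ℕₚ
open import Data.Integer using (ℤ; +_; -[1+_])
import Data.Integer as ℤ
import Data.Integer.Properties as ℤₚ
open import Data.Maybe using (Maybe; just; nothing)
open import Relation.Nullary using (yes; no; ¬_; contradiction)
open import Relation.Binary.PropositionalEquality using (_≡_; refl; sym; trans; cong; cong₂; subst; _≢_; subst₂)
import Algebra.Solver.Ring
import Algebra.Solver.Ring.AlmostCommutativeRing as ACR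
import Algebra.Properties.Semiring.Mult
import Algebra.Properties.Monoid.Mult.TCOptimised
import Algebra.Properties.Ring
import Relation.Binary.Reasoning.Setoid
open import Data.List using (List; []; _∷_; map; _++_; length; downFrom; replicate; upTo; applyUpTo; concatMap; allFin; tabulate; foldr)
open import Data.List.Relation.Unary.All using (All; []; _∷_)
open import Data.List.Relation.Unary.AllPairs using (AllPairs; []; _∷_)
open import Data.List.Relation.Unary.Any using (here; there)
open import Data.List.Membership.Propositional using (_∈_)
open import Data.List.Relation.Binary.Permutation.Propositional using (_↭_; ↭-refl; ↭-sym; ↭-trans; prep; swap)
import Data.List.Relation.Binary.Permutation.Propositional as Perm
open import Data.List.Relation.Binary.Permutation.Propositional.Properties using (All-resp-↭; ∈-resp-↭; ↭-length; shift; shifts; ++⁺ˡ; ++⁺ʳ; ++⁺; ↭-reverse)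
import Data.List.Relation.Unary.All as All
open import Data.Product using (Σ; _×_; _,_; proj₁; proj₂)
open import Data.Bool using (true; false; if_then_else_; Bool)
open import Data.Nat.Tactic.RingSolver using (solve-∀)
open import Relation.Binary.Definitions using (tri<; tri≈; tri>)
open import Relation.Nullary.Decidable using (dec-true; dec-false)
open import Function using (_∘_)
import Data.List.Relation.Unary.AllPairs as AllPairs
import Data.List.Relation.Unary.AllPairs.Properties as AllPairs
open import Data.Nat.ListAction using (sum)
open import Data.List.Properties using (length-downFrom; length-map; ∷-injectiveˡ; ∷-injectiveʳ; ++-assoc; reverse-applyUpTo; map-downFrom; length-upTo; upTo-∷ʳ; map-id; map-tabulate; length-replicate)
open import Data.List.Membership.Propositional.Properties using (∈-∃++; ∈-map⁺; ∈-downFrom⁻; ∈-++⁺ʳ; ∈-applyUpTo⁻)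
open import Algebra.Structures using (IsCommutativeRing)
open import Data.Nat.Divisibility using (_∣_; _∣?_; ∣m+n∣m⇒∣n; ∣m∣n⇒∣m+n; ∣-refl; _∣0; ∣⇒≤)
open import Data.List.Relation.Unary.Unique.Propositional.Properties using (upTo⁺)
open import Data.Sum using (inj₁; inj₂)
open import Data.Fin using (Fin; zero; suc; toℕ; punchIn)
open import Data.List.Relation.Unary.All.Properties using (concat⁺; map⁺)

-- There is no quotient field to compute in: ratios such as q^x/(q^x - q^y) are built from inverses
-- of 1 - q^d, and rational identities are checked by cancelling the non-zero-divisors q^x - q^y.
-- The obstacle in the limit over r is that U(k) is close to its limit only if every part of k is
-- large, while compositions with small parts occur for every r. What saves the argument is that
-- T(k) is divisible by q^(k_a - k_b - 1) whenever k_a > k_b, so that T(k) times the error of U(k)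
-- is small as soon as one part is at least d, and r ≥ n d forces such a part. The same estimate
-- serves both moduli; in the first the monomial weight is split off beforehand. The factor (q^κ;
-- q^κ)_r from the second modulus is what lowers the exponent n of (q^κ; q^κ)_∞ to n - 1. The limit
-- over the number N of variables is a second approximation: residue classes are then cut off at
-- finite height, and the telescoping product along a class leaves a boundary term, which is 1
-- modulo q^d once N ≥ (r + d) n.

module IntegerCoefficients (R : CommutativeRing 0ℓ 0ℓ) where
  open CommutativeRing R renaming (refl to ≈-refl; sym to ≈-sym; trans to ≈-trans)
  open Algebra.Properties.Ring ring
  open Algebra.Properties.Semiring.Mult semiring renaming (_×_ to _×ₙ_)
  open Algebra.Properties.Monoid.Mult.TCOptimised +-monoid using (×ᵤ≈×) renaming (_×_ to _×′_)
  open Relation.Binary.Reasoning.Setoid setoid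

  ⟦_⟧ : ℤ → Carrier
  ⟦ + n ⟧      = n ×ₙ 1#
  ⟦ -[1+ n ] ⟧ = - (suc n ×ₙ 1#)

  ⟦⟧-⊖ : ∀ m n → ⟦ m ℤ.⊖ n ⟧ ≈ m ×ₙ 1# - n ×ₙ 1#
  ⟦⟧-⊖ m zero = ≈-sym (≈-trans (+-congˡ -0#≈0#) (+-identityʳ _))
  ⟦⟧-⊖ zero (suc n) = ≈-sym (+-identityˡ _)
  ⟦⟧-⊖ (suc m) (suc n) = begin
    ⟦ suc m ℤ.⊖ suc n ⟧               ≡⟨ cong ⟦_⟧ (ℤₚ.[1+m]⊖[1+n]≡m⊖n m n) ⟩
    ⟦ m ℤ.⊖ n ⟧                       ≈⟨ ⟦⟧-⊖ m n ⟩
    m ×ₙ 1# - n ×ₙ 1#                   ≈⟨ +-congʳ (+-identityˡ _) ⟨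
    (0# + m ×ₙ 1#) - n ×ₙ 1#            ≈⟨ +-congʳ (+-congʳ (-‿inverseʳ 1#)) ⟨
    ((1# - 1#) + m ×ₙ 1#) - n ×ₙ 1#     ≈⟨ +-congʳ (+-assoc _ _ _) ⟩
    (1# + (- 1# + m ×ₙ 1#)) - n ×ₙ 1#   ≈⟨ +-congʳ (+-congˡ (+-comm _ _)) ⟩
    (1# + (m ×ₙ 1# - 1#)) - n ×ₙ 1#     ≈⟨ +-congʳ (+-assoc _ _ _) ⟨
    (suc m ×ₙ 1# - 1#) - n ×ₙ 1#        ≈⟨ +-assoc _ _ _ ⟩
    suc m ×ₙ 1# + (- 1# - n ×ₙ 1#)      ≈⟨ +-congˡ (-‿+-comm 1# (n ×ₙ 1#)) ⟩
    suc m ×ₙ 1# - suc n ×ₙ 1#           ∎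

  ⟦⟧-- : ∀ i → ⟦ ℤ.- i ⟧ ≈ - ⟦ i ⟧
  ⟦⟧-- (+ zero)  = ≈-sym -0#≈0#
  ⟦⟧-- (+ suc n) = ≈-refl
  ⟦⟧-- -[1+ n ]  = ≈-sym (-‿involutive _)

  ⟦⟧-+ : ∀ i j → ⟦ i ℤ.+ j ⟧ ≈ ⟦ i ⟧ + ⟦ j ⟧
  ⟦⟧-+ (+ m)    (+ n)    = ×-homo-+ 1# m n
  ⟦⟧-+ (+ m)    -[1+ n ] = ⟦⟧-⊖ m (suc n)
  ⟦⟧-+ -[1+ m ] (+ n)    = ≈-trans (⟦⟧-⊖ n (suc m)) (+-comm _ _)
  ⟦⟧-+ -[1+ m ] -[1+ n ] = begin
    - (suc (suc (m ℕ.+ n)) ×ₙ 1#)   ≡⟨ cong (λ z → - (z ×ₙ 1#)) (sym (ℕₚ.+-suc (suc m) n)) ⟩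
    - ((suc m ℕ.+ suc n) ×ₙ 1#)     ≈⟨ -‿cong (×-homo-+ 1# (suc m) (suc n)) ⟩
    - (suc m ×ₙ 1# + suc n ×ₙ 1#)    ≈⟨ -‿+-comm _ _ ⟨
    - (suc m ×ₙ 1#) - suc n ×ₙ 1#    ∎

  ⟦⟧-*⁺ : ∀ m n → ⟦ + m ℤ.* + n ⟧ ≈ m ×ₙ 1# * n ×ₙ 1#
  ⟦⟧-*⁺ m n = ≈-trans (reflexive (cong ⟦_⟧ (sym (ℤₚ.pos-* m n)))) (×1-homo-* m n)

  ⟦⟧-*ˡ : ∀ m j → ⟦ + m ℤ.* j ⟧ ≈ m ×ₙ 1# * ⟦ j ⟧
  ⟦⟧-*ˡ m (+ n) = ⟦⟧-*⁺ m n
  ⟦⟧-*ˡ m -[1+ n ] = begin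
    ⟦ + m ℤ.* (ℤ.- (+ suc n)) ⟧   ≡⟨ cong ⟦_⟧ (sym (ℤₚ.neg-distribʳ-* (+ m) (+ suc n))) ⟩
    ⟦ ℤ.- (+ m ℤ.* + suc n) ⟧     ≈⟨ ⟦⟧-- (+ m ℤ.* + suc n) ⟩
    - ⟦ + m ℤ.* + suc n ⟧         ≈⟨ -‿cong (⟦⟧-*⁺ m (suc n)) ⟩
    - (m ×ₙ 1# * suc n ×ₙ 1#)        ≈⟨ -‿distribʳ-* _ _ ⟩
    m ×ₙ 1# * - (suc n ×ₙ 1#)        ∎

  ⟦⟧-* : ∀ i j → ⟦ i ℤ.* j ⟧ ≈ ⟦ i ⟧ * ⟦ j ⟧
  ⟦⟧-* (+ m) j = ⟦⟧-*ˡ m j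
  ⟦⟧-* -[1+ m ] j = begin
    ⟦ (ℤ.- (+ suc m)) ℤ.* j ⟧   ≡⟨ cong ⟦_⟧ (sym (ℤₚ.neg-distribˡ-* (+ suc m) j)) ⟩
    ⟦ ℤ.- (+ suc m ℤ.* j) ⟧     ≈⟨ ⟦⟧-- (+ suc m ℤ.* j) ⟩
    - ⟦ + suc m ℤ.* j ⟧         ≈⟨ -‿cong (⟦⟧-*ˡ (suc m) j) ⟩
    - (suc m ×ₙ 1# * ⟦ j ⟧)       ≈⟨ -‿distribˡ-* _ _ ⟩
    - (suc m ×ₙ 1#) * ⟦ j ⟧       ∎

  -- The same map, arranged so that 1 is sent to 1# on the nose.
  eval : ℤ → Carrier
  eval (+ n)    = n ×′ 1#
  eval -[1+ n ] = - (suc n ×′ 1#)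

  eval≈ : ∀ i → eval i ≈ ⟦ i ⟧
  eval≈ (+ n)    = ≈-sym (×ᵤ≈× n 1#)
  eval≈ -[1+ n ] = -‿cong (≈-sym (×ᵤ≈× (suc n) 1#))

  almostCommutativeRing : ACR.AlmostCommutativeRing 0ℓ 0ℓ
  almostCommutativeRing = ACR.fromCommutativeRing R

  morphism : ℤ.+-*-rawRing ACR.-Raw-AlmostCommutative⟶ almostCommutativeRing
  morphism = record
    { ⟦_⟧    = eval
    ; +-homo = λ i j → ≈-trans (eval≈ (i ℤ.+ j)) (≈-trans (⟦⟧-+ i j) (≈-sym (+-cong (eval≈ i) (eval≈ j))))
    ; *-homo = λ i j → ≈-trans (eval≈ (i ℤ.* j)) (≈-trans (⟦⟧-* i j) (≈-sym (*-cong (eval≈ i) (eval≈ j))))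
    ; -‿homo = λ i → ≈-trans (eval≈ (ℤ.- i)) (≈-trans (⟦⟧-- i) (-‿cong (≈-sym (eval≈ i))))
    ; 0-homo = ≈-refl
    ; 1-homo = ≈-refl
    }

  -- Coefficients are compared in ℤ, where equality is decidable, while `R` itself need not have
  -- decidable equality; this is what lets the solver cancel terms with signs.
  weak≟ : ∀ i j → Maybe (eval i ≈ eval j)
  weak≟ i j with i ℤₚ.≟ j
  ... | yes refl = just ≈-refl
  ... | no _     = nothing

  module Solver = Algebra.Solver.Ring ℤ.+-*-rawRing almostCommutativeRing morphism weak≟

-- Sums and products over selections from a list

module Folds (R : CommutativeRing 0ℓ 0ℓ) where
  open CommutativeRing R renaming (refl to ≈-refl; sym to ≈-sym; trans to ≈-trans)
  open IntegerCoefficients R using (module Solver)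
  open Solver using (solve; _:+_; _:*_; _:-_; :-_; con; _:=_)
  open Relation.Binary.Reasoning.Setoid setoid

  -- The summand receives the chosen entry together with the others, so that nested selections run
  -- over the orderings of a list.
  Sel : {A : Set} → (A → List A → Carrier) → List A → Carrier
  Sel f []       = 0#
  Sel f (x ∷ xs) = f x xs + Sel (λ y ys → f y (x ∷ ys)) xs

  -- Laplace expansion along a row: the sign flips with each entry passed over.
  Alt : {A : Set} → (A → List A → Carrier) → List A → Carrier
  Alt f []       = 0#
  Alt f (x ∷ xs) = f x xs - Alt (λ y ys → f y (x ∷ ys)) xs

  Prod : {A : Set} → (A → Carrier) → List A → Carrier
  Prod f []       = 1#
  Prod f (x ∷ xs) = f x * Prod f xs

  Sum : {A : Set} → (A → Carrier) → List A → Carrier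
  Sum f []       = 0#
  Sum f (x ∷ xs) = f x + Sum f xs

  Pairs : {A : Set} → (A → A → Carrier) → List A → Carrier
  Pairs f []       = 1#
  Pairs f (x ∷ xs) = Prod (f x) xs * Pairs f xs

  module _ {A : Set} where

    -- The permutation handed to the hypothesis lets properties of `L`, such as distinctness, be
    -- transported to the chosen entry and the rest.
    Sel-cong : {f g : A → List A → Carrier} (L : List A) →
      (∀ x r → L ↭ x ∷ r → f x r ≈ g x r) → Sel f L ≈ Sel g L
    Sel-cong []       h = ≈-refl
    Sel-cong (x ∷ xs) h = +-cong (h x xs ↭-refl)
      (Sel-cong xs λ y ys p → h y (x ∷ ys) (↭-trans (prep x p) (swap x y ↭-refl)))

    Alt-cong : {f g : A → List A → Carrier} (L : List A) →
      (∀ x r → L ↭ x ∷ r → f x r ≈ g x r) → Alt f L ≈ Alt g L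
    Alt-cong []       h = ≈-refl
    Alt-cong (x ∷ xs) h = +-cong (h x xs ↭-refl) (-‿cong
      (Alt-cong xs λ y ys p → h y (x ∷ ys) (↭-trans (prep x p) (swap x y ↭-refl))))

    Sel-↭ : (f : A → List A → Carrier) → (∀ x {r r′} → r ↭ r′ → f x r ≈ f x r′) →
      ∀ {L L′} → L ↭ L′ → Sel f L ≈ Sel f L′
    Sel-↭ f h Perm.refl        = ≈-refl
    Sel-↭ f h (prep x p)       = +-cong (h x p) (Sel-↭ _ (λ y q → h y (prep x q)) p)
    Sel-↭ f h (swap {xs} {ys} x y p) = begin
      f x (y ∷ xs) + (f y (x ∷ xs) + Sel (λ z zs → f z (x ∷ y ∷ zs)) xs)
        ≈⟨ +-cong (h x (prep y p)) (+-cong (h y (prep x p))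
             (≈-trans (Sel-↭ _ (λ z q → h z (prep x (prep y q))) p)
                      (Sel-cong ys λ z zs _ → h z (swap x y ↭-refl)))) ⟩
      f x (y ∷ ys) + (f y (x ∷ ys) + Sel (λ z zs → f z (y ∷ x ∷ zs)) ys)
        ≈⟨ solve 3 (λ a b c → a :+ (b :+ c) := b :+ (a :+ c)) ≈-refl _ _ _ ⟩
      f y (x ∷ ys) + (f x (y ∷ ys) + Sel (λ z zs → f z (y ∷ x ∷ zs)) ys) ∎
    Sel-↭ f h (Perm.trans p q) = ≈-trans (Sel-↭ f h p) (Sel-↭ f h q)

    Sel-linear : ∀ a b (f g : A → List A → Carrier) L →
      Sel (λ x r → a * f x r + b * g x r) L ≈ a * Sel f L + b * Sel g L
    Sel-linear a b f g []       = solve 2 (λ a b → con (+ 0) := a :* con (+ 0) :+ b :* con (+ 0)) ≈-refl a b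
    Sel-linear a b f g (x ∷ xs) = ≈-trans (+-congˡ (Sel-linear a b _ _ xs))
      (solve 6 (λ a b u v s t → (a :* u :+ b :* v) :+ (a :* s :+ b :* t) := a :* (u :+ s) :+ b :* (v :+ t))
        ≈-refl a b _ _ _ _)

    Sel-*ˡ : ∀ a (f : A → List A → Carrier) L → Sel (λ x r → a * f x r) L ≈ a * Sel f L
    Sel-*ˡ a f []       = ≈-sym (zeroʳ a)
    Sel-*ˡ a f (x ∷ xs) = ≈-trans (+-congˡ (Sel-*ˡ a _ xs)) (≈-sym (distribˡ a _ _))

    Sel-*ʳ : ∀ a (f : A → List A → Carrier) L → Sel (λ x r → f x r * a) L ≈ Sel f L * a
    Sel-*ʳ a f L = ≈-trans (Sel-cong L λ _ _ _ → *-comm _ a) (≈-trans (Sel-*ˡ a f L) (*-comm a _))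

    Alt-zero : (L : List A) → Alt (λ _ _ → 0#) L ≈ 0#
    Alt-zero []       = ≈-refl
    Alt-zero (x ∷ xs) = ≈-trans (+-congˡ (-‿cong (Alt-zero xs)))
      (solve 0 (con (+ 0) :- con (+ 0) := con (+ 0)) ≈-refl)

    Alt-*ˡ : ∀ a (f : A → List A → Carrier) L → Alt (λ x r → a * f x r) L ≈ a * Alt f L
    Alt-*ˡ a f []       = ≈-sym (zeroʳ a)
    Alt-*ˡ a f (x ∷ xs) = ≈-trans (+-congˡ (-‿cong (Alt-*ˡ a _ xs)))
      (solve 3 (λ a u v → a :* u :- a :* v := a :* (u :- v)) ≈-refl a _ _)

    Alt-minus : (f g : A → List A → Carrier) → ∀ L →
      Alt (λ x r → f x r - g x r) L ≈ Alt f L - Alt g L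
    Alt-minus f g []       = solve 0 (con (+ 0) := con (+ 0) :- con (+ 0)) ≈-refl
    Alt-minus f g (x ∷ xs) = ≈-trans (+-congˡ (-‿cong (Alt-minus _ _ xs)))
      (solve 4 (λ a b c d → (a :- b) :- (c :- d) := (a :- c) :- (b :- d)) ≈-refl _ _ _ _)

    Prod-cong : {f g : A → Carrier} (L : List A) → (∀ x → x ∈ L → f x ≈ g x) → Prod f L ≈ Prod g L
    Prod-cong []       h = ≈-refl
    Prod-cong (x ∷ xs) h = *-cong (h x (here refl)) (Prod-cong xs λ y m → h y (there m))

    Prod-* : (f g : A → Carrier) → ∀ L → Prod (λ x → f x * g x) L ≈ Prod f L * Prod g L
    Prod-* f g []       = ≈-sym (*-identityˡ 1#)
    Prod-* f g (x ∷ xs) = ≈-trans (*-congˡ (Prod-* f g xs))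
      (solve 4 (λ a b c d → (a :* b) :* (c :* d) := (a :* c) :* (b :* d)) ≈-refl _ _ _ _)

    Prod-1 : ∀ (L : List A) → Prod (λ _ → 1#) L ≈ 1#
    Prod-1 []       = ≈-refl
    Prod-1 (x ∷ xs) = ≈-trans (*-identityˡ _) (Prod-1 xs)

    Prod-++ : (f : A → Carrier) → ∀ K L → Prod f (K ++ L) ≈ Prod f K * Prod f L
    Prod-++ f []      L = ≈-sym (*-identityˡ _)
    Prod-++ f (x ∷ K) L = ≈-trans (*-congˡ (Prod-++ f K L)) (≈-sym (*-assoc _ _ _))

    Prod-↭ : (f : A → Carrier) → ∀ {L L′} → L ↭ L′ → Prod f L ≈ Prod f L′
    Prod-↭ f Perm.refl        = ≈-refl
    Prod-↭ f (prep x p)       = *-congˡ (Prod-↭ f p)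
    Prod-↭ f (swap x y p)     = ≈-trans (*-congˡ (*-congˡ (Prod-↭ f p)))
      (solve 3 (λ a b c → a :* (b :* c) := b :* (a :* c)) ≈-refl _ _ _)
    Prod-↭ f (Perm.trans p q) = ≈-trans (Prod-↭ f p) (Prod-↭ f q)

    Pairs-* : (f g : A → A → Carrier) → ∀ L → Pairs (λ x y → f x y * g x y) L ≈ Pairs f L * Pairs g L
    Pairs-* f g []       = ≈-sym (*-identityˡ 1#)
    Pairs-* f g (x ∷ xs) = ≈-trans (*-cong (Prod-* (f x) (g x) xs) (Pairs-* f g xs))
      (solve 4 (λ a b c d → (a :* b) :* (c :* d) := (a :* c) :* (b :* d)) ≈-refl _ _ _ _)

    Prod-cong-All : {P : A → Set} {f g : A → Carrier} (L : List A) → All P L →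
      (∀ x → x ∈ L → P x → f x ≈ g x) → Prod f L ≈ Prod g L
    Prod-cong-All []       []       h = ≈-refl
    Prod-cong-All (x ∷ xs) (p ∷ ps) h = *-cong (h x (here refl) p) (Prod-cong-All xs ps λ y m → h y (there m))

    Pairs-cong : {_#_ : A → A → Set} {f g : A → A → Carrier} (L : List A) → AllPairs _#_ L →
      (∀ x y → x ∈ L → y ∈ L → x # y → f x y ≈ g x y) → Pairs f L ≈ Pairs g L
    Pairs-cong           []       []       h = ≈-refl
    Pairs-cong {_#_} {f} {g} (x ∷ xs) (d ∷ ds) h = *-cong
      (Prod-cong-All {P = x #_} {f x} {g x} xs d λ y m → h x y (here refl) (there m))
      (Pairs-cong {_#_} {f} {g} xs ds λ y z m n → h y z (there m) (there n))

    Pairs-↭ : (f : A → A → Carrier) → (∀ x y → f x y ≈ f y x) →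
      ∀ {L L′} → L ↭ L′ → Pairs f L ≈ Pairs f L′
    Pairs-↭ f s Perm.refl        = ≈-refl
    Pairs-↭ f s (prep x p)       = *-cong (Prod-↭ (f x) p) (Pairs-↭ f s p)
    Pairs-↭ f s (swap x y p)     = ≈-trans
      (*-cong (*-cong (s x y) (Prod-↭ (f x) p)) (*-cong (Prod-↭ (f y) p) (Pairs-↭ f s p)))
      (solve 4 (λ a b c d → (a :* b) :* (c :* d) := (a :* c) :* (b :* d)) ≈-refl _ _ _ _)
    Pairs-↭ f s (Perm.trans p q) = ≈-trans (Pairs-↭ f s p) (Pairs-↭ f s q)

  Alt-swap : {A B : Set} (f : A → List A → B → List B → Carrier) → ∀ K L →
    Alt (λ x r → Alt (f x r) L) K ≈ Alt (λ y s → Alt (λ x r → f x r y s) K) L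
  Alt-swap f []      L = ≈-sym (Alt-zero L)
  Alt-swap f (x ∷ K) L = ≈-trans (+-congˡ (-‿cong (Alt-swap (λ y r → f y (x ∷ r)) K L)))
    (≈-sym (Alt-minus (f x K) (λ y s → Alt (λ x′ r → f x′ (x ∷ r) y s) K) L))

-- Partial fractions over a list of points

-- ψ x y stands for y / (x - y) (or, symmetrically, for x / (y - x)).
module PartialFractions
  (R : CommutativeRing 0ℓ 0ℓ) {A : Set} (_#_ : A → A → Set) (#-sym : ∀ {x y} → x # y → y # x)
  (ψ : A → A → CommutativeRing.Carrier R)
  (ψ-sum : ∀ {x y} → x # y → CommutativeRing._≈_ R (CommutativeRing._+_ R (ψ x y) (ψ y x))
    (CommutativeRing.-_ R (CommutativeRing.1# R)))
  (ψ-cocycle : ∀ {z x a} → z # x → z # a → x # a → CommutativeRing._≈_ R (CommutativeRing._*_ R (ψ z x) (ψ z a))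
    (CommutativeRing._+_ R (CommutativeRing._*_ R (ψ z x) (ψ x a)) (CommutativeRing._*_ R (ψ z a) (ψ a x))))
  (s : A → CommutativeRing.Carrier R) where
  open CommutativeRing R renaming (refl to ≈-refl; sym to ≈-sym; trans to ≈-trans)
  open Folds R
  open IntegerCoefficients R using (module Solver)
  open Solver using (solve; _:+_; _:*_; _:-_; :-_; con; _:=_)
  open Relation.Binary.Reasoning.Setoid setoid

  -- With ψ a b = b/(a - b) this is (a - s_b b)/(a - b).
  factor : A → A → Carrier
  factor a b = 1# + (1# - s b) * ψ a b

  -- Up to the factor a, the residue at z = a of the product of all (z - s_b b)/(z - b).
  residue : A → List A → Carrier
  residue a r = (1# - s a) * Prod (factor a) r

  -- Partial fraction expansion in z of a product whose value at infinity is 1. The induction uses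
  -- its hypothesis twice, at `z` and at the new point `x`; the cocycle relation reconciles the two.
  expand : ∀ z L → All (z #_) L → AllPairs _#_ L →
    Prod (factor z) L ≈ 1# + Sel (λ a r → ψ z a * residue a r) L
  expand z []      []       []       = ≈-sym (+-identityʳ 1#)
  expand z (x ∷ L) (d ∷ ds) (e ∷ es) = begin
    (1# + ex * ψ z x) * Prod (factor z) L
      ≈⟨ *-congˡ (expand z L ds es) ⟩
    (1# + ex * ψ z x) * (1# + Sel (λ a r → ψ z a * residue a r) L)
      ≈⟨ solve 4 (λ e p S T → (con (+ 1) :+ e :* p) :* (con (+ 1) :+ S)
            := con (+ 1) :+ (p :* (e :* (con (+ 1) :+ T)) :+ ((con (+ 1) :+ e :* p) :* S :+ :- (e :* p) :* T)))
          ≈-refl ex (ψ z x) _ _ ⟩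
    1# + (ψ z x * (ex * (1# + Sel (λ a r → ψ x a * residue a r) L))
          + ((1# + ex * ψ z x) * Sel (λ a r → ψ z a * residue a r) L
             + - (ex * ψ z x) * Sel (λ a r → ψ x a * residue a r) L))
      ≈⟨ +-congˡ (+-cong (*-congˡ (*-congˡ (≈-sym (expand x L e es))))
           (≈-sym (≈-trans (Sel-cong L term) (Sel-linear _ _ _ _ L)))) ⟩
    1# + Sel (λ a r → ψ z a * residue a r) (x ∷ L) ∎
    where
    ex = 1# - s x
    term : ∀ a r → L Perm.↭ a ∷ r → ψ z a * residue a (x ∷ r) ≈
      (1# + ex * ψ z x) * (ψ z a * residue a r) + - (ex * ψ z x) * (ψ x a * residue a r)
    term a r p with All-resp-↭ p ds | All-resp-↭ p e
    ... | za ∷ _ | xa ∷ _ = begin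
      ψ z a * ((1# - s a) * ((1# + ex * ψ a x) * Π))
        ≈⟨ solve 5 (λ p q e c d → p :* (c :* ((con (+ 1) :+ e :* q) :* d))
             := p :* (c :* d) :+ e :* (c :* d) :* (p :* q)) ≈-refl (ψ z a) (ψ a x) ex (1# - s a) Π ⟩
      ψ z a * ((1# - s a) * Π) + ex * ((1# - s a) * Π) * (ψ z a * ψ a x)
        ≈⟨ +-congˡ (*-congˡ (≈-trans
             (solve 2 (λ u v → u := (v :+ u) :- v) ≈-refl (ψ z a * ψ a x) (ψ z x * ψ x a))
             (+-congʳ (≈-sym (ψ-cocycle d za xa))))) ⟩
      ψ z a * ((1# - s a) * Π) + ex * ((1# - s a) * Π) * (ψ z x * ψ z a - ψ z x * ψ x a)
        ≈⟨ solve 5 (λ p q w e k → p :* k :+ e :* k :* (w :* p :- w :* q)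
             := (con (+ 1) :+ e :* w) :* (p :* k) :+ :- (e :* w) :* (q :* k))
             ≈-refl (ψ z a) (ψ x a) (ψ z x) ex ((1# - s a) * Π) ⟩
      _ ∎
      where Π = Prod (factor a) r

  -- This is `expand` evaluated at z = 0, where each a/(z - a) is -1 and the product is that of the
  -- s. The index type need not contain such a point, so the evaluation is replayed as an induction.
  residues : ∀ L → AllPairs _#_ L → Sel residue L ≈ 1# - Prod s L
  residues []      []       = solve 0 (con (+ 0) := con (+ 1) :- con (+ 1)) ≈-refl
  residues (x ∷ L) (e ∷ es) = begin
    ex * Prod (factor x) L + Sel (λ a r → residue a (x ∷ r)) L
      ≈⟨ +-cong (*-congˡ (expand x L e es)) (≈-trans (Sel-cong L term) (Sel-linear _ _ _ _ L)) ⟩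
    ex * (1# + Sel (λ a r → ψ x a * residue a r) L)
      + ((1# - ex) * Sel residue L + - ex * Sel (λ a r → ψ x a * residue a r) L)
      ≈⟨ solve 3 (λ e S T → e :* (con (+ 1) :+ T) :+ ((con (+ 1) :- e) :* S :+ :- e :* T)
           := e :+ (con (+ 1) :- e) :* S) ≈-refl ex _ _ ⟩
    ex + (1# - ex) * Sel residue L
      ≈⟨ +-congˡ (*-congˡ (residues L es)) ⟩
    ex + (1# - ex) * (1# - Prod s L)
      ≈⟨ solve 2 (λ s P → (con (+ 1) :- s) :+ (con (+ 1) :- (con (+ 1) :- s)) :* (con (+ 1) :- P)
           := con (+ 1) :- s :* P) ≈-refl (s x) (Prod s L) ⟩
    1# - s x * Prod s L ∎
    where
    ex = 1# - s x
    term : ∀ a r → L Perm.↭ a ∷ r → residue a (x ∷ r) ≈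
      (1# - ex) * residue a r + - ex * (ψ x a * residue a r)
    term a r p with All-resp-↭ p e
    ... | xa ∷ _ = begin
      (1# - s a) * ((1# + ex * ψ a x) * Π)
        ≈⟨ *-congˡ (*-congʳ (+-congˡ (*-congˡ (≈-trans
             (solve 2 (λ u v → v := (u :+ v) :- u) ≈-refl (ψ x a) (ψ a x)) (+-congʳ (ψ-sum xa)))))) ⟩
      (1# - s a) * ((1# + ex * (- 1# - ψ x a)) * Π)
        ≈⟨ solve 4 (λ c e q d → c :* ((con (+ 1) :+ e :* (:- con (+ 1) :- q)) :* d)
             := (con (+ 1) :- e) :* (c :* d) :+ :- e :* (q :* (c :* d))) ≈-refl (1# - s a) ex (ψ x a) Π ⟩
      _ ∎
      where Π = Prod (factor a) r

-- Determinants by Laplace expansion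

module Determinants (R : CommutativeRing 0ℓ 0ℓ) where
  open CommutativeRing R renaming (refl to ≈-refl; sym to ≈-sym; trans to ≈-trans)
  open Folds R
  open IntegerCoefficients R using (module Solver)
  open Solver using (solve; _:*_; _:=_)
  open Relation.Binary.Reasoning.Setoid setoid

  -- Rows and columns are indexed by lists of arbitrary type, so a minor is the same matrix on
  -- shorter lists.
  Det : {A B : Set} → (A → B → Carrier) → List A → List B → Carrier
  Det M []       ys = 1#
  Det M (x ∷ xs) ys = Alt (λ y r → M x y * Det M xs r) ys

  Det-cong : {A B : Set} {M N : A → B → Carrier} → (∀ x y → M x y ≈ N x y) →
    ∀ xs ys → Det M xs ys ≈ Det N xs ys
  Det-cong h []       ys = ≈-refl
  Det-cong h (x ∷ xs) ys = Alt-cong ys λ y r _ → *-cong (h x y) (Det-cong h xs r)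

  -- Expanding along the first row, and the minors along the first column, leaves a double sum that
  -- transposition preserves. The bound `n` drives the recursion because the hypothesis is also
  -- applied to the rows `x ∷ t`, which are not a tail of the given list.
  Det-transpose′ : {A B : Set} (M : A → B → Carrier) → ∀ n xs ys → length xs ≤ n → length xs ≡ length ys →
    Det M xs ys ≈ Det (λ y x → M x y) ys xs
  Det-transpose′ M n       []       []       _       _ = ≈-refl
  Det-transpose′ M (suc n) (x ∷ xs) (y ∷ ys) (s≤s p) q = begin
    M x y * Det M xs ys - Alt (λ z r → M x z * Det M xs (y ∷ r)) ys
      ≈⟨ +-cong (*-congˡ (Det-transpose′ M n xs ys p q′)) (-‿cong (begin
           Alt (λ z r → M x z * Det M xs (y ∷ r)) ys
             ≈⟨ Alt-cong ys (λ z r e → ≈-trans (*-congˡ (Det-transpose′ M n xs (y ∷ r) p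
                  (trans q′ (↭-length e)))) (≈-sym (Alt-*ˡ (M x z) _ xs))) ⟩
           Alt (λ z r → Alt (λ w t → M x z * (M w y * Det Mᵀ r t)) xs) ys
             ≈⟨ Alt-swap (λ z r w t → M x z * (M w y * Det Mᵀ r t)) ys xs ⟩
           Alt (λ w t → Alt (λ z r → M x z * (M w y * Det Mᵀ r t)) ys) xs
             ≈⟨ Alt-cong xs (λ w t e → ≈-trans (Alt-cong ys λ z r f →
                  ≈-trans (*-congˡ (*-congˡ (≈-sym (Det-transpose′ M n t r (small e) (len e f)))))
                    (solve 3 (λ a b c → a :* (b :* c) := b :* (a :* c)) ≈-refl _ _ _))
                  (≈-trans (Alt-*ˡ (M w y) _ ys)
                    (*-congˡ (Det-transpose′ M n (x ∷ t) ys (subst (_≤ n) (↭-length e) p)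
                      (trans (sym (↭-length e)) q′))))) ⟩
           Alt (λ w t → M w y * Det Mᵀ ys (x ∷ t)) xs ∎)) ⟩
    M x y * Det Mᵀ ys xs - Alt (λ w t → M w y * Det Mᵀ ys (x ∷ t)) xs ∎
    where
    Mᵀ = λ y x → M x y
    q′ = ℕₚ.suc-injective q
    len : ∀ {w t z r} → xs Perm.↭ w ∷ t → ys Perm.↭ z ∷ r → length t ≡ length r
    len e f = ℕₚ.suc-injective (trans (sym (↭-length e)) (trans q′ (↭-length f)))
    small : ∀ {w t} → xs Perm.↭ w ∷ t → length t ≤ n
    small e = ℕₚ.≤-trans (ℕₚ.n≤1+n _) (subst (_≤ n) (↭-length e) p)

  Det-transpose : {A B : Set} (M : A → B → Carrier) → ∀ xs ys → length xs ≡ length ys →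
    Det M xs ys ≈ Det (λ y x → M x y) ys xs
  Det-transpose M xs ys = Det-transpose′ M (length xs) xs ys ℕₚ.≤-refl

-- Power series in an auxiliary variable

module PowerSeries (R : CommutativeRing 0ℓ 0ℓ) where
  open CommutativeRing R renaming (refl to ≈-refl; sym to ≈-sym; trans to ≈-trans)
  open IntegerCoefficients R using (module Solver)
  open Solver using (solve; _:+_; _:*_; _:=_)
  open Relation.Binary.Reasoning.Setoid setoid

  Conv : ℕ → (ℕ → ℕ → Carrier) → Carrier
  Conv zero    h = h 0 0
  Conv (suc r) h = h 0 (suc r) + Conv r (λ i j → h (suc i) j)

  Conv-cong : ∀ r {h k : ℕ → ℕ → Carrier} → (∀ i j → i ℕ.+ j ≡ r → h i j ≈ k i j) → Conv r h ≈ Conv r k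
  Conv-cong zero    e = e 0 0 refl
  Conv-cong (suc r) e = +-cong (e 0 (suc r) refl) (Conv-cong r λ i j p → e (suc i) j (cong suc p))

  Conv-+ : ∀ r (h k : ℕ → ℕ → Carrier) → Conv r (λ i j → h i j + k i j) ≈ Conv r h + Conv r k
  Conv-+ zero    h k = ≈-refl
  Conv-+ (suc r) h k = ≈-trans (+-congˡ (Conv-+ r _ _))
    (solve 4 (λ a b c d → (a :+ b) :+ (c :+ d) := (a :+ c) :+ (b :+ d)) ≈-refl _ _ _ _)

  Conv-*ˡ : ∀ r a (h : ℕ → ℕ → Carrier) → Conv r (λ i j → a * h i j) ≈ a * Conv r h
  Conv-*ˡ zero    a h = ≈-refl
  Conv-*ˡ (suc r) a h = ≈-trans (+-congˡ (Conv-*ˡ r a _)) (≈-sym (distribˡ a _ _))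

  Conv-0 : ∀ r → Conv r (λ _ _ → 0#) ≈ 0#
  Conv-0 zero    = ≈-refl
  Conv-0 (suc r) = ≈-trans (+-congˡ (Conv-0 r)) (+-identityˡ 0#)

  Conv-last : ∀ r (h : ℕ → ℕ → Carrier) → Conv (suc r) h ≈ Conv r (λ i j → h i (suc j)) + h (suc r) 0
  Conv-last zero    h = ≈-refl
  Conv-last (suc r) h = ≈-trans (+-congˡ (Conv-last r (λ i j → h (suc i) j))) (≈-sym (+-assoc _ _ _))

  Conv-flip : ∀ r (h : ℕ → ℕ → Carrier) → Conv r h ≈ Conv r (λ i j → h j i)
  Conv-flip zero    h = ≈-refl
  Conv-flip (suc r) h = ≈-trans (+-comm _ _)
    (≈-trans (+-congʳ (Conv-flip r _)) (≈-sym (Conv-last r (λ i j → h j i))))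

  Conv-assoc : ∀ r (F : ℕ → ℕ → ℕ → Carrier) →
    Conv r (λ i c → Conv i (λ a b → F a b c)) ≈ Conv r (λ a k → Conv k (λ b c → F a b c))
  Conv-assoc zero    F = ≈-refl
  Conv-assoc (suc r) F = begin
    F 0 0 (suc r) + Conv r (λ i c → F 0 (suc i) c + Conv i (λ a b → F (suc a) b c))
      ≈⟨ +-congˡ (Conv-+ r _ _) ⟩
    F 0 0 (suc r) + (Conv r (λ i c → F 0 (suc i) c) + Conv r (λ i c → Conv i (λ a b → F (suc a) b c)))
      ≈⟨ +-assoc _ _ _ ⟨
    Conv (suc r) (F 0) + Conv r (λ i c → Conv i (λ a b → F (suc a) b c))
      ≈⟨ +-congˡ (Conv-assoc r (λ a → F (suc a))) ⟩
    _ ∎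

  infixl 7 _⊛_
  _⊛_ : (ℕ → Carrier) → (ℕ → Carrier) → ℕ → Carrier
  (f ⊛ g) r = Conv r (λ i j → f i * g j)

  one : ℕ → Carrier
  one zero    = 1#
  one (suc _) = 0#

  ⊛-comm : ∀ f g r → (f ⊛ g) r ≈ (g ⊛ f) r
  ⊛-comm f g r = ≈-trans (Conv-flip r _) (Conv-cong r λ i j _ → *-comm _ _)

  ⊛-assoc : ∀ f g h r → ((f ⊛ g) ⊛ h) r ≈ (f ⊛ (g ⊛ h)) r
  ⊛-assoc f g h r = begin
    Conv r (λ i c → Conv i (λ a b → f a * g b) * h c)
      ≈⟨ Conv-cong r (λ i c _ → ≈-trans (*-comm _ _) (≈-sym (Conv-*ˡ i (h c) _))) ⟩
    Conv r (λ i c → Conv i (λ a b → h c * (f a * g b)))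
      ≈⟨ Conv-assoc r (λ a b c → h c * (f a * g b)) ⟩
    Conv r (λ a k → Conv k (λ b c → h c * (f a * g b)))
      ≈⟨ Conv-cong r (λ a k _ → ≈-trans (Conv-cong k λ b c _ →
           solve 3 (λ x y z → z :* (x :* y) := x :* (y :* z)) ≈-refl (f a) (g b) (h c)) (Conv-*ˡ k (f a) _)) ⟩
    Conv r (λ a k → f a * Conv k (λ b c → g b * h c)) ∎

  ⊛-identityˡ : ∀ f r → (one ⊛ f) r ≈ f r
  ⊛-identityˡ f zero    = *-identityˡ _
  ⊛-identityˡ f (suc r) = ≈-trans (+-cong (*-identityˡ _)
    (≈-trans (Conv-cong r λ _ _ _ → zeroˡ _) (Conv-0 r))) (+-identityʳ _)

  ⊛-distribˡ : ∀ f g h r → (f ⊛ (λ k → g k + h k)) r ≈ (f ⊛ g) r + (f ⊛ h) r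
  ⊛-distribˡ f g h r = ≈-trans (Conv-cong r λ _ _ _ → distribˡ _ _ _) (Conv-+ r _ _)

  ⊛-cong : ∀ {f f′ g g′} → (∀ r → f r ≈ f′ r) → (∀ r → g r ≈ g′ r) → ∀ r → (f ⊛ g) r ≈ (f′ ⊛ g′) r
  ⊛-cong p q r = Conv-cong r λ i j _ → *-cong (p i) (q j)

  powerSeries : CommutativeRing 0ℓ 0ℓ
  powerSeries = record
    { Carrier = ℕ → Carrier ; _≈_ = λ f g → ∀ r → f r ≈ g r
    ; _+_ = λ f g r → f r + g r ; _*_ = _⊛_ ; -_ = λ f r → - f r ; 0# = λ _ → 0# ; 1# = one
    ; isCommutativeRing = record
      { isRing = record
        { +-isAbelianGroup = record
          { isGroup = record
            { isMonoid = record
              { isSemigroup = record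
                { isMagma = record
                  { isEquivalence = record
                    { refl = λ _ → ≈-refl ; sym = λ p r → ≈-sym (p r) ; trans = λ p q r → ≈-trans (p r) (q r) }
                  ; ∙-cong = λ p q r → +-cong (p r) (q r) }
                ; assoc = λ f g h r → +-assoc _ _ _ }
              ; identity = (λ f r → +-identityˡ _) , (λ f r → +-identityʳ _) }
            ; inverse = (λ f r → -‿inverseˡ _) , (λ f r → -‿inverseʳ _)
            ; ⁻¹-cong = λ p r → -‿cong (p r) }
          ; comm = λ f g r → +-comm _ _ }
        ; *-cong = ⊛-cong
        ; *-assoc = ⊛-assoc
        ; *-identity = ⊛-identityˡ , λ f r → ≈-trans (⊛-comm f one r) (⊛-identityˡ f r)
        ; distrib = ⊛-distribˡ , λ f g h r → ≈-trans (⊛-comm (λ k → g k + h k) f r)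
            (≈-trans (⊛-distribˡ f g h r) (+-cong (⊛-comm f g r) (⊛-comm f h r))) }
      ; *-comm = ⊛-comm } }

-- Sums over compositions

module Compositions (R : CommutativeRing 0ℓ 0ℓ) where
  open CommutativeRing R renaming (refl to ≈-refl; sym to ≈-sym; trans to ≈-trans)
  open Folds R
  open Determinants R
  open PowerSeries R
  open IntegerCoefficients R using (module Solver)
  open Solver using (solve; _:*_; _:-_; :-_; con; _:=_)
  open Relation.Binary.Reasoning.Setoid setoid

  module PSFolds = Folds powerSeries
  module PSDet = Determinants powerSeries

  total : {A : Set} → List (A × ℕ) → ℕ
  total []            = 0
  total ((_ , k) ∷ S) = k ℕ.+ total S

  Cmp : {A : Set} → List A → ℕ → (List (A × ℕ) → Carrier) → Carrier
  Cmp []       zero    f = f []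
  Cmp []       (suc r) f = 0#
  Cmp (z ∷ zs) r       f = Conv r (λ i j → Cmp zs j (λ S → f ((z , i) ∷ S)))

  module _ {A : Set} where

    Cmp-cong : ∀ (zs : List A) r {f g : List (A × ℕ) → Carrier} →
      (∀ S → map proj₁ S ≡ zs → total S ≡ r → f S ≈ g S) → Cmp zs r f ≈ Cmp zs r g
    Cmp-cong []       zero    h = h [] refl refl
    Cmp-cong []       (suc r) h = ≈-refl
    Cmp-cong (z ∷ zs) r       h = Conv-cong r λ i j p → Cmp-cong zs j λ S m t →
      h ((z , i) ∷ S) (cong (z ∷_) m) (trans (cong (i ℕ.+_) t) p)

    Cmp-*ˡ : ∀ (zs : List A) r a f → Cmp zs r (λ S → a * f S) ≈ a * Cmp zs r f
    Cmp-*ˡ []       zero    a f = ≈-refl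
    Cmp-*ˡ []       (suc r) a f = ≈-sym (zeroʳ a)
    Cmp-*ˡ (z ∷ zs) r       a f = ≈-trans (Conv-cong r λ i j _ → Cmp-*ˡ zs j a _) (Conv-*ˡ r a _)

    Cmp-+ : ∀ (zs : List A) r f g → Cmp zs r (λ S → f S + g S) ≈ Cmp zs r f + Cmp zs r g
    Cmp-+ []       zero    f g = ≈-refl
    Cmp-+ []       (suc r) f g = ≈-sym (+-identityˡ 0#)
    Cmp-+ (z ∷ zs) r       f g = ≈-trans (Conv-cong r λ i j _ → Cmp-+ zs j _ _) (Conv-+ r _ _)

    Cmp-0 : ∀ (zs : List A) r → Cmp zs r (λ _ → 0#) ≈ 0#
    Cmp-0 []       zero    = ≈-refl
    Cmp-0 []       (suc r) = ≈-refl
    Cmp-0 (z ∷ zs) r       = ≈-trans (Conv-cong r λ i j _ → Cmp-0 zs j) (Conv-0 r)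

    Cmp-zero : ∀ (zs : List A) f → Cmp zs 0 f ≈ f (map (_, 0) zs)
    Cmp-zero []       f = ≈-refl
    Cmp-zero (z ∷ zs) f = Cmp-zero zs _

    Cmp-minus : ∀ (zs : List A) r f g → Cmp zs r (λ S → f S - g S) ≈ Cmp zs r f - Cmp zs r g
    Cmp-minus zs r f g = ≈-trans (Cmp-+ zs r f (λ S → - g S)) (+-congˡ
      (≈-trans (Cmp-cong zs r λ S _ _ → solve 1 (λ x → :- x := :- con (+ 1) :* x) ≈-refl (g S))
        (≈-trans (Cmp-*ˡ zs r (- 1#) g) (solve 1 (λ x → :- con (+ 1) :* x := :- x) ≈-refl _))))

    Cmp-Alt : ∀ {B : Set} (zs : List A) r (f : B → List B → List (A × ℕ) → Carrier) ys →
      Cmp zs r (λ S → Alt (λ y t → f y t S) ys) ≈ Alt (λ y t → Cmp zs r (f y t)) ys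
    Cmp-Alt zs r f []       = Cmp-0 zs r
    Cmp-Alt zs r f (y ∷ ys) = ≈-trans (Cmp-minus zs r _ _) (+-congˡ (-‿cong (Cmp-Alt zs r _ ys)))

    PSAlt-coefficient : ∀ {B : Set} (f : B → List B → ℕ → Carrier) ys r →
      PSFolds.Alt f ys r ≈ Alt (λ y t → f y t r) ys
    PSAlt-coefficient f []       r = ≈-refl
    PSAlt-coefficient f (y ∷ ys) r = +-congˡ (-‿cong (PSAlt-coefficient _ ys r))

    Conv-Alt : ∀ {B : Set} r (f : B → List B → ℕ → ℕ → Carrier) ys →
      Conv r (λ i j → Alt (λ y t → f y t i j) ys) ≈ Alt (λ y t → Conv r (f y t)) ys
    Conv-Alt r f []       = Conv-0 r
    Conv-Alt r f (y ∷ ys) = begin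
      Conv r (λ i j → f y ys i j - Alt (λ z t → f z (y ∷ t) i j) ys)
        ≈⟨ Conv-+ r _ _ ⟩
      Conv r (f y ys) + Conv r (λ i j → - Alt (λ z t → f z (y ∷ t) i j) ys)
        ≈⟨ +-congˡ (≈-trans (Conv-cong r λ i j _ → solve 1 (λ x → :- x := :- con (+ 1) :* x) ≈-refl _)
             (≈-trans (Conv-*ˡ r (- 1#) _) (solve 1 (λ x → :- con (+ 1) :* x := :- x) ≈-refl _))) ⟩
      Conv r (f y ys) - Conv r (λ i j → Alt (λ z t → f z (y ∷ t) i j) ys)
        ≈⟨ +-congˡ (-‿cong (Conv-Alt r _ ys)) ⟩
      _ ∎

    -- Each row involves the part of its own residue only, so multilinearity turns the sum over |k|
    -- = r into a coefficient of a determinant of generating series.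
    Cmp-Det : ∀ {B : Set} (M : A → B → ℕ → Carrier) zs ys r →
      Cmp zs r (λ S → Det (λ a y → M (proj₁ a) y (proj₂ a)) S ys) ≈ PSDet.Det M zs ys r
    Cmp-Det M []       ys zero    = ≈-refl
    Cmp-Det M []       ys (suc r) = ≈-refl
    Cmp-Det M (z ∷ zs) ys r       = begin
      Conv r (λ i j → Cmp zs j (λ S → Alt (λ y t → M z y i * D S t) ys))
        ≈⟨ Conv-cong r (λ i j _ → ≈-trans (Cmp-Alt zs j _ ys) (Alt-cong ys λ y t _ →
             ≈-trans (Cmp-*ˡ zs j (M z y i) _) (*-congˡ (Cmp-Det M zs t j)))) ⟩
      Conv r (λ i j → Alt (λ y t → M z y i * PSDet.Det M zs t j) ys)
        ≈⟨ Conv-Alt r (λ y t i j → M z y i * PSDet.Det M zs t j) ys ⟩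
      Alt (λ y t → (M z y ⊛ PSDet.Det M zs t) r) ys
        ≈⟨ PSAlt-coefficient (λ y t → M z y ⊛ PSDet.Det M zs t) ys r ⟨
      PSDet.Det M (z ∷ zs) ys r ∎
      where D = λ S t → Det (λ a y → M (proj₁ a) y (proj₂ a)) S t

    raised : (A × ℕ → List (A × ℕ) → Carrier) → A × ℕ → List (A × ℕ) → Carrier
    raised f (z , zero)  r = 0#
    raised f (z , suc k) r = f (z , k) r

    -- Compositions of r with a marked part correspond to compositions of r + 1 with a marked
    -- positive part. On a marked zero part, which has no preimage, `raised` returns 0.
    Cmp-raise : ∀ (zs : List A) r (f : A × ℕ → List (A × ℕ) → Carrier) →
      Cmp zs r (Sel f) ≈ Cmp zs (suc r) (Sel (raised f))
    Cmp-raise []       zero    f = ≈-refl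
    Cmp-raise []       (suc r) f = ≈-refl
    Cmp-raise (z ∷ zs) r       f = begin
      Conv r (λ i j → Cmp zs j (λ S → f (z , i) S + Sel (λ y t → f y ((z , i) ∷ t)) S))
        ≈⟨ ≈-trans (Conv-cong r λ i j _ → Cmp-+ zs j _ _) (Conv-+ r _ _) ⟩
      Conv r (λ i j → Cmp zs j (f (z , i))) + Conv r (λ i j → Cmp zs j (Sel (λ y t → f y ((z , i) ∷ t))))
        ≈⟨ +-cong
             (≈-trans (≈-sym (+-identityˡ _)) (+-congʳ (≈-sym (Cmp-0 zs (suc r)))))
             (≈-trans (Conv-cong r λ i j _ → ≈-trans (Cmp-raise zs j _)
                  (Cmp-cong zs (suc j) λ S _ _ → Sel-cong S λ { (y , zero) t _ → ≈-refl ; (y , suc k) t _ → ≈-refl }))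
               (≈-trans (≈-sym (+-identityʳ _)) (+-congˡ (≈-sym last≈0)))) ⟩
      Conv (suc r) (λ i j → Cmp zs j (raised f (z , i)))
        + (Conv r (λ i j → Cmp zs (suc j) (g i)) + Cmp zs 0 (g (suc r)))
        ≈⟨ +-congˡ (Conv-last r (λ i j → Cmp zs j (g i))) ⟨
      Conv (suc r) (λ i j → Cmp zs j (raised f (z , i))) + Conv (suc r) (λ i j → Cmp zs j (g i))
        ≈⟨ ≈-trans (Conv-cong (suc r) λ i j _ → Cmp-+ zs j (raised f (z , i)) (g i))
             (Conv-+ (suc r) (λ i j → Cmp zs j (raised f (z , i))) (λ i j → Cmp zs j (g i))) ⟨
      Conv (suc r) (λ i j → Cmp zs j (λ S → raised f (z , i) S + g i S)) ∎
      where
      g : ℕ → List (A × ℕ) → Carrier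
      g i = Sel (λ y t → raised f y ((z , i) ∷ t))
      zeros : ∀ i (ys : List A) (h : List (A × ℕ) → List (A × ℕ)) →
        Sel (λ y t → raised f y (h t)) (map (_, 0) ys) ≈ 0#
      zeros i []       h = ≈-refl
      zeros i (y ∷ ys) h = ≈-trans (+-identityˡ _) (zeros i ys (λ t → h ((y , 0) ∷ t)))
      -- Degree r + 1 has one more term, with the whole total in the first part; every other marked
      -- part is then zero.
      last≈0 : Cmp zs 0 (g (suc r)) ≈ 0#
      last≈0 = ≈-trans (Cmp-zero zs _) (zeros 0 zs (λ t → (z , suc r) ∷ t))

AllPairs-↭ : {A : Set} {P : A → A → Set} → (∀ {x y} → P x y → P y x) →
  ∀ {L L′} → L ↭ L′ → AllPairs P L → AllPairs P L′
AllPairs-↭ s Perm.refl        ds = ds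
AllPairs-↭ s (prep x p)       (d ∷ ds) = All-resp-↭ p d ∷ AllPairs-↭ s p ds
AllPairs-↭ s (swap x y p)     ((e ∷ d) ∷ d′ ∷ ds) =
  (s e ∷ All-resp-↭ p d′) ∷ All-resp-↭ p d ∷ AllPairs-↭ s p ds
AllPairs-↭ s (Perm.trans p q) ds = AllPairs-↭ s q (AllPairs-↭ s p ds)

-- Quotients of powers of q

-- X k plays the role of q^k, and g d that of 1/(1 - q^d) for d > 0.
record QRing : Set₁ where
  field
    base : CommutativeRing 0ℓ 0ℓ
  open CommutativeRing base using (Carrier; _≈_; _*_; _-_; 1#)
  field
    X        : ℕ → Carrier
    X-0      : X 0 ≈ 1#
    X-+      : ∀ a b → X (a ℕ.+ b) ≈ X a * X b
    X-cancel : ∀ a {u v} → X a * u ≈ X a * v → u ≈ v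
    g        : ℕ → Carrier
    g-suc    : ∀ d → (1# - X (suc d)) * g (suc d) ≈ 1#

module Monomials (Q : QRing) where
  open QRing Q
  open CommutativeRing base renaming (refl to ≈-refl; sym to ≈-sym; trans to ≈-trans)
  open IntegerCoefficients base using (module Solver)
  open Solver using (solve; _:+_; _:*_; _:-_; :-_; con; _:=_)
  open Relation.Binary.Reasoning.Setoid setoid

  X≡ : ∀ {a b} → a ≡ b → X a ≈ X b
  X≡ e = reflexive (cong X e)

  X-≤ : ∀ {a b} → a ≤ b → X b ≈ X a * X (b ∸ a)
  X-≤ {a} {b} p = ≈-trans (X≡ (sym (ℕₚ.m+[n∸m]≡n p))) (X-+ a (b ∸ a))

  g-inverse : ∀ {d} → 0 < d → (1# - X d) * g d ≈ 1#
  g-inverse {suc d} _ = g-suc d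

  one-cancel : ∀ {d} → 0 < d → ∀ {u v} → (1# - X d) * u ≈ (1# - X d) * v → u ≈ v
  one-cancel {d} p {u} {v} e = begin
    u                          ≈⟨ undo u ⟨
    g d * ((1# - X d) * u)     ≈⟨ *-congˡ e ⟩
    g d * ((1# - X d) * v)     ≈⟨ undo v ⟩
    v                          ∎
    where
    undo : ∀ w → g d * ((1# - X d) * w) ≈ w
    undo w = ≈-trans (solve 3 (λ g x w → g :* (x :* w) := (x :* g) :* w) ≈-refl (g d) (1# - X d) w)
      (≈-trans (*-congʳ (g-inverse p)) (*-identityˡ w))

  difference-< : ∀ {x y} → x < y → X x - X y ≈ X x * (1# - X (y ∸ x))
  difference-< {x} {y} p = ≈-trans (+-congˡ (-‿cong (X-≤ (ℕₚ.<⇒≤ p))))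
    (solve 2 (λ a b → a :- a :* b := a :* (con (+ 1) :- b)) ≈-refl (X x) (X (y ∸ x)))

  cancel-< : ∀ {x y} → x < y → ∀ {u v} → (X x - X y) * u ≈ (X x - X y) * v → u ≈ v
  cancel-< {x} {y} p {u} {v} e = one-cancel (ℕₚ.m<n⇒0<n∸m p) (X-cancel x
    (≈-trans (split u) (≈-trans e (≈-sym (split v)))))
    where
    split : ∀ w → X x * ((1# - X (y ∸ x)) * w) ≈ (X x - X y) * w
    split w = ≈-trans (≈-sym (*-assoc _ _ w)) (*-congʳ (≈-sym (difference-< p)))

  -- Up to sign q^x - q^y is a monomial times some 1 - q^d with d > 0. Rational identities below are
  -- proved by multiplying out and cancelling such differences.
  cancel : ∀ {x y} → x ≢ y → ∀ {u v} → (X x - X y) * u ≈ (X x - X y) * v → u ≈ v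
  cancel {x} {y} ne {u} {v} e with ℕₚ.<-cmp x y
  ... | tri< p _ _ = cancel-< p e
  ... | tri≈ _ p _ = contradiction p ne
  ... | tri> _ _ p = cancel-< p (≈-trans (neg u) (≈-trans (-‿cong e) (≈-sym (neg v))))
    where
    neg : ∀ w → (X y - X x) * w ≈ - ((X x - X y) * w)
    neg w = solve 3 (λ x y w → (y :- x) :* w := :- ((x :- y) :* w)) ≈-refl (X x) (X y) w

  -- p x y = q^x / (q^x - q^y), expanded as a power series in q.
  p : ℕ → ℕ → Carrier
  p x y = if x <ᵇ y then g (y ∸ x) else - (X (x ∸ y) * g (x ∸ y))

  p-< : ∀ {x y} → x < y → p x y ≡ g (y ∸ x)
  p-< {x} {y} l = cong (λ b → if b then g (y ∸ x) else - (X (x ∸ y) * g (x ∸ y))) (dec-true (x ℕ.<? y) l)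

  p-> : ∀ {x y} → y < x → p x y ≡ - (X (x ∸ y) * g (x ∸ y))
  p-> {x} {y} l = cong (λ b → if b then g (y ∸ x) else - (X (x ∸ y) * g (x ∸ y))) (dec-false (x ℕ.<? y) (ℕₚ.<⇒≯ l))

  p-spec : ∀ {x y} → x ≢ y → (X x - X y) * p x y ≈ X x
  p-spec {x} {y} ne with ℕₚ.<-cmp x y
  ... | tri≈ _ e _ = contradiction e ne
  ... | tri< l _ _ = begin
    (X x - X y) * p x y                      ≈⟨ *-cong (difference-< l) (reflexive (p-< l)) ⟩
    X x * (1# - X (y ∸ x)) * g (y ∸ x)       ≈⟨ *-assoc _ _ _ ⟩
    X x * ((1# - X (y ∸ x)) * g (y ∸ x))     ≈⟨ *-congˡ (g-inverse (ℕₚ.m<n⇒0<n∸m l)) ⟩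
    X x * 1#                                 ≈⟨ *-identityʳ _ ⟩
    X x                                      ∎
  ... | tri> _ _ l = begin
    (X x - X y) * p x y
      ≈⟨ *-congˡ (reflexive (p-> l)) ⟩
    (X x - X y) * - (X (x ∸ y) * g (x ∸ y))
      ≈⟨ solve 4 (λ x y d g → (x :- y) :* :- (d :* g) := (y :- x) :* (d :* g)) ≈-refl (X x) (X y) _ _ ⟩
    (X y - X x) * (X (x ∸ y) * g (x ∸ y))
      ≈⟨ *-congʳ (difference-< l) ⟩
    X y * (1# - X (x ∸ y)) * (X (x ∸ y) * g (x ∸ y))
      ≈⟨ solve 4 (λ y d e g → y :* e :* (d :* g) := y :* d :* (e :* g)) ≈-refl (X y) _ _ _ ⟩
    X y * X (x ∸ y) * ((1# - X (x ∸ y)) * g (x ∸ y))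
      ≈⟨ *-cong (≈-sym (X-≤ (ℕₚ.<⇒≤ l))) (g-inverse (ℕₚ.m<n⇒0<n∸m l)) ⟩
    X x * 1#
      ≈⟨ *-identityʳ _ ⟩
    X x ∎

  p-unique : ∀ {x y u} → x ≢ y → (X x - X y) * u ≈ X x → u ≈ p x y
  p-unique ne e = cancel ne (≈-trans e (≈-sym (p-spec ne)))

  p-shift : ∀ {x y} e → x ≢ y → p (x ℕ.+ e) (y ℕ.+ e) ≈ p x y
  p-shift {x} {y} e ne = ≈-sym (p-unique (λ q → ne (ℕₚ.+-cancelʳ-≡ e x y q)) (begin
    (X (x ℕ.+ e) - X (y ℕ.+ e)) * p x y   ≈⟨ *-congʳ (+-cong (X-+ x e) (-‿cong (X-+ y e))) ⟩
    (X x * X e - X y * X e) * p x y       ≈⟨ solve 4 (λ x y e p → (x :* e :- y :* e) :* p := ((x :- y) :* p) :* e) ≈-refl _ _ _ _ ⟩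
    ((X x - X y) * p x y) * X e           ≈⟨ *-congʳ (p-spec ne) ⟩
    X x * X e                             ≈⟨ X-+ x e ⟨
    X (x ℕ.+ e)                           ∎))

  ψ : ℕ → ℕ → Carrier
  ψ x y = p x y - 1#

  ψ-spec : ∀ {x y} → x ≢ y → (X x - X y) * ψ x y ≈ X y
  ψ-spec {x} {y} ne = ≈-trans
    (solve 3 (λ x y p → (x :- y) :* (p :- con (+ 1)) := (x :- y) :* p :- (x :- y)) ≈-refl (X x) (X y) (p x y))
    (≈-trans (+-congʳ (p-spec ne)) (solve 2 (λ x y → x :- (x :- y) := y) ≈-refl (X x) (X y)))

  ψ-sum : ∀ {x y} → x ≢ y → ψ x y + ψ y x ≈ - 1#
  ψ-sum {x} {y} ne = cancel ne (begin
    (X x - X y) * (ψ x y + ψ y x)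
      ≈⟨ solve 4 (λ x y u v → (x :- y) :* (u :+ v) := (x :- y) :* u :- (y :- x) :* v) ≈-refl (X x) (X y) _ _ ⟩
    (X x - X y) * ψ x y - (X y - X x) * ψ y x
      ≈⟨ +-cong (ψ-spec ne) (-‿cong (ψ-spec (ne ∘ sym))) ⟩
    X y - X x
      ≈⟨ solve 2 (λ x y → y :- x := (x :- y) :* :- con (+ 1)) ≈-refl (X x) (X y) ⟩
    (X x - X y) * - 1# ∎)

  ψ-cocycle : ∀ {z x a} → z ≢ x → z ≢ a → x ≢ a → ψ z x * ψ z a ≈ ψ z x * ψ x a + ψ z a * ψ a x
  ψ-cocycle {z} {x} {a} zx za xa = cancel zx (cancel za (cancel xa (begin
    (X x - X a) * ((X z - X a) * ((X z - X x) * (ψ z x * ψ z a)))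
      ≈⟨ solve 5 (λ x z a u v → (x :- a) :* ((z :- a) :* ((z :- x) :* (u :* v)))
           := (x :- a) :* (((z :- x) :* u) :* ((z :- a) :* v))) ≈-refl (X x) (X z) (X a) _ _ ⟩
    (X x - X a) * (((X z - X x) * ψ z x) * ((X z - X a) * ψ z a))
      ≈⟨ *-congˡ (*-cong (ψ-spec zx) (ψ-spec za)) ⟩
    (X x - X a) * (X x * X a)
      ≈⟨ solve 3 (λ x z a → (x :- a) :* (x :* a) := (z :- a) :* (x :* a) :- (z :- x) :* (a :* x)) ≈-refl (X x) (X z) (X a) ⟩
    (X z - X a) * (X x * X a) - (X z - X x) * (X a * X x)
      ≈⟨ +-cong (*-congˡ (*-cong (ψ-spec zx) (ψ-spec xa)))
           (-‿cong (*-congˡ (*-cong (ψ-spec za) (ψ-spec (xa ∘ sym))))) ⟨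
    (X z - X a) * (((X z - X x) * ψ z x) * ((X x - X a) * ψ x a))
      - (X z - X x) * (((X z - X a) * ψ z a) * ((X a - X x) * ψ a x))
      ≈⟨ solve 7 (λ x z a u v w t → (z :- a) :* (((z :- x) :* u) :* ((x :- a) :* w))
             :- (z :- x) :* (((z :- a) :* v) :* ((a :- x) :* t))
           := (x :- a) :* ((z :- a) :* ((z :- x) :* (u :* w :+ v :* t))))
           ≈-refl (X x) (X z) (X a) _ _ _ _ ⟩
    (X x - X a) * ((X z - X a) * ((X z - X x) * (ψ z x * ψ x a + ψ z a * ψ a x))) ∎)))

  -- The partial fraction relations survive the substitution q → 1/q.
  ψ-cocycle-op : ∀ {z x a} → z ≢ x → z ≢ a → x ≢ a → ψ x z * ψ a z ≈ ψ x z * ψ a x + ψ a z * ψ x a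
  ψ-cocycle-op {z} {x} {a} zx za xa = begin
    ψ x z * ψ a z
      ≈⟨ *-cong (op zx) (op za) ⟩
    (- 1# - ψ z x) * (- 1# - ψ z a)
      ≈⟨ solve 2 (λ u v → (:- con (+ 1) :- u) :* (:- con (+ 1) :- v) := con (+ 1) :+ u :+ v :+ u :* v) ≈-refl _ _ ⟩
    1# + ψ z x + ψ z a + ψ z x * ψ z a
      ≈⟨ +-congˡ (≈-trans (ψ-cocycle zx za xa) (+-congˡ (*-congˡ (op xa)))) ⟩
    1# + ψ z x + ψ z a + (ψ z x * ψ x a + ψ z a * (- 1# - ψ x a))
      ≈⟨ solve 3 (λ u v w → con (+ 1) :+ u :+ v :+ (u :* w :+ v :* (:- con (+ 1) :- w))
           := (:- con (+ 1) :- u) :* (:- con (+ 1) :- w) :+ (:- con (+ 1) :- v) :* w) ≈-refl _ _ _ ⟩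
    (- 1# - ψ z x) * (- 1# - ψ x a) + (- 1# - ψ z a) * ψ x a
      ≈⟨ +-congʳ (*-congˡ (op xa)) ⟨
    (- 1# - ψ z x) * ψ a x + (- 1# - ψ z a) * ψ x a
      ≈⟨ +-cong (*-congʳ (op zx)) (*-congʳ (op za)) ⟨
    ψ x z * ψ a x + ψ a z * ψ x a ∎
    where
    op : ∀ {x y} → x ≢ y → ψ y x ≈ - 1# - ψ x y
    op {x} {y} ne = ≈-trans (solve 2 (λ u v → v := (u :+ v) :- u) ≈-refl (ψ x y) (ψ y x)) (+-congʳ (ψ-sum ne))

  -- With u, y, t for q^u, q^y, q^c, clearing denominators leaves t u (u - y) = u (u - t y) + (t -
  -- 1) u^2. Needed in the inductive step of `telescope`.
  p-mix : ∀ {u y} c → u ≢ y → u ≢ y ℕ.+ c →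
    X c * p u (y ℕ.+ c) ≈ p u y + (X c - 1#) * (p u (y ℕ.+ c) * p u y)
  p-mix {u} {y} c ne ne′ = cancel ne (cancel ne′ (begin
    (X u - X y′) * ((X u - X y) * (X c * P))
      ≈⟨ solve 5 (λ u y y′ c P → (u :- y′) :* ((u :- y) :* (c :* P)) := (u :- y) :* c :* ((u :- y′) :* P))
           ≈-refl (X u) (X y) (X y′) (X c) P ⟩
    (X u - X y) * X c * ((X u - X y′) * P)
      ≈⟨ *-congˡ (p-spec ne′) ⟩
    (X u - X y) * X c * X u
      ≈⟨ solve 3 (λ u y c → (u :- y) :* c :* u := (u :- y :* c) :* u :+ (c :- con (+ 1)) :* (u :* u)) ≈-refl (X u) (X y) (X c) ⟩
    (X u - X y * X c) * X u + (X c - 1#) * (X u * X u)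
      ≈⟨ +-cong (*-cong (+-congˡ (-‿cong (≈-sym (X-+ y c)))) (≈-sym (p-spec ne)))
                (*-congˡ (*-cong (≈-sym (p-spec ne′)) (≈-sym (p-spec ne)))) ⟩
    (X u - X y′) * ((X u - X y) * S) + (X c - 1#) * (((X u - X y′) * P) * ((X u - X y) * S))
      ≈⟨ solve 6 (λ u y y′ c P S → (u :- y′) :* ((u :- y) :* S) :+ (c :- con (+ 1)) :* (((u :- y′) :* P) :* ((u :- y) :* S))
           := (u :- y′) :* ((u :- y) :* (S :+ (c :- con (+ 1)) :* (P :* S)))) ≈-refl (X u) (X y) (X y′) (X c) P S ⟩
    (X u - X y′) * ((X u - X y) * (S + (X c - 1#) * (P * S))) ∎))
    where
    y′ = y ℕ.+ c
    P = p u y′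
    S = p u y

-- Strands and sums over paths

-- A strand (z , k) is the set {z, z + c, …, z + (k - 1)c}; its head is the next element z + kc.
module Strands (Q : QRing) (c : ℕ) (c>0 : 0 < c) where
  open QRing Q
  open Monomials Q
  open CommutativeRing base renaming (refl to ≈-refl; sym to ≈-sym; trans to ≈-trans)
  open Folds base
  open Compositions base
  open IntegerCoefficients base using (module Solver)
  open Solver using (solve; _:+_; _:*_; _:-_; :-_; con; _:=_)
  open Relation.Binary.Reasoning.Setoid setoid

  Strand : Set
  Strand = ℕ × ℕ

  head : Strand → ℕ
  head (z , k) = z ℕ.+ c ℕ.* k

  up : Strand → Strand
  up (z , k) = z , suc k

  Apart : ℕ → ℕ → Set
  Apart z w = ∀ i j → z ℕ.+ c ℕ.* i ≢ w ℕ.+ c ℕ.* j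

  Apartₛ : Strand → Strand → Set
  Apartₛ a b = Apart (proj₁ a) (proj₁ b)

  Valid : List Strand → Set
  Valid = AllPairs Apartₛ

  Apart-sym : ∀ {z w} → Apart z w → Apart w z
  Apart-sym h i j e = h j i (sym e)

  head-up : ∀ z k → z ℕ.+ c ℕ.* suc k ≡ (z ℕ.+ c ℕ.* k) ℕ.+ c
  head-up z k = lemma z k c where
    lemma : ∀ z k c → z ℕ.+ c ℕ.* suc k ≡ (z ℕ.+ c ℕ.* k) ℕ.+ c
    lemma = solve-∀

  τ : ℕ → ℕ → ℕ → Carrier
  τ z zero    y = 1#
  τ z (suc k) y = τ z k y * p (z ℕ.+ c ℕ.* k) y

  -- 1 / (t; t)_k with t = q^c
  diagonal : ℕ → Carrier
  diagonal zero    = 1#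
  diagonal (suc k) = diagonal k * g (c ℕ.* suc k)

  poch : ℕ → Carrier
  poch zero    = 1#
  poch (suc k) = poch k * (1# - X (c ℕ.* suc k))

  cross : Strand → Strand → Carrier
  cross a b = τ (proj₁ a) (proj₂ a) (head b) * τ (proj₁ b) (proj₂ b) (head a)

  -- Closed form of the path sums: (t; t)_r times `T S` is the sum, over all ways to reach `S` from
  -- empty strands in r unweighted steps, of the product of the steps. The recursion behind this is
  -- `W-recurrence`.
  T : List Strand → Carrier
  T S = Prod (diagonal ∘ proj₂) S * Pairs cross S

  size : Strand → ℕ
  size (z , zero)  = 0
  size (z , suc k) = size (z , k) ℕ.+ (z ℕ.+ c ℕ.* k)

  T-↭ : ∀ {S S′} → S ↭ S′ → T S ≈ T S′
  T-↭ e = *-cong (Prod-↭ _ e) (Pairs-↭ cross (λ a b → *-comm _ _) e)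

  diagonal-step : ∀ k → (1# - X (c ℕ.* suc k)) * diagonal (suc k) ≈ diagonal k
  diagonal-step k = begin
    (1# - X (c ℕ.* suc k)) * (diagonal k * g (c ℕ.* suc k))
      ≈⟨ solve 3 (λ x d g → x :* (d :* g) := d :* (x :* g)) ≈-refl _ _ _ ⟩
    diagonal k * ((1# - X (c ℕ.* suc k)) * g (c ℕ.* suc k))
      ≈⟨ *-congˡ (g-inverse (ℕₚ.<-≤-trans c>0 (ℕₚ.m≤m*n c (suc k)))) ⟩
    diagonal k * 1#
      ≈⟨ *-identityʳ _ ⟩
    diagonal k ∎

  poch-diagonal : ∀ k → poch k * diagonal k ≈ 1#
  poch-diagonal zero    = *-identityˡ 1#
  poch-diagonal (suc k) = begin
    poch k * (1# - X (c ℕ.* suc k)) * diagonal (suc k)     ≈⟨ *-assoc _ _ _ ⟩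
    poch k * ((1# - X (c ℕ.* suc k)) * diagonal (suc k))   ≈⟨ *-congˡ (diagonal-step k) ⟩
    poch k * diagonal k                                    ≈⟨ poch-diagonal k ⟩
    1#                                                     ∎

  -- With x, y, t for q^x, q^y, q^c the bracket is t^l (x - t y)/(t^l x - t y). This is also the
  -- telescoped product over i < l of (t^i x - t y)/(t^i x - y), the ratio of the two values of τ.
  telescope : ∀ x l y → (∀ i → x ℕ.+ c ℕ.* i ≢ y) → (∀ i → x ℕ.+ c ℕ.* i ≢ y ℕ.+ c) →
    τ x l (y ℕ.+ c) * (1# + (1# - X (c ℕ.* l)) * ψ (x ℕ.+ c ℕ.* l) (y ℕ.+ c)) ≈ τ x l y
  telescope x zero y h h′ = begin
    1# * (1# + (1# - X (c ℕ.* 0)) * ψ (x ℕ.+ c ℕ.* 0) (y ℕ.+ c))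
      ≈⟨ *-congˡ (+-congˡ (*-congʳ (+-congˡ (-‿cong (≈-trans (X≡ (ℕₚ.*-zeroʳ c)) X-0))))) ⟩
    1# * (1# + (1# - 1#) * ψ (x ℕ.+ c ℕ.* 0) (y ℕ.+ c))
      ≈⟨ solve 1 (λ u → con (+ 1) :* (con (+ 1) :+ (con (+ 1) :- con (+ 1)) :* u) := con (+ 1)) ≈-refl _ ⟩
    1# ∎
  telescope x (suc l) y h h′ = begin
    τ x l y′ * P * (1# + (1# - X (c ℕ.* suc l)) * (p (x ℕ.+ c ℕ.* suc l) y′ - 1#))
      ≈⟨ *-congˡ (+-congˡ (*-cong (+-congˡ (-‿cong (≈-trans (X≡ (ℕₚ.*-suc c l)) (X-+ c (c ℕ.* l)))))
           (+-congʳ (≈-trans (reflexive (cong (λ v → p v y′) (head-up x l))) (p-shift c (h l)))))) ⟩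
    τ x l y′ * P * (1# + (1# - t * s) * (S - 1#))
      ≈⟨ solve 5 (λ τ P S t s → τ :* P :* (con (+ 1) :+ (con (+ 1) :- t :* s) :* (S :- con (+ 1)))
           := τ :* (P :* S :- s :* (t :* P :* S) :+ s :* (t :* P))) ≈-refl (τ x l y′) P S t s ⟩
    τ x l y′ * (P * S - s * (t * P * S) + s * (t * P))
      ≈⟨ *-congˡ (+-congˡ (*-congˡ (p-mix c (h l) (h′ l)))) ⟩
    τ x l y′ * (P * S - s * (t * P * S) + s * (S + (t - 1#) * (P * S)))
      ≈⟨ solve 5 (λ τ P S t s → τ :* (P :* S :- s :* (t :* P :* S) :+ s :* (S :+ (t :- con (+ 1)) :* (P :* S)))
           := (τ :* (con (+ 1) :+ (con (+ 1) :- s) :* (P :- con (+ 1)))) :* S) ≈-refl (τ x l y′) P S t s ⟩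
    τ x l y′ * (1# + (1# - s) * (P - 1#)) * S
      ≈⟨ *-congʳ (telescope x l y h h′) ⟩
    τ x l y * S ∎
    where
    y′ = y ℕ.+ c
    t = X c
    s = X (c ℕ.* l)
    P = p (x ℕ.+ c ℕ.* l) y′
    S = p (x ℕ.+ c ℕ.* l) y

  -- Adding its head to `a` contributes one factor p and moves that head by c; the move changes the
  -- product over `b` by the factor in `telescope`.
  cross-up : ∀ a b → Apartₛ a b → cross a b * p (head a) (head b) ≈
    (1# + (1# - X (c ℕ.* proj₂ b)) * ψ (head b) (head (up a))) * cross (up a) b
  cross-up (z , k) (z′ , l) ap = begin
    τ z k y * τ z′ l x * p x y
      ≈⟨ *-congʳ (*-congˡ (≈-sym (≈-trans
           (reflexive (cong₂ _*_ (cong (τ z′ l) (head-up z k)) (cong (λ v → 1# + (1# - X (c ℕ.* l)) * ψ y v) (head-up z k))))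
           (telescope z′ l x (λ i e → ap k i (sym e))
             (λ i e → ap (suc k) i (trans (head-up z k) (sym e))))))) ⟩
    τ z k y * (τ z′ l x⁺ * (1# + (1# - X (c ℕ.* l)) * ψ y x⁺)) * p x y
      ≈⟨ solve 4 (λ u v f q → u :* (v :* f) :* q := f :* ((u :* q) :* v)) ≈-refl _ _ _ _ ⟩
    (1# + (1# - X (c ℕ.* l)) * ψ y x⁺) * (τ z k y * p x y * τ z′ l x⁺) ∎
    where
    x = z ℕ.+ c ℕ.* k
    x⁺ = z ℕ.+ c ℕ.* suc k
    y = z′ ℕ.+ c ℕ.* l

  module Weighted (μ : ℕ) where

    W : List Strand → Carrier
    W S = Prod (λ a → X (μ ℕ.* size a)) S * T S

    W-↭ : ∀ {S S′} → S ↭ S′ → W S ≈ W S′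
    W-↭ e = *-cong (Prod-↭ _ e) (T-↭ e)

    step : Strand → List Strand → Carrier
    step a r = X (μ ℕ.* head a) * Prod (λ b → p (head a) (head b)) r

    -- Sum over all ways of extending strands r times by their heads.
    H : ℕ → List Strand → Carrier
    H zero    S = 1#
    H (suc r) S = Sel (λ a rest → step a rest * H r (up a ∷ rest)) S

    H-↭ : ∀ r {S S′} → S ↭ S′ → H r S ≈ H r S′
    H-↭ zero    e = ≈-refl
    H-↭ (suc r) e = Sel-↭ _ (λ a q → *-cong (*-congˡ (Prod-↭ _ q)) (H-↭ r (prep (up a) q))) e

    -- The swapped arguments of ψ make the inverses of q^head the variables. With s = t^k for a
    -- strand (z, k), residues at empty strands vanish and the product of all s is t^|k|.
    open PartialFractions base (λ a b → head a ≢ head b) (λ ne e → ne (sym e))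
      (λ a b → ψ (head b) (head a))
      (λ ne → ≈-trans (+-comm _ _) (ψ-sum ne)) ψ-cocycle-op (λ a → X (c ℕ.* proj₂ a))

    -- By `cross-up` the step supplies the product in the residue, and passing from 1/(t; t)_k to
    -- 1/(t; t)_(k+1) supplies its leading factor 1 - t^(k+1).
    W-step : ∀ z k r → Valid ((z , k) ∷ r) →
      W ((z , k) ∷ r) * step (z , k) r ≈ residue (z , suc k) r * W ((z , suc k) ∷ r)
    W-step z k r (v ∷ _) = begin
      (X (μ ℕ.* size (z , k)) * w) * ((diagonal k * d) * (Prod (cross a) r * ps)) * (X (μ ℕ.* head a) * Prod (λ b → p (head a) (head b)) r)
        ≈⟨ solve 8 (λ m w δ d f ps m′ q → (m :* w) :* ((δ :* d) :* (f :* ps)) :* (m′ :* q)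
             := (m :* m′ :* w) :* ((δ :* d) :* ((f :* q) :* ps))) ≈-refl _ w _ d _ ps _ _ ⟩
      (X (μ ℕ.* size (z , k)) * X (μ ℕ.* head a) * w)
        * ((diagonal k * d) * ((Prod (cross a) r * Prod (λ b → p (head a) (head b)) r) * ps))
        ≈⟨ *-cong (*-congʳ (≈-trans (≈-sym (X-+ _ _)) (X≡ (sym (ℕₚ.*-distribˡ-+ μ _ _)))))
             (*-cong (*-congʳ (≈-sym (diagonal-step k)))
               (*-congʳ (≈-trans (≈-sym (Prod-* _ _ r)) (≈-trans (Prod-cong-All r v crossing) (Prod-* _ _ r))))) ⟩
      (X (μ ℕ.* size (z , suc k)) * w)
        * (((1# - X (c ℕ.* suc k)) * diagonal (suc k) * d) * ((Prod (factor a⁺) r * Prod (cross a⁺) r) * ps))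
        ≈⟨ solve 7 (λ m x δ d f h y → m :* ((x :* δ :* d) :* ((f :* h) :* y))
             := (x :* f) :* (m :* ((δ :* d) :* (h :* y)))) ≈-refl _ _ _ d _ _ ps ⟩
      residue a⁺ r * W (a⁺ ∷ r) ∎
      where
      a = z , k
      a⁺ = z , suc k
      w = Prod (λ a → X (μ ℕ.* size a)) r
      d = Prod (diagonal ∘ proj₂) r
      ps = Pairs cross r
      crossing : ∀ b → b ∈ r → Apartₛ a b → cross a b * p (head a) (head b) ≈ factor a⁺ b * cross a⁺ b
      crossing b _ ap = cross-up a b ap

    heads-distinct : ∀ {S} → Valid S → AllPairs (λ a b → head a ≢ head b) S
    heads-distinct = AllPairs.map λ {a} {b} ap → ap (proj₂ a) (proj₂ b)

    poch-total : ∀ (S : List Strand) → Prod (λ a → X (c ℕ.* proj₂ a)) S ≈ X (c ℕ.* total S)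
    poch-total []      = ≈-sym (≈-trans (X≡ (ℕₚ.*-zeroʳ c)) X-0)
    poch-total (a ∷ S) = ≈-trans (*-congˡ (poch-total S))
      (≈-trans (≈-sym (X-+ _ _)) (X≡ (sym (ℕₚ.*-distribˡ-+ c (proj₂ a) (total S)))))

    -- The left side runs over the possible last steps of a path to `S`. Each contributes a residue
    -- by `W-step`, and the residues add up to 1 - t^|k|.
    W-recurrence : ∀ i S → Valid S →
      Sel (raised (λ a r → W (a ∷ r) * (step a r * H i (up a ∷ r)))) S
        ≈ (1# - X (c ℕ.* total S)) * (W S * H i S)
    W-recurrence i S v = begin
      Sel (raised (λ a r → W (a ∷ r) * (step a r * H i (up a ∷ r)))) S
        ≈⟨ Sel-cong S term ⟩
      Sel (λ a r → residue a r * (W S * H i S)) S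
        ≈⟨ Sel-*ʳ _ _ S ⟩
      Sel residue S * (W S * H i S)
        ≈⟨ *-congʳ (≈-trans (residues S (heads-distinct v)) (+-congˡ (-‿cong (poch-total S)))) ⟩
      (1# - X (c ℕ.* total S)) * (W S * H i S) ∎
      where
      term : ∀ a r → S ↭ a ∷ r →
        raised (λ a r → W (a ∷ r) * (step a r * H i (up a ∷ r))) a r ≈ residue a r * (W S * H i S)
      -- An empty strand admits no last step, in accordance with the factor 1 - t^0 = 0 of its
      -- residue.
      term (z , zero) r e = begin
        0#
          ≈⟨ solve 2 (λ u w → con (+ 0) := (con (+ 1) :- con (+ 1)) :* u :* w) ≈-refl _ _ ⟩
        (1# - 1#) * Prod (factor (z , 0)) r * (W S * H i S)
          ≈⟨ *-congʳ (*-congʳ (+-congˡ (-‿cong (≈-trans (X≡ (ℕₚ.*-zeroʳ c)) X-0)))) ⟨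
        residue (z , 0) r * (W S * H i S) ∎
      term (z , suc k) r e = begin
        W ((z , k) ∷ r) * (step (z , k) r * H i ((z , suc k) ∷ r))
          ≈⟨ *-assoc _ _ _ ⟨
        W ((z , k) ∷ r) * step (z , k) r * H i ((z , suc k) ∷ r)
          ≈⟨ *-congʳ (W-step z k r (lower (AllPairs-↭ Apart-sym e v))) ⟩
        residue (z , suc k) r * W ((z , suc k) ∷ r) * H i ((z , suc k) ∷ r)
          ≈⟨ *-assoc _ _ _ ⟩
        residue (z , suc k) r * (W ((z , suc k) ∷ r) * H i ((z , suc k) ∷ r))
          ≈⟨ *-congˡ (*-cong (W-↭ e) (H-↭ i e)) ⟨
        residue (z , suc k) r * (W S * H i S) ∎
        where
        lower : ∀ {r} → Valid ((z , suc k) ∷ r) → Valid ((z , k) ∷ r)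
        lower (d ∷ ds) = d ∷ ds

    valid-strands : ∀ {zs} S → map proj₁ S ≡ zs → AllPairs Apart zs → Valid S
    valid-strands S refl v = AllPairs.map⁻ v

    -- One step of the path moves from `H` to `W`; the factor 1 - t^(j+1) of `W-recurrence` extends
    -- (t; t)_j.
    transfer : ∀ zs → AllPairs Apart zs → ∀ j i →
      poch j * Cmp zs j (λ S → W S * H (suc i) S) ≈ poch (suc j) * Cmp zs (suc j) (λ S → W S * H i S)
    transfer zs v j i = begin
      poch j * Cmp zs j (λ S → W S * H (suc i) S)
        ≈⟨ *-congˡ (Cmp-cong zs j λ S _ _ → ≈-trans (≈-sym (Sel-*ˡ (W S) _ S))
             (Sel-cong S λ a r e → *-congʳ (W-↭ e))) ⟩
      poch j * Cmp zs j (Sel (λ a r → W (a ∷ r) * (step a r * H i (up a ∷ r))))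
        ≈⟨ *-congˡ (Cmp-raise zs j _) ⟩
      poch j * Cmp zs (suc j) (Sel (raised (λ a r → W (a ∷ r) * (step a r * H i (up a ∷ r)))))
        ≈⟨ *-congˡ (≈-trans (Cmp-cong zs (suc j) λ S m t → ≈-trans (W-recurrence i S (valid-strands S m v))
             (*-congʳ (+-congˡ (-‿cong (X≡ (cong (c ℕ.*_) t)))))) (Cmp-*ˡ zs (suc j) _ _)) ⟩
      poch j * ((1# - X (c ℕ.* suc j)) * Cmp zs (suc j) (λ S → W S * H i S))
        ≈⟨ *-assoc _ _ _ ⟨
      poch (suc j) * Cmp zs (suc j) (λ S → W S * H i S) ∎

    W-empty : ∀ zs → W (map (_, 0) zs) ≈ 1#
    W-empty zs = ≈-trans (*-cong (trivial zs) (*-cong (ones zs) (empty zs)))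
      (≈-trans (*-identityˡ _) (*-identityˡ _))
      where
      trivial : ∀ zs → Prod (λ a → X (μ ℕ.* size a)) (map (_, 0) zs) ≈ 1#
      trivial []       = ≈-refl
      trivial (z ∷ zs) = ≈-trans (*-cong (≈-trans (X≡ (ℕₚ.*-zeroʳ μ)) X-0) (trivial zs)) (*-identityˡ 1#)
      ones : ∀ zs → Prod (diagonal ∘ proj₂) (map (_, 0) zs) ≈ 1#
      ones []       = ≈-refl
      ones (z ∷ zs) = ≈-trans (*-identityˡ _) (ones zs)
      rows : ∀ z zs → Prod (cross (z , 0)) (map (_, 0) zs) ≈ 1#
      rows z []       = ≈-refl
      rows z (w ∷ zs) = ≈-trans (*-cong (*-identityˡ 1#) (rows z zs)) (*-identityˡ 1#)
      empty : ∀ zs → Pairs cross (map (_, 0) zs) ≈ 1#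
      empty []       = ≈-refl
      empty (z ∷ zs) = ≈-trans (*-cong (rows z zs) (empty zs)) (*-identityˡ 1#)

    -- Reading `transfer` backwards r times leads from compositions of r with no step left to empty
    -- strands with r steps left.
    path-sum : ∀ zs → AllPairs Apart zs → ∀ r →
      poch r * Cmp zs r W ≈ H r (map (_, 0) zs)
    path-sum zs v r = ≈-trans
      (*-congˡ (Cmp-cong zs r λ S _ _ → ≈-sym (*-identityʳ (W S))))
      (≈-trans (go r 0) (begin
        1# * Cmp zs 0 (λ S → W S * H (r ℕ.+ 0) S)              ≈⟨ *-identityˡ _ ⟩
        Cmp zs 0 (λ S → W S * H (r ℕ.+ 0) S)                   ≈⟨ Cmp-zero zs _ ⟩
        W (map (_, 0) zs) * H (r ℕ.+ 0) (map (_, 0) zs)        ≈⟨ *-congʳ (W-empty zs) ⟩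
        1# * H (r ℕ.+ 0) (map (_, 0) zs)                       ≈⟨ *-identityˡ _ ⟩
        H (r ℕ.+ 0) (map (_, 0) zs)                            ≡⟨ cong (λ r → H r (map (_, 0) zs)) (ℕₚ.+-identityʳ r) ⟩
        H r (map (_, 0) zs)                                     ∎))
      where
      go : ∀ j i → poch j * Cmp zs j (λ S → W S * H i S) ≈ poch 0 * Cmp zs 0 (λ S → W S * H (j ℕ.+ i) S)
      go zero    i = ≈-refl
      go (suc j) i = ≈-trans (≈-sym (transfer zs v j i)) (≈-trans (go j (suc i))
        (reflexive (cong (λ e → 1# * Cmp zs 0 (λ S → W S * H e S)) (ℕₚ.+-suc j i))))

  module _ where
    open Weighted 0
    open PartialFractions base (λ a b → head a ≢ head b) (λ ne e → ne (sym e))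
      (λ a b → ψ (head a) (head b)) ψ-sum ψ-cocycle (λ _ → 0#)

    -- Partial fractions with every s equal to 0.
    quotients-sum : ∀ S → Valid S → S ≢ [] → Sel (λ a r → Prod (λ b → p (head a) (head b)) r) S ≈ 1#
    quotients-sum S v ne = begin
      Sel (λ a r → Prod (λ b → p (head a) (head b)) r) S
        ≈⟨ Sel-cong S (λ a r _ → ≈-trans (solve 1 (λ x → x := (con (+ 1) :- con (+ 0)) :* x) ≈-refl _)
             (*-congˡ (Prod-cong r λ b _ →
               solve 1 (λ x → x := con (+ 1) :+ (con (+ 1) :- con (+ 0)) :* (x :- con (+ 1))) ≈-refl _))) ⟩
      Sel residue S
        ≈⟨ residues S (heads-distinct v) ⟩
      1# - Prod (λ _ → 0#) S
        ≈⟨ nonempty S ne ⟩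
      1# ∎
      where
      nonempty : ∀ S → S ≢ [] → 1# - Prod (λ _ → 0#) S ≈ 1#
      nonempty []      h with () ← h refl
      nonempty (a ∷ S) h = solve 1 (λ x → con (+ 1) :- con (+ 0) :* x := con (+ 1)) ≈-refl _

    -- Without weights the steps out of any state sum to 1, like transition probabilities, and hence
    -- so do all paths of a given length.
    H-weightless : ∀ r S → Valid S → S ≢ [] → H r S ≈ 1#
    H-weightless zero    S v ne = ≈-refl
    H-weightless (suc r) S v ne = ≈-trans (Sel-cong S λ a rest e → ≈-trans (*-cong (*-congʳ X-0)
        (H-weightless r (up a ∷ rest) (raise (AllPairs-↭ Apart-sym e v)) λ ()))
        (solve 1 (λ x → con (+ 1) :* x :* con (+ 1) := x) ≈-refl _))
      (quotients-sum S v ne)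
      where
      raise : ∀ {a r} → Valid (a ∷ r) → Valid (up a ∷ r)
      raise (d ∷ ds) = d ∷ ds

-- Signs, powers and Vandermonde products

module Antisymmetry (R : CommutativeRing 0ℓ 0ℓ) where
  open CommutativeRing R renaming (refl to ≈-refl; sym to ≈-sym; trans to ≈-trans)
  open Folds R
  open Determinants R
  open IntegerCoefficients R using (module Solver)
  open Solver using (solve; _:+_; _:*_; _:-_; :-_; con; _:=_)
  open Relation.Binary.Reasoning.Setoid setoid

  pow : Carrier → ℕ → Carrier
  pow x zero    = 1#
  pow x (suc k) = x * pow x k

  pow-* : ∀ x y k → pow (x * y) k ≈ pow x k * pow y k
  pow-* x y zero    = ≈-sym (*-identityˡ 1#)
  pow-* x y (suc k) = ≈-trans (*-congˡ (pow-* x y k))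
    (solve 4 (λ x y a b → (x :* y) :* (a :* b) := (x :* a) :* (y :* b)) ≈-refl x y _ _)

  pow-cong : ∀ {x y} → x ≈ y → ∀ k → pow x k ≈ pow y k
  pow-cong e zero    = ≈-refl
  pow-cong e (suc k) = *-cong e (pow-cong e k)

  pow-one : ∀ k → pow 1# k ≈ 1#
  pow-one zero    = ≈-refl
  pow-one (suc k) = ≈-trans (*-identityˡ _) (pow-one k)

  pow-inverse : ∀ {x y} → x * y ≈ 1# → ∀ k → pow x k * pow y k ≈ 1#
  pow-inverse {x} {y} e k = ≈-trans (≈-sym (pow-* x y k)) (≈-trans (pow-cong e k) (pow-one k))

  pow-+ : ∀ x k l → pow x (k ℕ.+ l) ≈ pow x k * pow x l
  pow-+ x zero    l = ≈-sym (*-identityˡ _)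
  pow-+ x (suc k) l = ≈-trans (*-congˡ (pow-+ x k l)) (≈-sym (*-assoc _ _ _))

  sign : ℕ → Carrier
  sign zero    = 1#
  sign (suc k) = - sign k

  sign-+ : ∀ k l → sign (k ℕ.+ l) ≈ sign k * sign l
  sign-+ zero    l = ≈-sym (*-identityˡ _)
  sign-+ (suc k) l = ≈-trans (-‿cong (sign-+ k l)) (solve 2 (λ a b → :- (a :* b) := :- a :* b) ≈-refl _ _)

  sign-square : ∀ k → sign k * sign k ≈ 1#
  sign-square zero    = *-identityˡ 1#
  sign-square (suc k) = ≈-trans (solve 1 (λ a → :- a :* :- a := a :* a) ≈-refl _) (sign-square k)

  module _ {A : Set} where

    -- Each entry lies in length L - 1 pairs, and `Prod f L` supplies the missing occurrence.
    Pairs-both : ∀ (f : A → Carrier) L →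
      Pairs (λ x y → f x * f y) L * Prod f L ≈ Prod (λ x → pow (f x) (length L)) L
    Pairs-both f []      = *-identityˡ 1#
    Pairs-both f (a ∷ L) = begin
      (Prod (λ b → f a * f b) L * Pairs (λ x y → f x * f y) L) * (f a * Prod f L)
        ≈⟨ *-congʳ (*-congʳ (≈-trans (Prod-* (λ _ → f a) f L) (*-congʳ (constant L)))) ⟩
      ((pow (f a) (length L) * Prod f L) * Pairs (λ x y → f x * f y) L) * (f a * Prod f L)
        ≈⟨ solve 4 (λ u v w f → ((u :* v) :* w) :* (f :* v) := (f :* u) :* (v :* (w :* v))) ≈-refl _ _ _ _ ⟩
      (f a * pow (f a) (length L)) * (Prod f L * (Pairs (λ x y → f x * f y) L * Prod f L))
        ≈⟨ *-congˡ (≈-trans (*-congˡ (Pairs-both f L)) (≈-sym (Prod-* f _ L))) ⟩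
      (f a * pow (f a) (length L)) * Prod (λ x → f x * pow (f x) (length L)) L ∎
      where
      constant : ∀ (L : List A) → Prod (λ _ → f a) L ≈ pow (f a) (length L)
      constant []      = ≈-refl
      constant (x ∷ L) = *-congˡ (constant L)

    Vandermonde : (A → Carrier) → List A → Carrier
    Vandermonde v = Pairs (λ a b → v a - v b)

    -- Moving the chosen entry to the front changes the Vandermonde product by the sign in the
    -- alternating sum; its differences with the other entries then clear the denominators of `h`.
    Vandermonde-Sel : ∀ (v : A → Carrier) (h k : A → List A → Carrier) S →
      (∀ a r → S ↭ a ∷ r → h a r * Prod (λ b → v a - v b) r ≈ k a r) →
      Vandermonde v S * Sel h S ≈ Alt (λ a r → k a r * Vandermonde v r) S
    Vandermonde-Sel v h k []      e = zeroʳ 1#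
    Vandermonde-Sel v h k (x ∷ S) e = begin
      (P * V) * (h x S + Sel (λ y r → h y (x ∷ r)) S)
        ≈⟨ solve 4 (λ P V h s → (P :* V) :* (h :+ s) := (h :* P) :* V :+ V :* (P :* s)) ≈-refl P V (h x S) _ ⟩
      (h x S * P) * V + V * (P * Sel (λ y r → h y (x ∷ r)) S)
        ≈⟨ +-cong (*-congʳ (e x S ↭-refl)) (*-congˡ (≈-sym (Sel-*ˡ P _ S))) ⟩
      k x S * V + V * Sel (λ y r → P * h y (x ∷ r)) S
        ≈⟨ +-congˡ (Vandermonde-Sel v _ (λ y r → - (k y (x ∷ r) * Prod (λ b → v x - v b) r)) S term) ⟩
      k x S * V + Alt (λ y r → - (k y (x ∷ r) * Prod (λ b → v x - v b) r) * Vandermonde v r) S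
        ≈⟨ +-congˡ (≈-trans (Alt-cong S (λ y r _ → solve 3 (λ a b c → :- (a :* b) :* c := :- con (+ 1) :* (a :* (b :* c))) ≈-refl _ _ _))
             (≈-trans (Alt-*ˡ (- 1#) _ S) (solve 1 (λ a → :- con (+ 1) :* a := :- a) ≈-refl _))) ⟩
      k x S * V - Alt (λ y r → k y (x ∷ r) * Vandermonde v (x ∷ r)) S ∎
      where
      P = Prod (λ b → v x - v b) S
      V = Vandermonde v S
      term : ∀ y r → S ↭ y ∷ r → (P * h y (x ∷ r)) * Prod (λ b → v y - v b) r ≈
        - (k y (x ∷ r) * Prod (λ b → v x - v b) r)
      term y r q = begin
        (P * h y (x ∷ r)) * Prod (λ b → v y - v b) r
          ≈⟨ *-congʳ (*-congʳ (Prod-↭ _ q)) ⟩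
        (((v x - v y) * Prod (λ b → v x - v b) r) * h y (x ∷ r)) * Prod (λ b → v y - v b) r
          ≈⟨ solve 5 (λ x y p h q → (((x :- y) :* p) :* h) :* q := :- ((h :* ((y :- x) :* q)) :* p)) ≈-refl _ _ _ _ _ ⟩
        - ((h y (x ∷ r) * Prod (λ b → v y - v b) (x ∷ r)) * Prod (λ b → v x - v b) r)
          ≈⟨ -‿cong (*-congʳ (e y (x ∷ r) (↭-trans (prep x q) (swap x y ↭-refl)))) ⟩
        - (k y (x ∷ r) * Prod (λ b → v x - v b) r) ∎

    Det-weighted : ∀ {B : Set} (w : A → Carrier) (M : A → B → Carrier) S ys →
      Prod w S * Det M S ys ≈ Det (λ a y → w a * M a y) S ys
    Det-weighted w M []      ys = *-identityˡ 1#
    Det-weighted w M (x ∷ S) ys = ≈-trans (≈-sym (Alt-*ˡ _ _ ys)) (Alt-cong ys λ y r _ →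
      ≈-trans (solve 4 (λ a b c d → (a :* b) :* (c :* d) := (a :* c) :* (b :* d)) ≈-refl _ _ _ _)
        (*-congˡ (Det-weighted w M S r)))

-- Clearing the denominators of a pair of strands

triangle : ℕ → ℕ
triangle zero    = 0
triangle (suc k) = triangle k ℕ.+ k

module Expansion (Q : QRing) (c : ℕ) (c>0 : 0 < c) where
  open QRing Q
  open Monomials Q
  open CommutativeRing base renaming (refl to ≈-refl; sym to ≈-sym; trans to ≈-trans)
  open Antisymmetry base
  open Strands Q c c>0
  open IntegerCoefficients base using (module Solver)
  open Solver using (solve; _:+_; _:*_; _:-_; :-_; con; _:=_)
  open Relation.Binary.Reasoning.Setoid setoid

  -- (q^d; q^c)_k
  partialPoch : ℕ → ℕ → Carrier
  partialPoch d zero    = 1#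
  partialPoch d (suc k) = partialPoch d k * (1# - X (d ℕ.+ c ℕ.* k))

  size-triangle : ∀ z k → size (z , k) ≡ z ℕ.* k ℕ.+ c ℕ.* triangle k
  size-triangle z zero    = lemma z c where
    lemma : ∀ z c → 0 ≡ z ℕ.* 0 ℕ.+ c ℕ.* 0
    lemma = solve-∀
  size-triangle z (suc k) = trans (cong (ℕ._+ (z ℕ.+ c ℕ.* k)) (size-triangle z k)) (lemma z c k (triangle k)) where
    lemma : ∀ z c k t → z ℕ.* k ℕ.+ c ℕ.* t ℕ.+ (z ℕ.+ c ℕ.* k) ≡ z ℕ.* suc k ℕ.+ c ℕ.* (t ℕ.+ k)
    lemma = solve-∀

  -- The strand lies above x, so its i-th factor is -q^e/(1 - q^e) with e = δ + c i, and 1 - q^e is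
  -- the i-th factor of (q^δ; q^c)_l.
  high-low : ∀ x δ l → 0 < δ →
    τ (x ℕ.+ δ) l (x ℕ.+ c ℕ.* 0) * partialPoch δ l ≈ sign l * X (δ ℕ.* l ℕ.+ c ℕ.* triangle l)
  high-low x δ zero    δ>0 = *-congˡ (≈-sym (≈-trans (X≡ (lemma δ c)) X-0)) where
    lemma : ∀ δ c → δ ℕ.* 0 ℕ.+ c ℕ.* 0 ≡ 0
    lemma = solve-∀
  high-low x δ (suc l) δ>0 = begin
    τ b l x′ * p (b ℕ.+ c ℕ.* l) x′ * (partialPoch δ l * (1# - X e))
      ≈⟨ *-congʳ (*-congˡ (reflexive (trans (p-> less) (cong (λ e → - (X e * g e)) gap)))) ⟩
    τ b l x′ * - (X e * g e) * (partialPoch δ l * (1# - X e))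
      ≈⟨ solve 4 (λ t e g P → t :* :- (e :* g) :* (P :* (con (+ 1) :- e)) := (t :* P) :* :- (e :* ((con (+ 1) :- e) :* g)))
           ≈-refl _ (X e) (g e) _ ⟩
    (τ b l x′ * partialPoch δ l) * - (X e * ((1# - X e) * g e))
      ≈⟨ *-cong (high-low x δ l δ>0) (-‿cong (*-congˡ (g-inverse (ℕₚ.<-≤-trans δ>0 (ℕₚ.m≤m+n δ _))))) ⟩
    (sign l * X (δ ℕ.* l ℕ.+ c ℕ.* triangle l)) * - (X e * 1#)
      ≈⟨ solve 3 (λ s a e → (s :* a) :* :- (e :* con (+ 1)) := :- s :* (a :* e)) ≈-refl _ _ _ ⟩
    - sign l * (X (δ ℕ.* l ℕ.+ c ℕ.* triangle l) * X e)
      ≈⟨ *-congˡ (≈-trans (≈-sym (X-+ _ _)) (X≡ (lemma δ c l (triangle l)))) ⟩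
    sign (suc l) * X (δ ℕ.* suc l ℕ.+ c ℕ.* triangle (suc l)) ∎
    where
    b = x ℕ.+ δ
    x′ = x ℕ.+ c ℕ.* 0
    e = δ ℕ.+ c ℕ.* l
    shape : b ℕ.+ c ℕ.* l ≡ x′ ℕ.+ e
    shape = lemma x δ c l where
      lemma : ∀ x δ c l → x ℕ.+ δ ℕ.+ c ℕ.* l ≡ x ℕ.+ c ℕ.* 0 ℕ.+ (δ ℕ.+ c ℕ.* l)
      lemma = solve-∀
    less : x′ < b ℕ.+ c ℕ.* l
    less = subst (x′ <_) (sym shape) (ℕₚ.m<m+n x′ (ℕₚ.<-≤-trans δ>0 (ℕₚ.m≤m+n δ _)))
    gap : (b ℕ.+ c ℕ.* l) ∸ x′ ≡ e
    gap = trans (cong (_∸ x′) shape) (ℕₚ.m+n∸m≡n x′ e)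
    lemma : ∀ δ c l t → δ ℕ.* l ℕ.+ c ℕ.* t ℕ.+ (δ ℕ.+ c ℕ.* l) ≡ δ ℕ.* suc l ℕ.+ c ℕ.* (t ℕ.+ l)
    lemma = solve-∀

  mixed : ℕ → ℕ → ℕ → ℕ → ℕ
  mixed x δ k l = (x ℕ.+ δ) ℕ.* k ℕ.+ x ℕ.* l ℕ.+ c ℕ.* k ℕ.* l

  -- Induction on k through `cross-up`. For k = 0 the denominators are (q^δ; q^c)_l; the one further
  -- factor 1 - q^(δ + c l) of `partialPoch δ (suc l)` produces the difference of the heads.
  cross-expansion : ∀ x δ k l → 0 < δ → δ < c → Apart x (x ℕ.+ δ) →
    cross (x , k) (x ℕ.+ δ , l) * (partialPoch δ (suc l) * partialPoch (c ∸ δ) k) * (- X x * X (mixed x δ k l))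
      ≈ (sign k * X (size (x , k))) * (sign l * X (size (x ℕ.+ δ , l))) * (X (head (x ℕ.+ δ , l)) - X (head (x , k)))
  cross-expansion x δ zero l δ>0 δ<c ap = begin
    1# * τ b l x′ * ((partialPoch δ l * (1# - X e)) * 1#) * (- X x * X (mixed x δ 0 l))
      ≈⟨ solve 5 (λ t P e x m → con (+ 1) :* t :* ((P :* (con (+ 1) :- e)) :* con (+ 1)) :* (:- x :* m)
           := (t :* P) :* m :* (x :* e :- x)) ≈-refl _ _ (X e) (X x) _ ⟩
    (τ b l x′ * partialPoch δ l) * X (mixed x δ 0 l) * (X x * X e - X x)
      ≈⟨ *-cong (*-congʳ (high-low x δ l δ>0)) (+-cong (≈-trans (≈-sym (X-+ x e)) (X≡ (sym (ℕₚ.+-assoc x δ _))))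
           (-‿cong (X≡ (lemma₀ x c)))) ⟩
    (sign l * X (δ ℕ.* l ℕ.+ c ℕ.* triangle l)) * X (mixed x δ 0 l) * (X (head (b , l)) - X x′)
      ≈⟨ *-congʳ (≈-trans (*-assoc _ _ _) (*-congˡ (≈-trans (≈-sym (X-+ _ _))
           (X≡ (trans (lemma₁ x δ c l (triangle l)) (sym (size-triangle b l))))))) ⟩
    (sign l * X (size (b , l))) * (X (head (b , l)) - X x′)
      ≈⟨ *-congʳ (≈-trans (≈-sym (*-identityˡ _)) (*-congʳ (≈-sym (≈-trans (*-identityˡ _) X-0)))) ⟩
    (1# * X 0) * (sign l * X (size (b , l))) * (X (head (b , l)) - X x′) ∎
    where
    b = x ℕ.+ δ
    x′ = x ℕ.+ c ℕ.* 0
    e = δ ℕ.+ c ℕ.* l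
    lemma₀ : ∀ x c → x ≡ x ℕ.+ c ℕ.* 0
    lemma₀ = solve-∀
    lemma₁ : ∀ x δ c l t → δ ℕ.* l ℕ.+ c ℕ.* t ℕ.+ ((x ℕ.+ δ) ℕ.* 0 ℕ.+ x ℕ.* l ℕ.+ c ℕ.* 0 ℕ.* l) ≡ (x ℕ.+ δ) ℕ.* l ℕ.+ c ℕ.* t
    lemma₁ = solve-∀
  cross-expansion x δ (suc k) l δ>0 δ<c ap = cancel (ap k l) (begin
    (Xa - Xb) * (C⁺ * (uδ * (u * (1# - X (c ∸ δ ℕ.+ c ℕ.* k)))) * (- X x * X (mixed x δ (suc k) l)))
      ≈⟨ *-congˡ (*-congˡ (*-congˡ (≈-trans (X≡ (lemma₂ x δ c k l)) (≈-trans (X-+ _ _) (*-congˡ (X-+ b (c ℕ.* l))))))) ⟩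
    (Xa - Xb) * (C⁺ * (uδ * (u * (1# - X (c ∸ δ ℕ.+ c ℕ.* k)))) * (- X x * (X (mixed x δ k l) * (X b * X (c ℕ.* l)))))
      ≈⟨ solve 9 (λ a b C uδ u v x m s → (a :- b) :* (C :* (uδ :* (u :* (con (+ 1) :- v))) :* (:- x :* (m :* s)))
           := ((a :- b) :* (s :* (con (+ 1) :- v)) :* C) :* ((uδ :* u) :* (:- x :* m))) ≈-refl Xa Xb C⁺ uδ u _ (X x) _ _ ⟩
    ((Xa - Xb) * ((X b * X (c ℕ.* l)) * (1# - X (c ∸ δ ℕ.+ c ℕ.* k))) * C⁺) * ((uδ * u) * (- X x * X (mixed x δ k l)))
      ≈⟨ *-congʳ (≈-trans (*-congʳ (*-congˡ shape)) step) ⟩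
    (Xa * (Xb - Xa⁺) * C) * ((uδ * u) * (- X x * X (mixed x δ k l)))
      ≈⟨ solve 4 (λ C y m a → (a :* C) :* (y :* m) := (C :* y :* m) :* a) ≈-refl C (uδ * u) _ _ ⟩
    (C * (uδ * u) * (- X x * X (mixed x δ k l))) * (Xa * (Xb - Xa⁺))
      ≈⟨ *-congʳ (cross-expansion x δ k l δ>0 δ<c ap) ⟩
    ((sign k * X (size (x , k))) * L * (Xb - Xa)) * (Xa * (Xb - Xa⁺))
      ≈⟨ solve 6 (λ s z L a b a′ → ((s :* z) :* L :* (b :- a)) :* (a :* (b :- a′))
           := (a :- b) :* ((:- s :* (z :* a)) :* L :* (b :- a′))) ≈-refl (sign k) _ L Xa Xb Xa⁺ ⟩
    (Xa - Xb) * ((- sign k * (X (size (x , k)) * Xa)) * L * (Xb - Xa⁺))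
      ≈⟨ *-congˡ (*-congʳ (*-congʳ (*-congˡ (≈-sym (X-+ _ _))))) ⟩
    (Xa - Xb) * ((sign (suc k) * X (size (x , suc k))) * L * (Xb - Xa⁺)) ∎)
    where
    b = x ℕ.+ δ
    Xa = X (head (x , k))
    Xb = X (head (b , l))
    Xa⁺ = X (head (x , suc k))
    C = cross (x , k) (b , l)
    C⁺ = cross (x , suc k) (b , l)
    L = sign l * X (size (b , l))
    uδ = partialPoch δ (suc l)
    u = partialPoch (c ∸ δ) k
    F = 1# + (1# - X (c ℕ.* l)) * ψ (head (b , l)) (head (x , suc k))
    lemma₂ : ∀ x δ c k l → (x ℕ.+ δ) ℕ.* suc k ℕ.+ x ℕ.* l ℕ.+ c ℕ.* suc k ℕ.* l
      ≡ ((x ℕ.+ δ) ℕ.* k ℕ.+ x ℕ.* l ℕ.+ c ℕ.* k ℕ.* l) ℕ.+ (x ℕ.+ δ ℕ.+ c ℕ.* l)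
    lemma₂ = solve-∀
    position : b ℕ.+ (c ∸ δ ℕ.+ c ℕ.* k) ≡ x ℕ.+ c ℕ.* suc k
    position = trans (lemma₃ x δ (c ∸ δ) (c ℕ.* k))
      (trans (cong (λ v → x ℕ.+ (v ℕ.+ c ℕ.* k)) (ℕₚ.m+[n∸m]≡n (ℕₚ.<⇒≤ δ<c))) (cong (x ℕ.+_) (sym (ℕₚ.*-suc c k))))
      where
      lemma₃ : ∀ x δ d e → x ℕ.+ δ ℕ.+ (d ℕ.+ e) ≡ x ℕ.+ (δ ℕ.+ d ℕ.+ e)
      lemma₃ = solve-∀
    -- The new factor of (q^(c-δ); q^c)_(k+1) measures the distance from `b` to the new head of the
    -- lower strand, so this is the numerator of `F`.
    shape : (X b * X (c ℕ.* l)) * (1# - X (c ∸ δ ℕ.+ c ℕ.* k)) ≈ Xb - X (c ℕ.* l) * Xa⁺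
    shape = ≈-trans (solve 3 (λ b s v → (b :* s) :* (con (+ 1) :- v) := b :* s :- s :* (b :* v)) ≈-refl _ _ _)
      (+-cong (≈-sym (X-+ b _)) (-‿cong (*-congˡ (≈-trans (≈-sym (X-+ b _)) (X≡ position)))))
    step : (Xa - Xb) * (Xb - X (c ℕ.* l) * Xa⁺) * C⁺ ≈ Xa * (Xb - Xa⁺) * C
    step = begin
      (Xa - Xb) * (Xb - X (c ℕ.* l) * Xa⁺) * C⁺
        ≈⟨ solve 5 (λ a b s a′ C → (a :- b) :* (b :- s :* a′) :* C := (a :- b) :* ((b :- a′) :+ (con (+ 1) :- s) :* a′) :* C)
             ≈-refl Xa Xb _ Xa⁺ C⁺ ⟩
      (Xa - Xb) * ((Xb - Xa⁺) + (1# - X (c ℕ.* l)) * Xa⁺) * C⁺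
        ≈⟨ *-congʳ (*-congˡ (+-congˡ (*-congˡ (≈-sym (ψ-spec (λ e → ap (suc k) l (sym e))))))) ⟩
      (Xa - Xb) * ((Xb - Xa⁺) + (1# - X (c ℕ.* l)) * ((Xb - Xa⁺) * ψ (head (b , l)) (head (x , suc k)))) * C⁺
        ≈⟨ solve 6 (λ a b s a′ C q → (a :- b) :* ((b :- a′) :+ (con (+ 1) :- s) :* ((b :- a′) :* q)) :* C
             := (a :- b) :* (b :- a′) :* ((con (+ 1) :+ (con (+ 1) :- s) :* q) :* C)) ≈-refl Xa Xb _ Xa⁺ C⁺ _ ⟩
      (Xa - Xb) * (Xb - Xa⁺) * (F * C⁺)
        ≈⟨ *-congˡ (cross-up (x , k) (b , l) ap) ⟨
      (Xa - Xb) * (Xb - Xa⁺) * (C * p (head (x , k)) (head (b , l)))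
        ≈⟨ solve 5 (λ a b a′ C q → (a :- b) :* (b :- a′) :* (C :* q) := ((a :- b) :* q) :* (b :- a′) :* C) ≈-refl Xa Xb Xa⁺ C _ ⟩
      ((Xa - Xb) * p (head (x , k)) (head (b , l))) * (Xb - Xa⁺) * C
        ≈⟨ *-congʳ (*-congʳ (p-spec (ap k l))) ⟩
      Xa * (Xb - Xa⁺) * C ∎

-- Residue classes and binomial identities

column-< : ∀ c {z w i j} → z < c → i < j → z ℕ.+ c ℕ.* i < w ℕ.+ c ℕ.* j
column-< c {z} {w} {i} {j} zc l = ℕₚ.<-≤-trans (ℕₚ.+-monoˡ-< (c ℕ.* i) zc)
  (ℕₚ.≤-trans (ℕₚ.≤-reflexive (sym (ℕₚ.*-suc c i))) (ℕₚ.≤-trans (ℕₚ.*-monoʳ-≤ c l) (ℕₚ.m≤n+m _ w)))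

Apart-< : ∀ c {z w} → z < c → w < c → z ≢ w → ∀ i j → z ℕ.+ c ℕ.* i ≢ w ℕ.+ c ℕ.* j
Apart-< c {z} {w} zc wc ne i j e with ℕₚ.<-cmp i j
... | tri≈ _ refl _ = ne (ℕₚ.+-cancelʳ-≡ (c ℕ.* i) z w e)
... | tri< l _ _    = ℕₚ.<⇒≢ (column-< c zc l) e
... | tri> _ _ l    = ℕₚ.<⇒≢ (column-< c wc l) (sym e)

downFrom-descending : ∀ n c → n ≤ c → AllPairs (λ b a → (a < b) × (b < c)) (downFrom n)
downFrom-descending zero    c le = []
downFrom-descending (suc n) c le = below n ℕₚ.≤-refl ∷ downFrom-descending n c (ℕₚ.<⇒≤ le)
  where
  below : ∀ k → k ≤ n → All (λ a → (a < n) × (n < c)) (downFrom k)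
  below zero    _  = []
  below (suc k) kn = (kn , le) ∷ below k (ℕₚ.<⇒≤ kn)

downFrom-apart : ∀ n c → n ≤ c → AllPairs (λ z w → ∀ i j → z ℕ.+ c ℕ.* i ≢ w ℕ.+ c ℕ.* j) (downFrom n)
downFrom-apart n c le = AllPairs.map (λ (ab , bc) → Apart-< c bc (ℕₚ.<-trans ab bc) (ℕₚ.<⇒≢ ab ∘ sym))
  (downFrom-descending n c le)

residues-zeros : ∀ (zs : List ℕ) → map proj₁ (map (_, 0) zs) ≡ zs
residues-zeros []       = refl
residues-zeros (z ∷ zs) = cong (z ∷_) (residues-zeros zs)

triangle-+ : ∀ k l → triangle (k ℕ.+ l) ≡ triangle k ℕ.+ triangle l ℕ.+ k ℕ.* l
triangle-+ zero    l = sym (ℕₚ.+-identityʳ _)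
triangle-+ (suc k) l = trans (cong (ℕ._+ (k ℕ.+ l)) (triangle-+ k l)) (lemma k l (triangle k) (triangle l))
  where
  lemma : ∀ k l s t → s ℕ.+ t ℕ.+ k ℕ.* l ℕ.+ (k ℕ.+ l) ≡ s ℕ.+ k ℕ.+ t ℕ.+ (l ℕ.+ k ℕ.* l)
  lemma = solve-∀

-- From sums over strands to determinants

module Offset (Q : QRing) where
  open QRing Q
  open CommutativeRing base renaming (refl to ≈-refl; sym to ≈-sym; trans to ≈-trans)
  open Folds base
  open IntegerCoefficients base using (module Solver)
  open Solver using (solve; _:*_; _:-_; :-_; _:=_)

  Regular : Carrier → Set
  Regular u = ∀ {x y} → u * x ≈ u * y → x ≈ y

  Regular-* : ∀ {u v} → Regular u → Regular v → Regular (u * v)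
  Regular-* {u} {v} p q e = q (p (≈-trans (≈-sym (*-assoc u v _)) (≈-trans e (*-assoc u v _))))

  Regular-1 : Regular 1#
  Regular-1 e = ≈-trans (≈-sym (*-identityˡ _)) (≈-trans e (*-identityˡ _))

  -- Collects the constants -q^a that the pair expansions carry. It depends on the residues alone,
  -- is common to both moduli, and is cancelled when they are compared.
  offset : List ℕ → Carrier
  offset = Pairs (λ _ z → - X z)

  offset-regular : ∀ zs → Regular (offset zs)
  offset-regular []       = Regular-1
  offset-regular (z ∷ zs) = Regular-* (row zs) (offset-regular zs)
    where
    row : ∀ ws → Regular (Prod (λ z → - X z) ws)
    row []       = Regular-1
    row (w ∷ ws) = Regular-* (λ {x} {y} e → X-cancel w (≈-trans (flip x) (≈-trans (-‿cong e) (≈-sym (flip y))))) (row ws)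
      where
      flip : ∀ x → X w * x ≈ - (- X w * x)
      flip x = solve 2 (λ w x → w :* x := :- (:- w :* x)) ≈-refl (X w) x

module Family (Q : QRing) (c : ℕ) (c>0 : 0 < c) (μ : ℕ) where
  open QRing Q
  open Monomials Q
  open Offset Q
  open CommutativeRing base renaming (refl to ≈-refl; sym to ≈-sym; trans to ≈-trans)
  open Folds base
  open Compositions base
  open Determinants base
  open Antisymmetry base
  open Strands Q c c>0
  open Weighted μ
  open Expansion Q c c>0
  open IntegerCoefficients base using (module Solver)
  open Solver using (solve; _:*_; _:=_)
  open Relation.Binary.Reasoning.Setoid setoid

  -- The strands are listed with the larger residue first.
  _▷_ : Strand → Strand → Set
  (b , _) ▷ (a , _) = (a < b) × (b < c)

  ▷⇒Apart : ∀ {b a} → b ▷ a → Apartₛ b a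
  ▷⇒Apart (ab , bc) = Apart-< c bc (ℕₚ.<-trans ab bc) (ℕₚ.<⇒≢ ab ∘ sym)

  UPair : Strand → Strand → Carrier
  UPair (b , l) (a , k) = partialPoch (b ∸ a) (suc l) * partialPoch (c ∸ (b ∸ a)) k

  U : List Strand → Carrier
  U S = Prod (poch ∘ proj₂) S * Pairs UPair S

  f : Strand → Carrier
  f a = sign (proj₂ a) * X (size a)

  mix : Strand → Strand → ℕ
  mix (b , l) (a , k) = b ℕ.* k ℕ.+ a ℕ.* l ℕ.+ c ℕ.* k ℕ.* l

  pair-expansion : ∀ b a → b ▷ a →
    cross b a * UPair b a * (- X (proj₁ a) * X (mix b a)) ≈ f b * f a * (X (head b) - X (head a))
  pair-expansion (b , l) (a , k) (ab , bc) = begin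
    cross (b , l) (a , k) * U₀ * (- X a * X (mix (b , l) (a , k)))
      ≈⟨ *-congʳ (*-congʳ (*-comm _ _)) ⟩
    cross (a , k) (b , l) * U₀ * (- X a * X (mix (b , l) (a , k)))
      ≈⟨ subst (λ b′ → cross (a , k) (b′ , l) * U₀ * (- X a * X (mix (b′ , l) (a , k)))
           ≈ f (a , k) * f (b′ , l) * (X (head (b′ , l)) - X (head (a , k)))) b≡
           (cross-expansion a δ k l (ℕₚ.m<n⇒0<n∸m ab) (ℕₚ.≤-<-trans (ℕₚ.m∸n≤m b a) bc)
             (Apart-< c ac (subst (_< c) (sym b≡) bc) (λ e → ℕₚ.<⇒≢ ab (trans e b≡)))) ⟩
    f (a , k) * f (b , l) * (X (head (b , l)) - X (head (a , k)))
      ≈⟨ *-congʳ (*-comm _ _) ⟩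
    f (b , l) * f (a , k) * (X (head (b , l)) - X (head (a , k))) ∎
    where
    δ = b ∸ a
    U₀ = UPair (b , l) (a , k)
    ac = ℕₚ.<-trans ab bc
    b≡ : a ℕ.+ δ ≡ b
    b≡ = ℕₚ.m+[n∸m]≡n (ℕₚ.<⇒≤ ab)

  residueSum : List Strand → ℕ
  residueSum S = sum (map proj₁ S)

  exponent : List Strand → ℕ
  exponent S = residueSum S ℕ.* total S ℕ.+ c ℕ.* triangle (total S)

  mix-row : ∀ b l S → Prod (λ a → X (mix (b , l) a)) S ≈
    X (b ℕ.* total S ℕ.+ residueSum S ℕ.* l ℕ.+ c ℕ.* total S ℕ.* l)
  mix-row b l [] = ≈-sym (≈-trans (X≡ (lemma b c l)) X-0) where
    lemma : ∀ b c l → b ℕ.* 0 ℕ.+ 0 ℕ.* l ℕ.+ c ℕ.* 0 ℕ.* l ≡ 0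
    lemma = solve-∀
  mix-row b l ((a , k) ∷ S) = ≈-trans (*-congˡ (mix-row b l S)) (≈-trans (≈-sym (X-+ _ _))
    (X≡ (lemma b l a k c (total S) (residueSum S)))) where
    lemma : ∀ b l a k c t r → b ℕ.* k ℕ.+ a ℕ.* l ℕ.+ c ℕ.* k ℕ.* l ℕ.+ (b ℕ.* t ℕ.+ r ℕ.* l ℕ.+ c ℕ.* t ℕ.* l)
      ≡ b ℕ.* (k ℕ.+ t) ℕ.+ (a ℕ.+ r) ℕ.* l ℕ.+ c ℕ.* (k ℕ.+ t) ℕ.* l
    lemma = solve-∀

  -- As triangle (k + l) = triangle k + triangle l + k l, the exponents of strands and pairs add up
  -- to an expression in the residues and the total. They therefore come out of the sum over |k| =
  -- r.
  mix-total : ∀ S → Prod f S * Pairs (λ b a → X (mix b a)) S ≈ sign (total S) * X (exponent S)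
  mix-total [] = *-congˡ (≈-sym (≈-trans (X≡ (ℕₚ.*-zeroʳ c)) X-0))
  mix-total ((z , k) ∷ S) = begin
    (sign k * X (size (z , k)) * Prod f S) * (Prod (λ a → X (mix (z , k) a)) S * Pairs (λ b a → X (mix b a)) S)
      ≈⟨ *-congˡ (*-congʳ (mix-row z k S)) ⟩
    (sign k * X (size (z , k)) * Prod f S) * (X row * Pairs (λ b a → X (mix b a)) S)
      ≈⟨ solve 5 (λ s x p r q → (s :* x :* p) :* (r :* q) := (s :* (x :* r)) :* (p :* q)) ≈-refl _ _ _ _ _ ⟩
    (sign k * (X (size (z , k)) * X row)) * (Prod f S * Pairs (λ b a → X (mix b a)) S)
      ≈⟨ *-cong (*-congˡ (≈-sym (X-+ _ _))) (mix-total S) ⟩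
    (sign k * X (size (z , k) ℕ.+ row)) * (sign (total S) * X (exponent S))
      ≈⟨ solve 4 (λ s x t y → (s :* x) :* (t :* y) := (s :* t) :* (x :* y)) ≈-refl _ _ _ _ ⟩
    (sign k * sign (total S)) * (X (size (z , k) ℕ.+ row) * X (exponent S))
      ≈⟨ *-cong (≈-sym (sign-+ k (total S))) (≈-trans (≈-sym (X-+ _ _)) (X≡ exponents)) ⟩
    sign (k ℕ.+ total S) * X (exponent ((z , k) ∷ S)) ∎
    where
    row = z ℕ.* total S ℕ.+ residueSum S ℕ.* k ℕ.+ c ℕ.* total S ℕ.* k
    lemma : ∀ z k c t r tk tt → z ℕ.* k ℕ.+ c ℕ.* tk ℕ.+ (z ℕ.* t ℕ.+ r ℕ.* k ℕ.+ c ℕ.* t ℕ.* k) ℕ.+ (r ℕ.* t ℕ.+ c ℕ.* tt)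
      ≡ (z ℕ.+ r) ℕ.* (k ℕ.+ t) ℕ.+ c ℕ.* (tk ℕ.+ tt ℕ.+ k ℕ.* t)
    lemma = solve-∀
    exponents : size (z , k) ℕ.+ row ℕ.+ exponent S ≡ exponent ((z , k) ∷ S)
    exponents = trans (cong (λ s → s ℕ.+ row ℕ.+ exponent S) (size-triangle z k))
      (trans (lemma z k c (total S) (residueSum S) (triangle k) (triangle (total S)))
        (cong (λ t → (z ℕ.+ residueSum S) ℕ.* (k ℕ.+ total S) ℕ.+ c ℕ.* t) (sym (triangle-+ k (total S)))))

  offset-map : ∀ (S : List Strand) → Pairs (λ _ a → - X (proj₁ a)) S ≈ offset (map proj₁ S)
  offset-map []      = ≈-refl
  offset-map (a ∷ S) = *-cong (row S) (offset-map S)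
    where
    row : ∀ (S : List Strand) → Prod (λ a → - X (proj₁ a)) S ≈ Prod (λ z → - X z) (map proj₁ S)
    row []      = ≈-refl
    row (b ∷ S) = *-congˡ (row S)

  W-U : ∀ S → W S * U S ≈ Prod (λ a → X (μ ℕ.* size a)) S * (Pairs cross S * Pairs UPair S)
  W-U S = begin
    (w * (D * P)) * (D′ * V)
      ≈⟨ solve 5 (λ w d p e v → (w :* (d :* p)) :* (e :* v) := (e :* d) :* (w :* (p :* v))) ≈-refl w D P D′ V ⟩
    (D′ * D) * (w * (P * V))
      ≈⟨ *-congʳ (≈-trans (≈-sym (Prod-* _ _ S)) (≈-trans (Prod-cong S λ a _ → poch-diagonal (proj₂ a)) (Prod-1 S))) ⟩
    1# * (w * (P * V))
      ≈⟨ *-identityˡ _ ⟩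
    w * (P * V) ∎
    where
    w = Prod (λ a → X (μ ℕ.* size a)) S
    D = Prod (diagonal ∘ proj₂) S
    D′ = Prod (poch ∘ proj₂) S
    P = Pairs cross S
    V = Pairs UPair S

  heads : List Strand → Carrier
  heads = Vandermonde (X ∘ head)

  -- Multiplying by 1, written as in `quotients-sum`, turns the Vandermonde product into its
  -- expansion along the row of highest powers.
  heads-Det : ∀ n S → length S ≡ n → Valid S → heads S ≈ Det (λ s a → X (s ℕ.* head a)) (downFrom n) S
  heads-Det zero    []      _ _ = ≈-refl
  heads-Det (suc n) S@(_ ∷ _) len v = begin
    heads S
      ≈⟨ *-identityʳ _ ⟨
    heads S * 1#
      ≈⟨ *-congˡ (quotients-sum S v λ ()) ⟨
    heads S * Sel (λ a r → Prod (λ b → p (head a) (head b)) r) S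
      ≈⟨ Vandermonde-Sel (X ∘ head) _ (λ a r → X (length r ℕ.* head a)) S (λ a r e →
           row a r (heads-distinct (AllPairs-↭ Apart-sym e v))) ⟩
    Alt (λ a r → X (length r ℕ.* head a) * heads r) S
      ≈⟨ Alt-cong S (λ a r e → *-cong (X≡ (cong (ℕ._* head a) (shorter e)))
           (heads-Det n r (shorter e) (AllPairs.tail (AllPairs-↭ Apart-sym e v)))) ⟩
    Alt (λ a r → X (n ℕ.* head a) * Det (λ s a → X (s ℕ.* head a)) (downFrom n) r) S ∎
    where
    shorter : ∀ {a r} → S ↭ a ∷ r → length r ≡ n
    shorter e = ℕₚ.suc-injective (trans (sym (↭-length e)) len)
    row : ∀ a r → AllPairs (λ a b → head a ≢ head b) (a ∷ r) →
      Prod (λ b → p (head a) (head b)) r * Prod (λ b → X (head a) - X (head b)) r ≈ X (length r ℕ.* head a)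
    row a []      _                = ≈-trans (*-identityˡ 1#) (≈-sym X-0)
    row a (b ∷ r) ((d ∷ ds) ∷ _ ∷ e) = begin
      (p (head a) (head b) * Prod (λ b → p (head a) (head b)) r) * ((X (head a) - X (head b)) * Prod (λ b → X (head a) - X (head b)) r)
        ≈⟨ solve 4 (λ p P x Y → (p :* P) :* (x :* Y) := (x :* p) :* (P :* Y)) ≈-refl _ _ _ _ ⟩
      ((X (head a) - X (head b)) * p (head a) (head b)) * (Prod (λ b → p (head a) (head b)) r * Prod (λ b → X (head a) - X (head b)) r)
        ≈⟨ *-cong (p-spec d) (row a r (ds ∷ e)) ⟩
      X (head a) * X (length r ℕ.* head a)
        ≈⟨ X-+ _ _ ⟨
      X (suc (length r) ℕ.* head a) ∎

  -- The k-th coefficient of the series in row `z` and column `s`. Of the μ + n copies of the strand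
  -- size, n come from `Pairs-both` and μ from the weight; the last summand comes from the
  -- Vandermonde factor.
  entry : ℕ → ℕ → ℕ → ℕ → Carrier
  entry n z s k = pow (sign k) n * X ((μ ℕ.+ n) ℕ.* (z ℕ.* k ℕ.+ c ℕ.* triangle k) ℕ.+ s ℕ.* (z ℕ.+ c ℕ.* k))

  pow-X : ∀ e n → pow (X e) n ≈ X (n ℕ.* e)
  pow-X e zero    = ≈-sym X-0
  pow-X e (suc n) = ≈-trans (*-congˡ (pow-X e n)) (≈-sym (X-+ _ _))

  -- Every pair yields `f b * f a` times a difference of heads: the first parts combine to n-th
  -- powers of the `f a`, the differences to a Vandermonde determinant whose rows absorb those
  -- powers.
  expansion : ∀ S → AllPairs _▷_ S →
    (sign (total S) * X (exponent S) * offset (map proj₁ S)) * (W S * U S)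
      ≈ Det (λ a s → entry (length S) (proj₁ a) s (proj₂ a)) S (downFrom (length S))
  expansion S v = begin
    (sign (total S) * X (exponent S) * offset (map proj₁ S)) * (W S * U S)
      ≈⟨ *-cong (*-cong (≈-sym (mix-total S)) (≈-sym (offset-map S))) (W-U S) ⟩
    ((Prod f S * M) * K) * (w * (P * V))
      ≈⟨ solve 6 (λ f m k w p v → ((f :* m) :* k) :* (w :* (p :* v)) := (w :* f) :* ((p :* v) :* (k :* m))) ≈-refl _ M K w P V ⟩
    (w * Prod f S) * ((P * V) * (K * M))
      ≈⟨ *-congˡ (≈-trans (*-cong (≈-sym (Pairs-* cross UPair S)) (≈-sym (Pairs-* _ _ S)))
           (≈-trans (≈-sym (Pairs-* _ _ S))
             (≈-trans (Pairs-cong S v λ b a _ _ → pair-expansion b a) (Pairs-* _ _ S)))) ⟩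
    (w * Prod f S) * (Pairs (λ b a → f b * f a) S * heads S)
      ≈⟨ solve 4 (λ w f q h → (w :* f) :* (q :* h) := (w :* (q :* f)) :* h) ≈-refl w _ _ _ ⟩
    (w * (Pairs (λ b a → f b * f a) S * Prod f S)) * heads S
      ≈⟨ *-cong (≈-trans (*-congˡ (Pairs-both f S)) (≈-sym (Prod-* _ _ S)))
           (≈-trans (heads-Det (length S) S refl (AllPairs.map (λ {b} {a} → ▷⇒Apart {b} {a}) v))
             -- Strands become rows, since `Det-weighted` and `Cmp-Det` act row by row.
             (Det-transpose (λ s a → X (s ℕ.* head a)) (downFrom (length S)) S (length-downFrom (length S)))) ⟩
    Prod (λ a → X (μ ℕ.* size a) * pow (f a) (length S)) S * Det (λ a s → X (s ℕ.* head a)) S (downFrom (length S))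
      ≈⟨ Det-weighted _ _ S (downFrom (length S)) ⟩
    Det (λ a s → (X (μ ℕ.* size a) * pow (f a) (length S)) * X (s ℕ.* head a)) S (downFrom (length S))
      ≈⟨ Det-cong (λ a s → entries (length S) (proj₁ a) s (proj₂ a)) S (downFrom (length S)) ⟩
    Det (λ a s → entry (length S) (proj₁ a) s (proj₂ a)) S (downFrom (length S)) ∎
    where
    w = Prod (λ a → X (μ ℕ.* size a)) S
    M = Pairs (λ b a → X (mix b a)) S
    K = Pairs (λ _ a → - X (proj₁ a)) S
    P = Pairs cross S
    V = Pairs UPair S
    entries : ∀ n z s k → (X (μ ℕ.* size (z , k)) * pow (f (z , k)) n) * X (s ℕ.* head (z , k)) ≈ entry n z s k
    entries n z s k = begin
      (X (μ ℕ.* size (z , k)) * pow (sign k * X (size (z , k))) n) * X (s ℕ.* head (z , k))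
        ≈⟨ *-congʳ (*-congˡ (≈-trans (pow-* _ _ n) (*-congˡ (pow-X _ n)))) ⟩
      (X (μ ℕ.* size (z , k)) * (pow (sign k) n * X (n ℕ.* size (z , k)))) * X (s ℕ.* head (z , k))
        ≈⟨ solve 4 (λ m σ x y → (m :* (σ :* x)) :* y := σ :* ((m :* x) :* y)) ≈-refl _ _ _ _ ⟩
      pow (sign k) n * ((X (μ ℕ.* size (z , k)) * X (n ℕ.* size (z , k))) * X (s ℕ.* head (z , k)))
        ≈⟨ *-congˡ (≈-trans (*-congʳ (≈-sym (X-+ _ _))) (≈-trans (≈-sym (X-+ _ _)) (X≡ (trans
             (cong (ℕ._+ s ℕ.* head (z , k)) (sym (ℕₚ.*-distribʳ-+ (size (z , k)) μ n)))
             (cong (λ e → (μ ℕ.+ n) ℕ.* e ℕ.+ s ℕ.* head (z , k)) (size-triangle z k)))))) ⟩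
      entry n z s k ∎

  descending-strands : ∀ {n} S → map proj₁ S ≡ downFrom n → n ≤ c → AllPairs _▷_ S
  descending-strands {n} S e le = AllPairs.map⁻ (subst (AllPairs _) (sym e) (downFrom-descending n c le))

  -- By `mix-total` the prefactor is the same for all compositions of r, so it passes through the
  -- sum.
  family-Det : ∀ n → n ≤ c → ∀ r →
    (sign r * X (sum (downFrom n) ℕ.* r ℕ.+ c ℕ.* triangle r) * offset (downFrom n))
        * Cmp (downFrom n) r (λ S → W S * U S)
      ≈ PSDet.Det (entry n) (downFrom n) (downFrom n) r
  family-Det n le r = begin
    _ ≈⟨ Cmp-*ˡ (downFrom n) r _ _ ⟨
    Cmp (downFrom n) r (λ S → (sign r * X (sum (downFrom n) ℕ.* r ℕ.+ c ℕ.* triangle r) * offset (downFrom n)) * (W S * U S))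
      ≈⟨ Cmp-cong (downFrom n) r term ⟩
    Cmp (downFrom n) r (λ S → Det (λ a s → entry n (proj₁ a) s (proj₂ a)) S (downFrom n))
      ≈⟨ Cmp-Det (entry n) (downFrom n) (downFrom n) r ⟩
    PSDet.Det (entry n) (downFrom n) (downFrom n) r ∎
    where
    term : ∀ S → map proj₁ S ≡ downFrom n → total S ≡ r →
      (sign r * X (sum (downFrom n) ℕ.* r ℕ.+ c ℕ.* triangle r) * offset (downFrom n)) * (W S * U S)
        ≈ Det (λ a s → entry n (proj₁ a) s (proj₂ a)) S (downFrom n)
    term S e refl = begin
      _ ≡⟨ cong (λ zs → (sign (total S) * X (sum zs ℕ.* total S ℕ.+ c ℕ.* triangle (total S)) * offset zs) * (W S * U S)) (sym e) ⟩
      _ ≈⟨ expansion S (descending-strands S e le) ⟩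
      _ ≡⟨ cong (λ n → Det (λ a s → entry n (proj₁ a) s (proj₂ a)) S (downFrom n)) len ⟩
      _ ∎
      where
      len : length S ≡ n
      len = trans (sym (length-map proj₁ S)) (trans (cong length e) (length-downFrom n))

-- Duality between the moduli n and m + n

module Duality (Q : QRing) (m n : ℕ) (n>0 : 0 < n) where
  open QRing Q
  open Monomials Q
  open Offset Q
  open CommutativeRing base renaming (refl to ≈-refl; sym to ≈-sym; trans to ≈-trans)
  open Compositions base
  open Antisymmetry base
  open IntegerCoefficients base using (module Solver)
  open Solver using (solve; _:*_; _:=_)
  open Relation.Binary.Reasoning.Setoid setoid

  κ>0 : 0 < m ℕ.+ n
  κ>0 = ℕₚ.<-≤-trans n>0 (ℕₚ.m≤n+m n m)

  module F₁ = Family Q n n>0 m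
  module F₂ = Family Q (m ℕ.+ n) κ>0 0
  module W₁ = Strands.Weighted Q n n>0 m
  module W₂ = Strands.Weighted Q (m ℕ.+ n) κ>0 0

  -- The two matrices are transposes of each other.
  duality : ∀ r → Cmp (downFrom n) r (λ S → W₁.W S * F₁.U S)
    ≈ X (m ℕ.* triangle r) * Cmp (downFrom n) r (λ S → W₂.W S * F₂.U S)
  duality r = offset-regular (downFrom n) (X-cancel e₁ (signed (begin
    sign r * (X e₁ * (K * C₁))
      ≈⟨ solve 4 (λ s x k c → s :* (x :* (k :* c)) := (s :* x :* k) :* c) ≈-refl _ _ K C₁ ⟩
    (sign r * X e₁ * K) * C₁
      ≈⟨ F₁.family-Det n ℕₚ.≤-refl r ⟩
    PSDet.Det (F₁.entry n) (downFrom n) (downFrom n) r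
      ≈⟨ PSDet.Det-transpose (F₁.entry n) (downFrom n) (downFrom n) refl r ⟩
    PSDet.Det (λ s z → F₁.entry n z s) (downFrom n) (downFrom n) r
      ≈⟨ PSDet.Det-cong (λ s z k → *-congˡ (X≡ (exponents m n z s k (triangle k)))) (downFrom n) (downFrom n) r ⟩
    PSDet.Det (F₂.entry n) (downFrom n) (downFrom n) r
      ≈⟨ F₂.family-Det n (ℕₚ.m≤n+m n m) r ⟨
    (sign r * X (sum (downFrom n) ℕ.* r ℕ.+ (m ℕ.+ n) ℕ.* triangle r) * K) * C₂
      ≈⟨ *-congʳ (*-congʳ (*-congˡ (≈-trans (X≡ (split m n (sum (downFrom n) ℕ.* r) (triangle r))) (X-+ _ _)))) ⟩
    (sign r * (X e₁ * X (m ℕ.* triangle r)) * K) * C₂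
      ≈⟨ solve 5 (λ s x y k c → (s :* (x :* y) :* k) :* c := s :* (x :* (k :* (y :* c)))) ≈-refl _ _ _ K C₂ ⟩
    sign r * (X e₁ * (K * (X (m ℕ.* triangle r) * C₂))) ∎)))
    where
    K = offset (downFrom n)
    C₁ = Cmp (downFrom n) r (λ S → W₁.W S * F₁.U S)
    C₂ = Cmp (downFrom n) r (λ S → W₂.W S * F₂.U S)
    e₁ = sum (downFrom n) ℕ.* r ℕ.+ n ℕ.* triangle r
    signed : ∀ {u v} → sign r * u ≈ sign r * v → u ≈ v
    signed {u} {v} e = ≈-trans (≈-sym (twice u)) (≈-trans (*-congˡ e) (twice v))
      where
      twice : ∀ u → sign r * (sign r * u) ≈ u
      twice u = ≈-trans (≈-sym (*-assoc _ _ u)) (≈-trans (*-congʳ (sign-square r)) (*-identityˡ u))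
    -- Both sides expand to (m + n) z k + n s k + n (m + n) t + s z. The weights m and 0 are what
    -- balances the moduli n and m + n here.
    exponents : ∀ m n z s k t → (m ℕ.+ n) ℕ.* (z ℕ.* k ℕ.+ n ℕ.* t) ℕ.+ s ℕ.* (z ℕ.+ n ℕ.* k)
      ≡ n ℕ.* (s ℕ.* k ℕ.+ (m ℕ.+ n) ℕ.* t) ℕ.+ z ℕ.* (s ℕ.+ (m ℕ.+ n) ℕ.* k)
    exponents = solve-∀
    split : ∀ m n a t → a ℕ.+ (m ℕ.+ n) ℕ.* t ≡ a ℕ.+ n ℕ.* t ℕ.+ m ℕ.* t
    split = solve-∀

-- Divisibility by powers of q and congruences

module Divisibility (Q : QRing) where
  open QRing Q
  open Monomials Q
  open CommutativeRing base renaming (refl to ≈-refl; sym to ≈-sym; trans to ≈-trans)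
  open Compositions base
  open PowerSeries base using (Conv)
  open IntegerCoefficients base using (module Solver)
  open Solver using (solve; _:*_; _:-_; :-_; con; _:=_)

  record Divisible (e : ℕ) (x : Carrier) : Set where
    constructor divisible
    field
      quotient  : Carrier
      equality  : x ≈ X e * quotient

  Divisible-resp : ∀ {e x y} → x ≈ y → Divisible e x → Divisible e y
  Divisible-resp p (divisible h q) = divisible h (≈-trans (≈-sym p) q)

  Divisible-0 : ∀ e → Divisible e 0#
  Divisible-0 e = divisible 0# (≈-sym (zeroʳ _))

  Divisible-zero : ∀ x → Divisible 0 x
  Divisible-zero x = divisible x (≈-sym (≈-trans (*-congʳ X-0) (*-identityˡ x)))

  Divisible-X : ∀ e → Divisible e (X e)
  Divisible-X e = divisible 1# (≈-sym (*-identityʳ _))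

  Divisible-+ : ∀ {e x y} → Divisible e x → Divisible e y → Divisible e (x + y)
  Divisible-+ (divisible h p) (divisible k q) = divisible (h + k) (≈-trans (+-cong p q) (≈-sym (distribˡ _ h k)))

  Divisible-*ˡ : ∀ {e} a {x} → Divisible e x → Divisible e (a * x)
  Divisible-*ˡ a (divisible h p) = divisible (a * h) (≈-trans (*-congˡ p)
    (solve 3 (λ a x h → a :* (x :* h) := x :* (a :* h)) ≈-refl a _ h))

  Divisible-*ʳ : ∀ {e} a {x} → Divisible e x → Divisible e (x * a)
  Divisible-*ʳ a p = Divisible-resp (*-comm a _) (Divisible-*ˡ a p)

  Divisible-neg : ∀ {e x} → Divisible e x → Divisible e (- x)
  Divisible-neg {e} {x} p = Divisible-resp (solve 1 (λ x → :- con (+ 1) :* x := :- x) ≈-refl x) (Divisible-*ˡ (- 1#) p)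

  Divisible-* : ∀ {d e x y} → Divisible d x → Divisible e y → Divisible (d ℕ.+ e) (x * y)
  Divisible-* {d} {e} (divisible h p) (divisible k q) = divisible (h * k) (≈-trans (*-cong p q)
    (≈-trans (solve 4 (λ a h b k → (a :* h) :* (b :* k) := (a :* b) :* (h :* k)) ≈-refl _ h _ k)
      (*-congʳ (≈-sym (X-+ d e)))))

  Divisible-≤ : ∀ {d e x} → d ≤ e → Divisible e x → Divisible d x
  Divisible-≤ {d} {e} le (divisible h p) = divisible (X (e ∸ d) * h)
    (≈-trans p (≈-trans (*-congʳ (X-≤ le)) (*-assoc _ _ h)))

  Divisible-cancel : ∀ a {d x} → Divisible (a ℕ.+ d) (X a * x) → Divisible d x
  Divisible-cancel a {d} (divisible h p) = divisible h (X-cancel a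
    (≈-trans p (≈-trans (*-congʳ (X-+ a d)) (*-assoc _ _ h))))

  Divisible-Conv : ∀ {e} r h → (∀ i j → i ℕ.+ j ≡ r → Divisible e (h i j)) → Divisible e (Conv r h)
  Divisible-Conv zero    h p = p 0 0 refl
  Divisible-Conv (suc r) h p = Divisible-+ (p 0 (suc r) refl)
    (Divisible-Conv r _ λ i j q → p (suc i) j (cong suc q))

  Divisible-Cmp : ∀ {e} {A : Set} (zs : List A) r f →
    (∀ S → map proj₁ S ≡ zs → total S ≡ r → Divisible e (f S)) → Divisible e (Cmp zs r f)
  Divisible-Cmp []       zero    f p = p [] refl refl
  Divisible-Cmp []       (suc r) f p = Divisible-0 _
  Divisible-Cmp (z ∷ zs) r       f p = Divisible-Conv r _ λ i j q → Divisible-Cmp zs j _ λ S m t →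
    p ((z , i) ∷ S) (cong (z ∷_) m) (trans (cong (i ℕ.+_) t) q)

-- Congruence modulo the ideal of those x for which t x is divisible by q^d.
module Congruence (Q : QRing) (t : CommutativeRing.Carrier (QRing.base Q)) (d : ℕ) where
  open QRing Q
  open CommutativeRing base renaming (refl to ≈-refl; sym to ≈-sym; trans to ≈-trans)
  open Divisibility Q
  open Folds base
  open IntegerCoefficients base using (module Solver)
  open Solver using (solve; _:+_; _:*_; _:-_; :-_; _:=_)

  infix 4 _∼_
  record _∼_ (x y : Carrier) : Set where
    constructor congruent
    field difference : Divisible d (t * (x - y))
  open _∼_ public

  lift : ∀ {x y} → x ≈ y → x ∼ y
  lift {x} {y} e = congruent (Divisible-resp
    (≈-sym (≈-trans (*-congˡ (≈-trans (+-congʳ e) (-‿inverseʳ y))) (zeroʳ t))) (Divisible-0 d))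

  ∼-refl : ∀ {x} → x ∼ x
  ∼-refl = lift ≈-refl

  ∼-sym : ∀ {x y} → x ∼ y → y ∼ x
  ∼-sym {x} {y} (congruent p) = congruent
    (Divisible-resp (solve 3 (λ t x y → :- (t :* (x :- y)) := t :* (y :- x)) ≈-refl t x y) (Divisible-neg p))

  ∼-trans : ∀ {x y z} → x ∼ y → y ∼ z → x ∼ z
  ∼-trans {x} {y} {z} (congruent p) (congruent q) = congruent (Divisible-resp
    (solve 4 (λ t x y z → t :* (x :- y) :+ t :* (y :- z) := t :* (x :- z)) ≈-refl t x y z) (Divisible-+ p q))

  ∼-+ : ∀ {x y u v} → x ∼ y → u ∼ v → x + u ∼ y + v
  ∼-+ {x} {y} {u} {v} (congruent p) (congruent q) = congruent (Divisible-resp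
    (solve 5 (λ t x y u v → t :* (x :- y) :+ t :* (u :- v) := t :* ((x :+ u) :- (y :+ v))) ≈-refl t x y u v)
    (Divisible-+ p q))

  ∼-* : ∀ {x y u v} → x ∼ y → u ∼ v → x * u ∼ y * v
  ∼-* {x} {y} {u} {v} (congruent p) (congruent q) = congruent (Divisible-resp
    (solve 5 (λ t x y u v → u :* (t :* (x :- y)) :+ y :* (t :* (u :- v)) := t :* (x :* u :- y :* v)) ≈-refl t x y u v)
    (Divisible-+ (Divisible-*ˡ u p) (Divisible-*ˡ y q)))

  module _ {A : Set} where

    Prod-∼ : {f g : A → Carrier} (L : List A) → (∀ x → x ∈ L → f x ∼ g x) → Prod f L ∼ Prod g L
    Prod-∼ []      h = ∼-refl
    Prod-∼ (x ∷ L) h = ∼-* (h x (here refl)) (Prod-∼ L λ y m → h y (there m))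

    Prod-∼-All : {P : A → Set} {f g : A → Carrier} (L : List A) → All P L →
      (∀ x → x ∈ L → P x → f x ∼ g x) → Prod f L ∼ Prod g L
    Prod-∼-All []      []       h = ∼-refl
    Prod-∼-All (x ∷ L) (p ∷ ps) h = ∼-* (h x (here refl) p) (Prod-∼-All L ps λ y m → h y (there m))

    Pairs-∼ : {_#_ : A → A → Set} {f g : A → A → Carrier} (L : List A) → AllPairs _#_ L →
      (∀ x y → x ∈ L → y ∈ L → x # y → f x y ∼ g x y) → Pairs f L ∼ Pairs g L
    Pairs-∼                   []      []       h = ∼-refl
    Pairs-∼ {_#_} {f} {g} (x ∷ L) (v ∷ vs) h = ∼-*
      (Prod-∼-All {P = x #_} {f x} {g x} L v λ y m → h x y (here refl) (there m))
      (Pairs-∼ {_#_} {f} {g} L vs λ y z m n → h y z (there m) (there n))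

    Sel-∼ : {f g : A → List A → Carrier} (L : List A) →
      (∀ x r → L ↭ x ∷ r → f x r ∼ g x r) → Sel f L ∼ Sel g L
    Sel-∼ []      h = ∼-refl
    Sel-∼ (x ∷ L) h = ∼-+ (h x L ↭-refl)
      (Sel-∼ L λ y r p → h y (x ∷ r) (↭-trans (prep x p) (swap x y ↭-refl)))

∈-↭ : {A : Set} {x : A} {L : List A} → x ∈ L → Σ (List A) λ r → L ↭ x ∷ r
∈-↭ {x = x} m with ∈-∃++ m
... | ys , zs , refl = ys ++ zs , shift x ys zs

-- Replacing U by its limit inside the sum

module Truncation (Q : QRing) (c : ℕ) (c>0 : 0 < c) (μ : ℕ) where
  open QRing Q
  open Monomials Q
  open Divisibility Q
  open CommutativeRing base renaming (refl to ≈-refl; sym to ≈-sym; trans to ≈-trans)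
  open Folds base
  open Compositions base
  open Strands Q c c>0
  open Weighted μ
  open Expansion Q c c>0
  open Family Q c c>0 μ
  open IntegerCoefficients base using (module Solver)
  open Solver using (solve; _:+_; _:*_; _:-_; :-_; con; _:=_)

  -- The elements z + c i with l < i < k lie above the point, and each of these k - l - 1 factors is
  -- divisible by q.
  τ-divisible : ∀ z w k l → w < c → Divisible (k ∸ suc l) (τ z k (w ℕ.+ c ℕ.* l))
  τ-divisible z w zero    l w<c = Divisible-zero _
  τ-divisible z w (suc k) l w<c with l ℕ.<? k
  ... | no  l≮k = Divisible-≤ (ℕₚ.≤-reflexive (ℕₚ.m≤n⇒m∸n≡0 (s≤s (ℕₚ.≮⇒≥ l≮k)))) (Divisible-zero _)
  ... | yes l<k = Divisible-≤ (ℕₚ.≤-reflexive (trans (ℕₚ.+-∸-assoc 1 l<k) (ℕₚ.+-comm 1 _)))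
    (Divisible-* (τ-divisible z w k l w<c)
      (Divisible-resp (reflexive (sym (p-> below)))
        (Divisible-neg (Divisible-*ʳ _ (Divisible-≤ (ℕₚ.m<n⇒0<n∸m below) (Divisible-X _))))))
    where
    below : w ℕ.+ c ℕ.* l < z ℕ.+ c ℕ.* k
    below = ℕₚ.<-≤-trans (ℕₚ.+-monoˡ-< (c ℕ.* l) w<c) (ℕₚ.≤-trans (ℕₚ.≤-reflexive (sym (ℕₚ.*-suc c l)))
      (ℕₚ.≤-trans (ℕₚ.*-monoʳ-≤ c l<k) (ℕₚ.m≤n+m _ z)))

  T-divisible : ∀ S → (∀ {a} → a ∈ S → proj₁ a < c) → ∀ {a b} → a ∈ S → b ∈ S →
    Divisible (proj₂ a ∸ suc (proj₂ b)) (T S)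
  T-divisible S small {a} {b} a∈ b∈ with ∈-↭ a∈
  ... | r , e with ∈-resp-↭ e b∈
  ... | here refl = Divisible-≤ (ℕₚ.≤-reflexive (ℕₚ.m≤n⇒m∸n≡0 (ℕₚ.n≤1+n (proj₂ a)))) (Divisible-zero _)
  ... | there b∈r with ∈-↭ b∈r
  ... | r′ , e′ = Divisible-resp (≈-sym (T-↭ (↭-trans e (prep a e′))))
    (Divisible-*ˡ _ (Divisible-*ʳ _ (Divisible-*ʳ _ (Divisible-*ʳ _
      (τ-divisible (proj₁ a) (proj₁ b) (proj₂ a) (proj₂ b) (small b∈))))))

  -- The additional factors are 1 - q^e with e ≥ d + c k ≥ k + 1.
  partialPoch-stable : ∀ d k j → 0 < d → Divisible (suc k) (partialPoch d (j ℕ.+ k) - partialPoch d k)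
  partialPoch-stable d k zero    d>0 = Divisible-resp (≈-sym (-‿inverseʳ _)) (Divisible-0 _)
  partialPoch-stable d k (suc j) d>0 = Divisible-resp
    (solve 3 (λ u x v → (u :- v) :+ :- (u :* x) := u :* (con (+ 1) :- x) :- v) ≈-refl _ _ _)
    (Divisible-+ (partialPoch-stable d k j d>0) (Divisible-neg (Divisible-*ˡ _
      (Divisible-≤ bound (Divisible-X _)))))
    where
    bound : suc k ≤ d ℕ.+ c ℕ.* (j ℕ.+ k)
    bound = ℕₚ.+-mono-≤ d>0 (ℕₚ.≤-trans (ℕₚ.m≤n+m k j) (ℕₚ.m≤n*m (j ℕ.+ k) c ⦃ ℕ.>-nonZero c>0 ⦄))

  poch-partialPoch : ∀ k → poch k ≈ partialPoch c k
  poch-partialPoch zero    = ≈-refl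
  poch-partialPoch (suc k) = *-cong (poch-partialPoch k) (+-congˡ (-‿cong (X≡ (ℕₚ.*-suc c k))))

  -- `U` with every part replaced by a common `M`, hence independent of the composition.
  full : ℕ → List ℕ → Carrier
  full M zs = Prod (λ _ → partialPoch c M) zs
    * Pairs (λ b a → partialPoch (b ∸ a) (suc M) * partialPoch (c ∸ (b ∸ a)) M) zs

  Prod-residues : ∀ (h : ℕ → Carrier) (S : List Strand) → Prod (h ∘ proj₁) S ≡ Prod h (map proj₁ S)
  Prod-residues h []      = refl
  Prod-residues h (a ∷ S) = cong (h (proj₁ a) *_) (Prod-residues h S)

  Pairs-residues : ∀ (h : ℕ → ℕ → Carrier) (S : List Strand) →
    Pairs (λ b a → h (proj₁ b) (proj₁ a)) S ≡ Pairs h (map proj₁ S)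
  Pairs-residues h []      = refl
  Pairs-residues h (a ∷ S) = cong₂ _*_ (Prod-residues (h (proj₁ a)) S) (Pairs-residues h S)

  -- If one part is large, T is divisible by a high power of q unless the other parts are large as well.
  T-U-full : ∀ S d M → AllPairs _▷_ S → (∀ {a} → a ∈ S → proj₁ a < c) → (∀ {a} → a ∈ S → proj₂ a ≤ M) →
    ∀ {a} → a ∈ S → d ≤ proj₂ a → Divisible d (T S * (U S - full M (map proj₁ S)))
  T-U-full S d M v small le {a} a∈ large = difference (∼-* diagonals pairs)
    where
    open Congruence Q (T S) d
    stable : ∀ e {b} → b ∈ S → ∀ i {k j} → 0 < e → k ≡ i ℕ.+ proj₂ b → partialPoch e (j ℕ.+ k) ∼ partialPoch e k
    stable e {b} b∈ i {k} {j} e>0 refl = congruent (Divisible-≤ bound (Divisible-* (T-divisible S small a∈ b∈)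
        (partialPoch-stable e (i ℕ.+ proj₂ b) j e>0)))
      where
      -- With k_a ≥ d the large part, `T` supplies q^(k_a - k_b - 1) and stability q^(k_b + 1);
      -- together this is at least q^(k_a).
      bound : d ≤ (proj₂ a ∸ suc (proj₂ b)) ℕ.+ suc (i ℕ.+ proj₂ b)
      bound = ℕₚ.≤-trans large (ℕₚ.≤-trans (ℕₚ.m≤n+m∸n (proj₂ a) (suc (proj₂ b)))
        (ℕₚ.≤-trans (ℕₚ.≤-reflexive (ℕₚ.+-comm (suc (proj₂ b)) _))
          (ℕₚ.+-monoʳ-≤ _ (s≤s (ℕₚ.m≤n+m (proj₂ b) i)))))
    grown : ∀ e {b} → b ∈ S → 0 < e → partialPoch e (proj₂ b) ∼ partialPoch e M
    grown e {b} b∈ e>0 = subst (λ M → partialPoch e (proj₂ b) ∼ partialPoch e M) (ℕₚ.m∸n+n≡m (le b∈))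
      (∼-sym (stable e b∈ 0 {j = M ∸ proj₂ b} e>0 refl))
    grown⁺ : ∀ e {b} → b ∈ S → 0 < e → partialPoch e (suc (proj₂ b)) ∼ partialPoch e (suc M)
    grown⁺ e {b} b∈ e>0 = subst (λ M → partialPoch e (suc (proj₂ b)) ∼ partialPoch e M)
      (trans (ℕₚ.+-suc (M ∸ proj₂ b) (proj₂ b)) (cong suc (ℕₚ.m∸n+n≡m (le b∈))))
      (∼-sym (stable e b∈ 1 {j = M ∸ proj₂ b} e>0 refl))
    diagonals : Prod (poch ∘ proj₂) S ∼ Prod (λ _ → partialPoch c M) (map proj₁ S)
    diagonals = subst (Prod (poch ∘ proj₂) S ∼_) (Prod-residues _ S)
      (Prod-∼ S λ b b∈ → ∼-trans (lift (poch-partialPoch (proj₂ b))) (grown c b∈ c>0))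
    pairs : Pairs UPair S ∼ Pairs (λ b a → partialPoch (b ∸ a) (suc M) * partialPoch (c ∸ (b ∸ a)) M) (map proj₁ S)
    pairs = subst (Pairs UPair S ∼_) (Pairs-residues _ S) (Pairs-∼ S v λ b a b∈ a∈ (ab , bc) →
      ∼-* (grown⁺ _ b∈ (ℕₚ.m<n⇒0<n∸m ab)) (grown _ a∈ (ℕₚ.m<n⇒0<n∸m (ℕₚ.≤-<-trans (ℕₚ.m∸n≤m (proj₁ b) (proj₁ a)) bc))))

  part≤total : ∀ {S : List Strand} {a} → a ∈ S → proj₂ a ≤ total S
  part≤total {(_ , k) ∷ S} (here refl) = ℕₚ.m≤m+n k _
  part≤total {(_ , k) ∷ S} (there m)   = ℕₚ.≤-trans (part≤total m) (ℕₚ.m≤n+m _ k)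

  -- Pigeonhole on the parts.
  large-part : ∀ d (S : List Strand) → S ≢ [] → length S ℕ.* d ≤ total S → Σ Strand λ a → a ∈ S × d ≤ proj₂ a
  large-part d []                    ne _  = contradiction refl ne
  large-part d ((z , k) ∷ S) ne le with d ℕ.≤? k
  ... | yes p = (z , k) , here refl , p
  large-part d ((z , k) ∷ [])    ne le | no ¬p =
    contradiction (subst₂ _≤_ (ℕₚ.+-identityʳ d) (ℕₚ.+-identityʳ k) le) ¬p
  large-part d ((z , k) ∷ S@(_ ∷ _)) ne le | no ¬p with large-part d S (λ ())
    (ℕₚ.+-cancelˡ-≤ d _ _ (ℕₚ.≤-trans le (ℕₚ.+-monoˡ-≤ (total S) (ℕₚ.<⇒≤ (ℕₚ.≰⇒> ¬p)))))
  ... | a , a∈ , q = a , there a∈ , q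

  weight : List Strand → ℕ
  weight []      = 0
  weight (a ∷ S) = size a ℕ.+ weight S

  weight-X : ∀ S → Prod (λ a → X (μ ℕ.* size a)) S ≈ X (μ ℕ.* weight S)
  weight-X []      = ≈-sym (≈-trans (X≡ (ℕₚ.*-zeroʳ μ)) X-0)
  weight-X (a ∷ S) = ≈-trans (*-congˡ (weight-X S)) (≈-trans (≈-sym (X-+ _ _))
    (X≡ (sym (ℕₚ.*-distribˡ-+ μ (size a) (weight S)))))

  residue< : ∀ {n} → n ≤ c → ∀ (S : List Strand) → map proj₁ S ≡ downFrom n → ∀ {a} → a ∈ S → proj₁ a < c
  residue< {n} le S e a∈ = ℕₚ.<-≤-trans (∈-downFrom⁻ (subst (_ ∈_) e (∈-map⁺ proj₁ a∈))) le

  -- The monomial weight contributes q^e, and `T` times the error of `U` contributes q^d, the large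
  -- part being provided by n d ≤ r.
  truncated-sum : ∀ n → 0 < n → n ≤ c → ∀ r d e → n ℕ.* d ≤ r →
    (∀ S → map proj₁ S ≡ downFrom n → total S ≡ r → e ≤ μ ℕ.* weight S) →
    Divisible (e ℕ.+ d) (Cmp (downFrom n) r (λ S → W S * U S) - full r (downFrom n) * Cmp (downFrom n) r W)
  truncated-sum n n>0 le r d e nd≤r heavy = Divisible-resp
    (≈-trans (Cmp-minus (downFrom n) r _ _) (+-congˡ (-‿cong (Cmp-*ˡ (downFrom n) r _ W))))
    (Divisible-Cmp (downFrom n) r _ term)
    where
    term : ∀ S → map proj₁ S ≡ downFrom n → total S ≡ r →
      Divisible (e ℕ.+ d) (W S * U S - full r (downFrom n) * W S)
    term S m t = Divisible-resp
      (solve 4 (λ w T U F → w :* (T :* (U :- F)) := (w :* T) :* U :- F :* (w :* T)) ≈-refl _ (T S) (U S) _)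
      (Divisible-* (Divisible-resp (≈-sym (weight-X S)) (Divisible-≤ (heavy S m t) (Divisible-X _)))
        (subst (λ zs → Divisible d (T S * (U S - full r zs))) m
          (T-U-full S d r (descending-strands S m le) (residue< le S m)
            (λ b∈ → subst (_ ≤_) t (part≤total b∈)) (proj₁ (proj₂ big)) (proj₂ (proj₂ big)))))
      where
      len : length S ≡ n
      len = trans (sym (length-map proj₁ S)) (trans (cong length m) (length-downFrom n))
      big : Σ Strand λ a → a ∈ S × d ≤ proj₂ a
      big = large-part d S (λ { refl → ℕₚ.<⇒≢ n>0 len }) (subst₂ _≤_ (cong (ℕ._* d) (sym len)) (sym t) nd≤r)

-- The difference of the two sides is (k - l)(k - l + 1)/2, half a product of consecutive integers.
product≤triangles : ∀ k l → k ℕ.* l ≤ k ℕ.+ triangle k ℕ.+ triangle l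
product≤triangles zero    l       = z≤n
product≤triangles (suc k) zero    = ℕₚ.≤-trans (ℕₚ.≤-reflexive (ℕₚ.*-zeroʳ k)) z≤n
product≤triangles (suc k) (suc l) = subst₂ _≤_ (left k l) (right k l (triangle k) (triangle l))
  (ℕₚ.+-monoˡ-≤ (k ℕ.+ l ℕ.+ 1) (product≤triangles k l))
  where
  left : ∀ k l → k ℕ.* l ℕ.+ (k ℕ.+ l ℕ.+ 1) ≡ suc k ℕ.* suc l
  left = solve-∀
  right : ∀ k l s t → k ℕ.+ s ℕ.+ t ℕ.+ (k ℕ.+ l ℕ.+ 1) ≡ suc k ℕ.+ (s ℕ.+ k) ℕ.+ (t ℕ.+ l)
  right = solve-∀

-- The congruence satisfied by the Hall-Littlewood series

module Limit (Q : QRing) (m n : ℕ) (n>0 : 0 < n) where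
  open QRing Q
  open Divisibility Q
  open CommutativeRing base renaming (refl to ≈-refl; sym to ≈-sym; trans to ≈-trans)
  open Compositions base
  open Duality Q m n n>0
  open IntegerCoefficients base using (module Solver)
  open Solver using (solve; _:+_; _:*_; _:-_; :-_; _:=_)
  open Relation.Binary.Reasoning.Setoid setoid

  module T₁ = Truncation Q n n>0 m
  module T₂ = Truncation Q (m ℕ.+ n) κ>0 0
  module S₂ = Strands Q (m ℕ.+ n) κ>0

  linear : List (ℕ × ℕ) → ℕ
  linear []            = 0
  linear ((z , k) ∷ S) = z ℕ.* k ℕ.+ linear S

  triangles : List (ℕ × ℕ) → ℕ
  triangles []            = 0
  triangles ((z , k) ∷ S) = triangle k ℕ.+ triangles S

  weight≡ : ∀ S → T₁.weight S ≡ linear S ℕ.+ n ℕ.* triangles S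
  weight≡ []            = sym (ℕₚ.*-zeroʳ n)
  weight≡ ((z , k) ∷ S) = trans (cong₂ ℕ._+_ (Expansion.size-triangle Q n n>0 z k) (weight≡ S))
    (lemma (z ℕ.* k) n (triangle k) (linear S) (triangles S)) where
    lemma : ∀ a n s b t → a ℕ.+ n ℕ.* s ℕ.+ (b ℕ.+ n ℕ.* t) ≡ a ℕ.+ b ℕ.+ n ℕ.* (s ℕ.+ t)
    lemma = solve-∀

  -- The right side adds up the elements of strands modulo j, which are distinct naturals, so it is
  -- at least 0 + 1 + ... + (r - 1) for total r. The induction raises the modulus along with the
  -- number of strands and pays for the mixed term k l of triangle (k + l) by `product≤triangles`.
  heavy : ∀ j S → map proj₁ S ≡ downFrom j → triangle (total S) ≤ linear S ℕ.+ j ℕ.* triangles S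
  heavy zero    []            _ = z≤n
  heavy (suc j) ((z , k) ∷ S) e with refl ← ∷-injectiveˡ e = begin′
    where
    e′ = ∷-injectiveʳ e
    rows : ∀ i S → length S ≡ i → k ℕ.* total S ≤ i ℕ.* k ℕ.+ i ℕ.* triangle k ℕ.+ triangles S
    rows zero    []            _ = ℕₚ.≤-reflexive (ℕₚ.*-zeroʳ k)
    rows (suc i) ((y , l) ∷ S) p = subst₂ _≤_ (sym (ℕₚ.*-distribˡ-+ k l (total S)))
      (lemma k i (triangle k) (triangle l) (triangles S))
      (ℕₚ.+-mono-≤ (product≤triangles k l) (rows i S (ℕₚ.suc-injective p)))
      where
      lemma : ∀ k i s t u → k ℕ.+ s ℕ.+ t ℕ.+ (i ℕ.* k ℕ.+ i ℕ.* s ℕ.+ u) ≡ suc i ℕ.* k ℕ.+ suc i ℕ.* s ℕ.+ (t ℕ.+ u)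
      lemma = solve-∀
    len : length S ≡ j
    len = trans (sym (length-map proj₁ S)) (trans (cong length e′) (length-downFrom j))
    lemma : ∀ j k s t a → s ℕ.+ (a ℕ.+ j ℕ.* t) ℕ.+ (j ℕ.* k ℕ.+ j ℕ.* s ℕ.+ t) ≡ j ℕ.* k ℕ.+ a ℕ.+ suc j ℕ.* (s ℕ.+ t)
    lemma = solve-∀
    begin′ : triangle (k ℕ.+ total S) ≤ j ℕ.* k ℕ.+ linear S ℕ.+ suc j ℕ.* (triangle k ℕ.+ triangles S)
    begin′ = subst₂ _≤_ (sym (triangle-+ k (total S))) (lemma j k (triangle k) (triangles S) (linear S))
      (ℕₚ.+-mono-≤ (ℕₚ.+-monoʳ-≤ (triangle k) (heavy j S e′)) (rows j S len))

  -- The Hall-Littlewood series P_{(m^r)}(1, q, q², …; q^n).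
  P : ℕ → Carrier
  P r = Cmp (downFrom n) r W₁.W

  heavy₁ : ∀ r S → map proj₁ S ≡ downFrom n → total S ≡ r → m ℕ.* triangle r ≤ m ℕ.* T₁.weight S
  heavy₁ r S e refl = ℕₚ.*-monoʳ-≤ m (ℕₚ.≤-trans (heavy n S e) (ℕₚ.≤-reflexive (sym (weight≡ S))))

  P-divisible : ∀ r → Divisible (m ℕ.* triangle r) (P r)
  P-divisible r = Divisible-Cmp (downFrom n) r W₁.W λ S e t → Divisible-*ʳ _
    (Divisible-resp (≈-sym (T₁.weight-X S)) (Divisible-≤ (heavy₁ r S e t) (Divisible-X _)))

  poch-sum : ∀ r → S₂.poch r * Cmp (downFrom n) r W₂.W ≈ 1#
  poch-sum r = ≈-trans (W₂.path-sum (downFrom n) apart r)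
    (S₂.H-weightless r (map (_, 0) (downFrom n)) (W₂.valid-strands _ (residues-zeros (downFrom n)) apart) (nonempty n n>0))
    where
    apart : AllPairs S₂.Apart (downFrom n)
    apart = downFrom-apart n (m ℕ.+ n) (ℕₚ.m≤n+m n m)
    nonempty : ∀ n → 0 < n → map (_, 0) (downFrom n) ≢ []
    nonempty (suc n) _ ()

  -- This is `duality` with both sums truncated; the second becomes `full` times a sum that (q^κ;
  -- q^κ)_r turns into 1 by `poch-sum`.
  main-congruence : ∀ d r → n ℕ.* d ≤ r → Divisible (m ℕ.* triangle r ℕ.+ d)
    (P r * (T₁.full r (downFrom n) * S₂.poch r) - X (m ℕ.* triangle r) * T₂.full r (downFrom n))
  main-congruence d r le = Divisible-resp (begin
      - (φ * (C₁ - f₁ * P r)) + X e * (φ * (C₂ - f₂ * G))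
        ≈⟨ +-congʳ (-‿cong (*-congˡ (+-congʳ (duality r)))) ⟩
      - (φ * (X e * C₂ - f₁ * P r)) + X e * (φ * (C₂ - f₂ * G))
        ≈⟨ solve 7 (λ φ x C f p h G → :- (φ :* (x :* C :- f :* p)) :+ x :* (φ :* (C :- h :* G))
             := p :* (f :* φ) :- x :* (h :* (φ :* G))) ≈-refl φ (X e) C₂ f₁ (P r) f₂ G ⟩
      P r * (f₁ * φ) - X e * (f₂ * (φ * G))
        ≈⟨ +-congˡ (-‿cong (*-congˡ (≈-trans (*-congˡ (poch-sum r)) (*-identityʳ f₂)))) ⟩
      P r * (f₁ * φ) - X e * f₂ ∎)
    (Divisible-+
      (Divisible-neg (Divisible-*ˡ φ (T₁.truncated-sum n n>0 ℕₚ.≤-refl r d e le (heavy₁ r))))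
      (Divisible-* (Divisible-X e) (Divisible-*ˡ φ
        (T₂.truncated-sum n n>0 (ℕₚ.m≤n+m n m) r d 0 le λ _ _ _ → z≤n))))
    where
    e = m ℕ.* triangle r
    φ = S₂.poch r
    f₁ = T₁.full r (downFrom n)
    f₂ = T₂.full r (downFrom n)
    C₁ = Cmp (downFrom n) r (λ S → W₁.W S * F₁.U S)
    C₂ = Cmp (downFrom n) r (λ S → W₂.W S * F₂.U S)
    G = Cmp (downFrom n) r W₂.W

-- Reflection of the theta product

module Reflection (R : CommutativeRing 0ℓ 0ℓ) where
  open CommutativeRing R renaming (refl to ≈-refl; sym to ≈-sym; trans to ≈-trans)
  open Folds R
  open Antisymmetry R using (pow)
  open IntegerCoefficients R using (module Solver)
  open Solver using (solve; _:*_; _:=_)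
  open Relation.Binary.Reasoning.Setoid setoid

  initial : (ℕ → Carrier) → ℕ → Carrier
  initial v zero    = 1#
  initial v (suc k) = initial v k * v (suc k)

  range : (ℕ → Carrier) → ℕ → ℕ → Carrier
  range v m zero    = 1#
  range v m (suc k) = range v m k * v (m ℕ.+ k)

  range-head : ∀ v m k → range v m (suc k) ≈ v m * range v (suc m) k
  range-head v m zero    = ≈-trans (*-identityˡ _) (≈-trans (reflexive (cong v (ℕₚ.+-identityʳ m))) (≈-sym (*-identityʳ _)))
  range-head v m (suc k) = ≈-trans (*-cong (range-head v m k) (reflexive (cong v (ℕₚ.+-suc m k)))) (*-assoc _ _ _)

  range-+ : ∀ v k l → range v 0 (k ℕ.+ l) ≈ range v 0 k * range v k l
  range-+ v k zero    = ≈-trans (reflexive (cong (range v 0) (ℕₚ.+-identityʳ k))) (≈-sym (*-identityʳ _))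
  range-+ v k (suc l) = ≈-trans (reflexive (cong (range v 0) (ℕₚ.+-suc k l)))
    (≈-trans (*-congʳ (range-+ v k l)) (*-assoc _ _ _))

  Prod-downFrom : ∀ (v : ℕ → Carrier) n → Prod (λ a → v (n ∸ a)) (downFrom n) ≈ initial v n
  Prod-downFrom v n = ≈-trans (≈-sym (*-identityˡ _)) (go n 0 (ℕₚ.+-identityʳ n))
    where
    go : ∀ k j → k ℕ.+ j ≡ n → initial v j * Prod (λ a → v (n ∸ a)) (downFrom k) ≈ initial v n
    go zero    j refl = *-identityʳ _
    go (suc k) j e = ≈-trans (≈-sym (*-assoc _ _ _)) (≈-trans (*-congʳ (*-congˡ (reflexive (cong v gap))))
      (go k (suc j) (trans (ℕₚ.+-suc k j) e)))
      where
      gap : n ∸ k ≡ suc j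
      gap = trans (cong (_∸ k) (trans (sym e) (sym (ℕₚ.+-suc k j)))) (ℕₚ.m+n∸m≡n k (suc j))

  -- Pairs are grouped by their larger index b, for which b - a runs through 1, ..., b.
  Pairs-downFrom : ∀ (v : ℕ → Carrier) n → Pairs (λ b a → v (b ∸ a)) (downFrom n) ≈ range (initial v) 0 n
  Pairs-downFrom v zero    = ≈-refl
  Pairs-downFrom v (suc n) = ≈-trans (*-cong (Prod-downFrom v n) (Pairs-downFrom v n)) (*-comm _ _)

  initial-* : ∀ u v k → initial (λ d → u d * v d) k ≈ initial u k * initial v k
  initial-* u v zero    = ≈-sym (*-identityˡ 1#)
  initial-* u v (suc k) = ≈-trans (*-congʳ (initial-* u v k))
    (solve 4 (λ a b c d → (a :* b) :* (c :* d) := (a :* c) :* (b :* d)) ≈-refl _ _ _ _)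

  module _ (c : ℕ) (w : ℕ → Carrier) where

    paired : ℕ → Carrier
    paired d = w d * w (c ∸ d)

    -- The second product consists of w (c - 1), ..., w (j + 1), exactly what the first j factors
    -- leave out.
    complement : ∀ j i → suc (i ℕ.+ j) ≡ c → initial w j * initial (λ d → w (c ∸ d)) i ≈ initial w (c ∸ 1)
    complement j zero    refl = *-identityʳ _
    complement j (suc i) refl = begin
      initial w j * (initial (λ d → w (c ∸ d)) i * w (suc (i ℕ.+ j) ∸ i))
        ≈⟨ solve 3 (λ a b d → a :* (b :* d) := (a :* d) :* b) ≈-refl _ _ _ ⟩
      (initial w j * w (suc (i ℕ.+ j) ∸ i)) * initial (λ d → w (c ∸ d)) i
        ≈⟨ *-congʳ (*-congˡ (reflexive (cong w (trans (cong (_∸ i) (sym (ℕₚ.+-suc i j))) (ℕₚ.m+n∸m≡n i (suc j)))))) ⟩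
      initial w (suc j) * initial (λ d → w (c ∸ d)) i
        ≈⟨ complement (suc j) i (cong suc (ℕₚ.+-suc i j)) ⟩
      initial w (c ∸ 1) ∎

    -- Both ends are split off at once: the indices m and m + k - 1 add up to c - 1, so `complement`
    -- applies crosswise. A single middle index is its own partner.
    symmetric-range : ∀ k m → m ℕ.+ m ℕ.+ k ≡ c → range (initial paired) m k ≈ pow (initial w (c ∸ 1)) k
    symmetric-range zero          m e = ≈-refl
    symmetric-range (suc zero)    m e = ≈-trans (*-identityˡ _) (≈-trans (reflexive (cong (initial paired) (ℕₚ.+-identityʳ m)))
      (≈-trans (initial-* _ _ m) (≈-trans (complement m m (trans (ℕₚ.+-comm 1 _) e)) (≈-sym (*-identityʳ _)))))
    symmetric-range (suc (suc k)) m e = begin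
      range (initial paired) m (suc k) * initial paired (m ℕ.+ suc k)
        ≈⟨ *-cong (range-head (initial paired) m k) (initial-* _ _ (m ℕ.+ suc k)) ⟩
      (initial paired m * range (initial paired) (suc m) k) * (initial w (m ℕ.+ suc k) * initial (λ d → w (c ∸ d)) (m ℕ.+ suc k))
        ≈⟨ *-congʳ (*-cong (initial-* _ _ m) (symmetric-range k (suc m) (trans (lemma₁ m k) e))) ⟩
      ((initial w m * initial (λ d → w (c ∸ d)) m) * pow F k) * (initial w (m ℕ.+ suc k) * initial (λ d → w (c ∸ d)) (m ℕ.+ suc k))
        ≈⟨ solve 5 (λ a b p x y → ((a :* b) :* p) :* (x :* y) := (a :* y) :* ((x :* b) :* p)) ≈-refl _ _ _ _ _ ⟩
      (initial w m * initial (λ d → w (c ∸ d)) (m ℕ.+ suc k)) * ((initial w (m ℕ.+ suc k) * initial (λ d → w (c ∸ d)) m) * pow F k)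
        ≈⟨ *-cong (complement m (m ℕ.+ suc k) (trans (lemma₂ m k) e))
             (*-congʳ (complement (m ℕ.+ suc k) m (trans (lemma₃ m k) e))) ⟩
      F * (F * pow F k) ∎
      where
      F = initial w (c ∸ 1)
      lemma₁ : ∀ m k → suc m ℕ.+ suc m ℕ.+ k ≡ m ℕ.+ m ℕ.+ suc (suc k)
      lemma₁ = solve-∀
      lemma₂ : ∀ m k → suc (m ℕ.+ suc k ℕ.+ m) ≡ m ℕ.+ m ℕ.+ suc (suc k)
      lemma₂ = solve-∀
      lemma₃ : ∀ m k → suc (m ℕ.+ (m ℕ.+ suc k)) ≡ m ℕ.+ m ℕ.+ suc (suc k)
      lemma₃ = solve-∀

    Pairs-paired : ∀ m k → m ℕ.+ m ℕ.+ k ≡ c →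
      Pairs (λ b a → paired (b ∸ a)) (downFrom (m ℕ.+ k))
        ≈ Pairs (λ b a → paired (b ∸ a)) (downFrom m) * pow (initial w (c ∸ 1)) k
    Pairs-paired m k e = ≈-trans (Pairs-downFrom paired (m ℕ.+ k)) (≈-trans (range-+ (initial paired) m k)
      (*-cong (≈-sym (Pairs-downFrom paired m)) (symmetric-range k m e)))

-- Hall-Littlewood sums at powers of q

module HallLittlewood (Q : QRing) (c : ℕ) (c>0 : 0 < c) where
  open QRing Q
  open Monomials Q
  open Divisibility Q
  open CommutativeRing base renaming (refl to ≈-refl; sym to ≈-sym; trans to ≈-trans)
  open Folds base
  open Antisymmetry base using (pow)
  open Strands Q c c>0
  open IntegerCoefficients base using (module Solver)
  open Solver using (solve; _:+_; _:*_; _:-_; :-_; con; _:=_)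

  -- (q^x - t q^y) / (q^x - q^y) with t = q^c
  φ : ℕ → ℕ → Carrier
  φ x y = 1# + (1# - X c) * ψ x y

  -- The sum over permutations in the definition of the polynomial, before division by v: each
  -- exponent in turn chooses its variable, and an entry x of `L` stands for the variable q^x.
  HL : List ℕ → List ℕ → Carrier
  HL []       L = 1#
  HL (e ∷ es) L = Sel (λ x r → X (e ℕ.* x) * Prod (φ x) r * HL es r) L

  HL-↭ : ∀ es {L L′} → L ↭ L′ → HL es L ≈ HL es L′
  HL-↭ []       p = ≈-refl
  HL-↭ (e ∷ es) p = Sel-↭ _ (λ x q → *-cong (*-congˡ (Prod-↭ (φ x) q)) (HL-↭ es q)) p

  φ-spec : ∀ {x y} → x ≢ y → (X x - X y) * φ x y ≈ X x - X (y ℕ.+ c)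
  φ-spec {x} {y} ne = ≈-trans
    (solve 4 (λ x y c q → (x :- y) :* (con (+ 1) :+ (con (+ 1) :- c) :* q)
      := (x :- y) :+ (con (+ 1) :- c) :* ((x :- y) :* q)) ≈-refl (X x) (X y) (X c) (ψ x y))
    (≈-trans (+-congˡ (*-congˡ (ψ-spec ne)))
      (≈-trans (solve 3 (λ x y c → (x :- y) :+ (con (+ 1) :- c) :* y := x :- y :* c) ≈-refl (X x) (X y) (X c))
        (+-congˡ (-‿cong (≈-sym (X-+ y c))))))

  g-c : (1# - X c) * g c ≈ 1#
  g-c = g-inverse c>0

  n≢n+c : ∀ y → y ℕ.+ c ≢ y
  n≢n+c y e = ℕₚ.<⇒≢ c>0 (ℕₚ.+-cancelˡ-≡ y 0 c (trans (ℕₚ.+-identityʳ y) (sym e)))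

  φ-vanishes : ∀ y → φ (y ℕ.+ c) y ≈ 0#
  φ-vanishes y = cancel (n≢n+c y) (≈-trans (φ-spec (n≢n+c y)) (≈-trans (-‿inverseʳ _) (≈-sym (zeroʳ _))))

  Prod-vanishes : ∀ {f : ℕ → Carrier} {y L} → y ∈ L → f y ≈ 0# → Prod f L ≈ 0#
  Prod-vanishes (here refl) z = ≈-trans (*-congʳ z) (zeroˡ _)
  Prod-vanishes (there m)   z = ≈-trans (*-congˡ (Prod-vanishes m z)) (zeroʳ _)

  module _ where
    open PartialFractions base _≢_ (λ ne e → ne (sym e)) ψ ψ-sum ψ-cocycle (λ _ → X c)

    -- Partial fractions with s = t: choosing the first of k variables yields (1 - t^k)/(1 - t),
    -- whichever variables they are. The product of these is the factor of v for multiplicity k.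
    HL-zero : ∀ k L → length L ≡ k → AllPairs _≢_ L → HL (replicate k 0) L ≈ poch k * pow (g c) k
    HL-zero zero    L e v = ≈-sym (*-identityˡ 1#)
    HL-zero (suc k) L e v = begin
      Sel (λ x r → X 0 * Prod (φ x) r * HL (replicate k 0) r) L
        ≈⟨ Sel-cong L (λ x r p → ≈-trans (*-cong (*-congʳ X-0) (HL-zero k r
             (ℕₚ.suc-injective (trans (sym (↭-length p)) e)) (AllPairs.tail (AllPairs-↭ (λ ne e → ne (sym e)) p v))))
             (≈-trans (solve 4 (λ P h x g → con (+ 1) :* P :* h := P :* h) ≈-refl _ _ 1# 1#)
               (≈-trans (*-congʳ (unit (Prod (φ x) r))) (*-assoc _ _ _)))) ⟩
      Sel (λ x r → g c * (residue x r * (poch k * pow (g c) k))) L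
        ≈⟨ ≈-trans (Sel-*ˡ (g c) _ L) (*-congˡ (≈-trans (Sel-*ʳ _ residue L) (*-congʳ (residues L v)))) ⟩
      g c * ((1# - Prod (λ _ → X c) L) * (poch k * pow (g c) k))
        ≈⟨ *-congˡ (*-congʳ (+-congˡ (-‿cong (power L e)))) ⟩
      g c * ((1# - X (c ℕ.* suc k)) * (poch k * pow (g c) k))
        ≈⟨ solve 4 (λ g x p q → g :* (x :* (p :* q)) := (p :* x) :* (g :* q)) ≈-refl _ _ _ _ ⟩
      poch (suc k) * pow (g c) (suc k) ∎
      where
      open Relation.Binary.Reasoning.Setoid setoid
      unit : ∀ P → P ≈ g c * ((1# - X c) * P)
      unit P = ≈-sym (≈-trans (solve 3 (λ g x P → g :* (x :* P) := (x :* g) :* P) ≈-refl _ _ P)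
        (≈-trans (*-congʳ g-c) (*-identityˡ P)))
      power : ∀ {k} (L : List ℕ) → length L ≡ k → Prod (λ _ → X c) L ≈ X (c ℕ.* k)
      power []      refl = ≈-sym (≈-trans (X≡ (ℕₚ.*-zeroʳ c)) X-0)
      power (_ ∷ L) refl = ≈-trans (*-congˡ (power L refl)) (≈-trans (≈-sym (X-+ c _)) (X≡ (sym (ℕₚ.*-suc c _))))

  chain : ℕ → ℕ → List ℕ
  chain y zero    = []
  chain y (suc q) = y ∷ chain (y ℕ.+ c) q

  -- The first L elements of each residue class, without those of its strand.
  chains : ℕ → List Strand → List ℕ
  chains L []            = []
  chains L ((z , k) ∷ S) = chain (z ℕ.+ c ℕ.* k) (L ∸ k) ++ chains L S

  chains-↭ : ∀ L {S S′} → S ↭ S′ → chains L S ↭ chains L S′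
  chains-↭ L Perm.refl              = ↭-refl
  chains-↭ L (prep (z , k) p)       = ++⁺ˡ (chain _ (L ∸ k)) (chains-↭ L p)
  chains-↭ L (swap (z , k) (y , l) p) = ↭-trans (shifts (chain _ (L ∸ k)) (chain _ (L ∸ l)))
    (++⁺ˡ (chain _ (L ∸ l)) (++⁺ˡ (chain _ (L ∸ k)) (chains-↭ L p)))
  chains-↭ L (Perm.trans p q)       = ↭-trans (chains-↭ L p) (chains-↭ L q)

  chains-up : ∀ L z k S J → k < L →
    chains L ((z , k) ∷ S) ++ J ≡ (z ℕ.+ c ℕ.* k) ∷ (chains L ((z , suc k) ∷ S) ++ J)
  chains-up L z k S J k<L with L ∸ k | ℕₚ.+-∸-assoc 1 k<L
  ... | _ | refl = cong (λ y → (z ℕ.+ c ℕ.* k) ∷ ((chain y (L ∸ suc k) ++ chains L S) ++ J)) (sym (head-up z k))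

  -- Telescoping: the numerator of φ x y is the denominator of p x (y + c).
  chain-product : ∀ x y q → (∀ i → x ≢ y ℕ.+ c ℕ.* i) →
    Prod (φ x) (chain y q) * p x (y ℕ.+ c ℕ.* q) ≈ p x y
  chain-product x y zero    h = ≈-trans (*-identityˡ _) (reflexive (cong (p x) (lemma y c)))
    where
    lemma : ∀ y c → y ℕ.+ c ℕ.* 0 ≡ y
    lemma = solve-∀
  chain-product x y (suc q) h = ≈-trans (*-assoc _ _ _) (≈-trans (*-congˡ (≈-trans
      (*-congˡ (reflexive (cong (p x) (trans (head-up y q) (lemma y c (c ℕ.* q))))))
      (chain-product x (y ℕ.+ c) q λ i e → h (suc i) (trans e (sym (trans (head-up y i) (lemma y c (c ℕ.* i))))))))
    (p-unique (λ e → h 0 (trans e (sym (lemma₀ y c)))) (≈-trans (≈-sym (*-assoc _ _ _)) (≈-trans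
      (*-congʳ (φ-spec (λ e → h 0 (trans e (sym (lemma₀ y c)))))) (p-spec (λ e → h 1 (trans e (sym (lemma₁ y c)))))))))
    where
    lemma : ∀ y c b → y ℕ.+ b ℕ.+ c ≡ y ℕ.+ c ℕ.+ b
    lemma = solve-∀
    lemma₀ : ∀ y c → y ℕ.+ c ℕ.* 0 ≡ y
    lemma₀ = solve-∀
    lemma₁ : ∀ y c → y ℕ.+ c ℕ.* 1 ≡ y ℕ.+ c
    lemma₁ = solve-∀

  module Approximation (d m : ℕ) (m>0 : 0 < m) where
    open Congruence Q 1# d
    open Weighted m

    ∼-Divisible : ∀ {x} → Divisible d x → x ∼ 0#
    ∼-Divisible {x} p = congruent (Divisible-resp (solve 1 (λ x → x := con (+ 1) :* (x :- con (+ 0))) ≈-refl x) p)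

    p-far : ∀ {x y} → 0 < d → x ℕ.+ d ≤ y → p x y ∼ 1#
    p-far {x} {y} d>0 le = ∼-trans (lift (reflexive (p-< x<y))) (congruent (Divisible-resp
      (≈-trans (solve 2 (λ e g → e :* g := g :- (con (+ 1) :- e) :* g) ≈-refl _ _)
        (≈-trans (+-congˡ (-‿cong (g-inverse (ℕₚ.m<n⇒0<n∸m x<y)))) (≈-sym (*-identityˡ _))))
      (Divisible-*ʳ (g (y ∸ x)) (Divisible-≤ (subst (_≤ y ∸ x) (ℕₚ.m+n∸m≡n x d) (ℕₚ.∸-monoˡ-≤ x le)) (Divisible-X (y ∸ x))))))
      where
      x<y : x < y
      x<y = ℕₚ.<-≤-trans (ℕₚ.m<m+n x d>0) le

    φ-far : ∀ {x y} → 0 < d → x ℕ.+ d ≤ y → φ x y ∼ 1#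
    φ-far d>0 le = ∼-trans (∼-+ ∼-refl (∼-* ∼-refl (∼-+ (p-far d>0 le) ∼-refl)))
      (lift (solve 1 (λ e → con (+ 1) :+ e :* (con (+ 1) :- con (+ 1)) := con (+ 1)) ≈-refl _))

    -- Abstracts `φ-vanishes`, so that the selection lemmas need nothing else about the summand in
    -- order to discard all but the heads.
    Chaining : (ℕ → List ℕ → Carrier) → Set
    Chaining F = ∀ y r → y ∈ r → F (y ℕ.+ c) r ∼ 0#

    -- Once the first entry of the chain is excluded, each later one is excluded because its
    -- predecessor stays behind.
    Sel-tail : ∀ (F : ℕ → List ℕ → Carrier) → Chaining F → ∀ y q K → (∀ r → F y r ∼ 0#) →
      Sel F (chain y q ++ K) ∼ Sel (λ x r → F x (chain y q ++ r)) K
    Sel-tail F v y zero    K z = ∼-refl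
    Sel-tail F v y (suc q) K z = ∼-trans
      (∼-+ (z _) (Sel-tail (λ x r → F x (y ∷ r)) (λ w r w∈ → v w (y ∷ r) (there w∈)) (y ℕ.+ c) q K
        (λ r → v y (y ∷ r) (here refl))))
      (lift (+-identityˡ _))

    Sel-junk : ∀ (F : ℕ → List ℕ → Carrier) J → (∀ x r → x ∈ J → F x r ∼ 0#) → Sel F J ∼ 0#
    Sel-junk F []      z = ∼-refl
    Sel-junk F (x ∷ J) z = ∼-trans
      (∼-+ (z x J (here refl)) (Sel-junk (λ y r → F y (x ∷ r)) J (λ y r m → z y (x ∷ r) (there m))))
      (lift (+-identityˡ _))

    -- Within each chain `Sel-tail` discards everything above the head; the far entries `J` are
    -- negligible by assumption.
    Sel-chains : ∀ (F : ℕ → List ℕ → Carrier) → Chaining F → (∀ x {r r′} → r ↭ r′ → F x r ≈ F x r′) →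
      ∀ L J → (∀ x r → x ∈ J → F x r ∼ 0#) → ∀ S → (∀ {a} → a ∈ S → proj₂ a < L) →
      Sel F (chains L S ++ J) ∼ Sel (λ a r → F (head a) (chains L (up a ∷ r) ++ J)) S
    Sel-chains F v p L J z []            b = Sel-junk F J z
    Sel-chains F v p L J z ((x , k) ∷ S) b = ∼-trans (lift (reflexive (cong (Sel F) (chains-up L x k S J k<L))))
      (∼-+ ∼-refl (∼-trans
        (∼-trans (lift (reflexive (cong (Sel F′) (++-assoc C (chains L S) J))))
          (Sel-tail F′ (λ w r w∈ → v w (h ∷ r) (there w∈)) (x ℕ.+ c ℕ.* suc k) (L ∸ suc k) (chains L S ++ J)
            (λ r → subst (λ y → F y (h ∷ r) ∼ 0#) (sym (head-up x k)) (v h (h ∷ r) (here refl)))))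
        (∼-trans (Sel-chains (λ y r → F y (h ∷ (C ++ r))) (λ w r w∈ → v w _ (there (∈-++⁺ʳ C w∈)))
            (λ y q → p y (prep h (++⁺ˡ C q))) L J (λ y r m → z y _ m) S (λ m → b (there m)))
          (lift (Sel-cong S λ a r _ → p (head a) (reorder a r))))))
      where
      h = x ℕ.+ c ℕ.* k
      C = chain (x ℕ.+ c ℕ.* suc k) (L ∸ suc k)
      F′ = λ y r → F y (h ∷ r)
      k<L = b (here refl)
      reorder : ∀ a r → h ∷ (C ++ (chains L (up a ∷ r) ++ J)) ↭ chains L (up a ∷ (x , k) ∷ r) ++ J
      reorder a r = ↭-trans (Perm.↭-reflexive (cong (h ∷_) (sym (++-assoc C (chains L (up a ∷ r)) J))))
        (↭-trans (Perm.↭-reflexive (sym (chains-up L x k (up a ∷ r) J k<L)))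
          (++⁺ʳ J (chains-↭ L (swap (x , k) (up a) (↭-refl {x = r})))))

    -- By `chain-product` each chain reduces to p at its first entry; the boundary term is 1 modulo
    -- q^d, as the upper end lies at least d above the chosen head. The chain of `a` itself now
    -- starts at head + c, whence the factor 1/(1 - t).
    step-product : 0 < d → ∀ L R J → R ℕ.+ d ≤ L → (∀ {y} → y ∈ J → c ℕ.* R ℕ.+ d ≤ y) →
      ∀ a r → Valid (a ∷ r) → proj₁ a < c → proj₂ a < R → (∀ {b} → b ∈ r → proj₂ b ≤ R) →
      Prod (φ (head a)) (chains L (up a ∷ r) ++ J) ∼ g c * Prod (λ b → p (head a) (head b)) r
    step-product d>0 L R J RL far (z , k) r (v ∷ _) z<c k<R bounded = ∼-trans
      (lift (Prod-++ (φ x) (chains L ((z , suc k) ∷ r)) J)) (∼-trans (∼-* (∼-trans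
        (lift (Prod-++ (φ x) (chain (z ℕ.+ c ℕ.* suc k) (L ∸ suc k)) (chains L r))) (∼-* own (others r v bounded)))
        junk) (lift (*-identityʳ _)))
      where
      x = z ℕ.+ c ℕ.* k
      x≤ : x ℕ.+ d ≤ c ℕ.* R ℕ.+ d
      x≤ = ℕₚ.+-monoˡ-≤ d (ℕₚ.≤-trans (ℕₚ.<⇒≤ (ℕₚ.+-monoˡ-< (c ℕ.* k) z<c))
        (ℕₚ.≤-trans (ℕₚ.≤-reflexive (sym (ℕₚ.*-suc c k))) (ℕₚ.*-monoʳ-≤ c k<R)))
      x≤top : ∀ w l → l ≤ L → x ℕ.+ d ≤ w ℕ.+ c ℕ.* l ℕ.+ c ℕ.* (L ∸ l)
      x≤top w l l≤L = ℕₚ.≤-trans x≤ (ℕₚ.≤-trans (ℕₚ.+-monoʳ-≤ (c ℕ.* R) (ℕₚ.m≤n*m d c ⦃ ℕ.>-nonZero c>0 ⦄))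
        (ℕₚ.≤-trans (ℕₚ.≤-reflexive (sym (ℕₚ.*-distribˡ-+ c R d))) (ℕₚ.≤-trans (ℕₚ.*-monoʳ-≤ c RL)
          (ℕₚ.≤-trans (ℕₚ.≤-reflexive (trans (cong (c ℕ.*_) (sym (ℕₚ.m+[n∸m]≡n l≤L))) (ℕₚ.*-distribˡ-+ c l (L ∸ l))))
            (ℕₚ.+-monoˡ-≤ (c ℕ.* (L ∸ l)) (ℕₚ.m≤n+m (c ℕ.* l) w))))))
      R≤L : R ≤ L
      R≤L = ℕₚ.≤-trans (ℕₚ.m≤m+n R d) RL
      chain∼ : ∀ w l → l ≤ L → (∀ i → x ≢ w ℕ.+ c ℕ.* l ℕ.+ c ℕ.* i) →
        Prod (φ x) (chain (w ℕ.+ c ℕ.* l) (L ∸ l)) ∼ p x (w ℕ.+ c ℕ.* l)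
      chain∼ w l l≤L ne = ∼-trans (lift (≈-sym (*-identityʳ _)))
        (∼-trans (∼-* ∼-refl (∼-sym (p-far d>0 (x≤top w l l≤L)))) (lift (chain-product x _ (L ∸ l) ne)))
      x<own : ∀ i → x < z ℕ.+ c ℕ.* suc k ℕ.+ c ℕ.* i
      x<own i = ℕₚ.<-≤-trans (ℕₚ.m<m+n x c>0) (ℕₚ.≤-trans (ℕₚ.≤-reflexive (sym (head-up z k))) (ℕₚ.m≤m+n _ _))
      own : Prod (φ x) (chain (z ℕ.+ c ℕ.* suc k) (L ∸ suc k)) ∼ g c
      own = ∼-trans (chain∼ z (suc k) (ℕₚ.≤-trans k<R R≤L) (λ i → ℕₚ.<⇒≢ (x<own i)))
        (lift (reflexive (trans (cong (p x) (head-up z k)) (trans (p-< (ℕₚ.m<m+n x c>0)) (cong g (ℕₚ.m+n∸m≡n x c))))))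
      shape : ∀ w l i → w ℕ.+ c ℕ.* (l ℕ.+ i) ≡ w ℕ.+ c ℕ.* l ℕ.+ c ℕ.* i
      shape w l i = trans (cong (w ℕ.+_) (ℕₚ.*-distribˡ-+ c l i)) (sym (ℕₚ.+-assoc w _ _))
      others : ∀ r → All (Apartₛ (z , k)) r → (∀ {b} → b ∈ r → proj₂ b ≤ R) →
        Prod (φ x) (chains L r) ∼ Prod (λ b → p x (head b)) r
      others []            []       _ = ∼-refl
      others ((w , l) ∷ r) (v ∷ vs) b = ∼-trans (lift (Prod-++ (φ x) (chain (w ℕ.+ c ℕ.* l) (L ∸ l)) (chains L r)))
        (∼-* (chain∼ w l (ℕₚ.≤-trans (b (here refl)) R≤L) (λ i e → v k (l ℕ.+ i) (trans e (sym (shape w l i)))))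
          (others r vs (λ m → b (there m))))
      junk : Prod (φ x) J ∼ 1#
      junk = ∼-trans (Prod-∼ J λ y y∈ → φ-far d>0 (ℕₚ.≤-trans x≤ (far y∈))) (lift (Prod-1 J))

    -- Each exponent m chooses a head, giving 1/(1 - t) times a step of `H`, and `HL-zero` sums over
    -- the places of the j zeros. `R` bounds the parts after all remaining steps, so that chains of
    -- height `L` stay long enough throughout.
    HL-approximation : 0 < d → ∀ L R J → R ℕ.+ d ≤ L → (∀ {y} → y ∈ J → c ℕ.* R ℕ.+ d ≤ y) →
      ∀ r j S → Valid S → (∀ {a} → a ∈ S → proj₁ a < c) → (∀ {a} → a ∈ S → proj₂ a ℕ.+ r ≤ R) →
      ∀ {K} → K ↭ chains L S ++ J → AllPairs _≢_ K → length K ≡ r ℕ.+ j →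
      HL (replicate r m ++ replicate j 0) K ∼ (poch j * pow (g c) j) * (pow (g c) r * H r S)
    HL-approximation d>0 L R J RL far zero j S v small bounded {K} e u len =
      lift (≈-trans (HL-zero j K len u) (≈-sym (≈-trans (*-congˡ (*-identityˡ 1#)) (*-identityʳ _))))
    HL-approximation d>0 L R J RL far (suc r) j S v small bounded {K} e u len = ∼-trans
      (lift (Sel-↭ F (λ x q → *-cong (*-congˡ (Prod-↭ (φ x) q)) (HL-↭ (replicate r m ++ replicate j 0) q)) e))
      (∼-trans (Sel-chains F
          (λ y K′ y∈ → lift (≈-trans (*-congʳ (≈-trans (*-congˡ (Prod-vanishes y∈ (φ-vanishes y))) (zeroʳ _))) (zeroˡ _)))
          (λ x q → *-cong (*-congˡ (Prod-↭ (φ x) q)) (HL-↭ (replicate r m ++ replicate j 0) q)) L J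
          -- A far variable x costs q^(m x), and m x ≥ x ≥ d because m is positive.
          (λ x K′ x∈ → ∼-Divisible (Divisible-*ʳ _ (Divisible-*ʳ _ (Divisible-≤
            (ℕₚ.≤-trans (ℕₚ.≤-trans (ℕₚ.m≤n+m d (c ℕ.* R)) (far x∈)) (ℕₚ.m≤n*m x m ⦃ ℕ.>-nonZero m>0 ⦄)) (Divisible-X _)))))
          S k<L)
        (∼-trans (Sel-∼ S term) (lift (≈-trans (Sel-*ˡ _ _ S)
          (solve 4 (λ q g gr s → q :* (g :* gr) :* s := q :* ((g :* gr) :* s)) ≈-refl _ (g c) _ _)))))
      where
      F = λ x K′ → X (m ℕ.* x) * Prod (φ x) K′ * HL (replicate r m ++ replicate j 0) K′
      k<R : ∀ {a} → a ∈ S → proj₂ a < R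
      k<R {a} a∈ = ℕₚ.<-≤-trans (ℕₚ.m<m+n (proj₂ a) (s≤s z≤n)) (bounded a∈)
      k<L : ∀ {a} → a ∈ S → proj₂ a < L
      k<L a∈ = ℕₚ.<-≤-trans (k<R a∈) (ℕₚ.≤-trans (ℕₚ.m≤m+n R d) RL)
      term : ∀ a rest → S ↭ a ∷ rest → F (head a) (chains L (up a ∷ rest) ++ J) ∼
        ((poch j * pow (g c) j) * (g c * pow (g c) r)) * (step a rest * H r (up a ∷ rest))
      term a@(z , k) rest p = ∼-trans
        (∼-* (∼-* ∼-refl (step-product d>0 L R J RL far a rest va (small a∈) (k<R a∈)
            (λ b∈ → ℕₚ.<⇒≤ (k<R (∈-resp-↭ (↭-sym p) (there b∈))))))
          (HL-approximation d>0 L R J RL far r j (up a ∷ rest) (raise va)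
            (λ { (here refl) → small a∈ ; (there b∈) → small (∈-resp-↭ (↭-sym p) (there b∈)) })
            (λ { (here refl) → ℕₚ.≤-trans (ℕₚ.≤-reflexive (sym (ℕₚ.+-suc k r))) (bounded a∈)
               ; {b} (there b∈) → ℕₚ.≤-trans (ℕₚ.+-monoʳ-≤ (proj₂ b) (ℕₚ.n≤1+n r)) (bounded (∈-resp-↭ (↭-sym p) (there b∈))) })
            ↭-refl (AllPairs.tail (AllPairs-↭ (λ ne e → ne (sym e)) K↭ u))
            (ℕₚ.suc-injective (trans (sym (↭-length K↭)) len))))
        (lift (solve 6 (λ x g P q gr h → (x :* (g :* P)) :* (q :* (gr :* h))
          := (q :* (g :* gr)) :* ((x :* P) :* h)) ≈-refl _ (g c) _ _ _ _))
        where
        va = AllPairs-↭ Apart-sym p v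
        a∈ : a ∈ S
        a∈ = ∈-resp-↭ (↭-sym p) (here refl)
        raise : ∀ {r} → Valid ((z , k) ∷ r) → Valid ((z , suc k) ∷ r)
        raise (d ∷ ds) = d ∷ ds
        K↭ : K ↭ head a ∷ (chains L (up a ∷ rest) ++ J)
        K↭ = ↭-trans e (↭-trans (++⁺ʳ J (chains-↭ L p)) (Perm.↭-reflexive (chains-up L z k rest J (k<L a∈))))

-- The ring of formal power series

module SeriesConvolution where
  open PowerSeries ℤₚ.+-*-commutativeRing

  sumTo-cong : ∀ n {f h : ℕ → ℤ} → (∀ i → i < n → f i ≡ h i) → sumTo n f ≡ sumTo n h
  sumTo-cong zero    e = refl
  sumTo-cong (suc n) e = cong₂ ℤ._+_ (sumTo-cong n λ i l → e i (ℕₚ.m<n⇒m<1+n l)) (e n ℕₚ.≤-refl)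

  sumTo≡Conv : ∀ r (h : ℕ → ℕ → ℤ) → sumTo (suc r) (λ i → h i (r ∸ i)) ≡ Conv r h
  sumTo≡Conv zero    h = ℤₚ.+-identityˡ _
  sumTo≡Conv (suc r) h = trans (cong₂ ℤ._+_
      (trans (sumTo-cong (suc r) λ { i (s≤s l) → cong (h i) (ℕₚ.+-∸-assoc 1 l) })
        (sumTo≡Conv r (λ i j → h i (suc j))))
      (cong (h (suc r)) (ℕₚ.n∸n≡0 r)))
    (sym (Conv-last r h))

  *ₛ≡⊛ : ∀ f h r → (f *ₛ h) r ≡ (f ⊛ h) r
  *ₛ≡⊛ f h r = sumTo≡Conv r (λ i j → f i ℤ.* h j)

  1ₛ≡one : ∀ r → 1ₛ r ≡ one r
  1ₛ≡one zero    = refl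
  1ₛ≡one (suc r) = refl

  private module PS = CommutativeRing powerSeries

  *ₛ-assoc : ∀ f h k r → ((f *ₛ h) *ₛ k) r ≡ (f *ₛ (h *ₛ k)) r
  *ₛ-assoc f h k r = trans (*ₛ≡⊛ (f *ₛ h) k r) (trans (⊛-cong (*ₛ≡⊛ f h) (λ _ → refl) r)
    (trans (⊛-assoc f h k r) (sym (trans (*ₛ≡⊛ f (h *ₛ k) r) (⊛-cong {f} (λ _ → refl) (*ₛ≡⊛ h k) r)))))

  *ₛ-comm : ∀ f h r → (f *ₛ h) r ≡ (h *ₛ f) r
  *ₛ-comm f h r = trans (*ₛ≡⊛ f h r) (trans (⊛-comm f h r) (sym (*ₛ≡⊛ h f r)))

  *ₛ-cong : ∀ {f f′ h h′} → (∀ r → f r ≡ f′ r) → (∀ r → h r ≡ h′ r) → ∀ r → (f *ₛ h) r ≡ (f′ *ₛ h′) r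
  *ₛ-cong {f} {f′} {h} {h′} p q r = trans (*ₛ≡⊛ f h r) (trans (⊛-cong p q r) (sym (*ₛ≡⊛ f′ h′ r)))

  *ₛ-identityˡ : ∀ f r → (1ₛ *ₛ f) r ≡ f r
  *ₛ-identityˡ f r = trans (*ₛ≡⊛ 1ₛ f r) (trans (⊛-cong {1ₛ} {one} {f} 1ₛ≡one (λ _ → refl) r) (⊛-identityˡ f r))

  *ₛ-distribˡ : ∀ f h k r → (f *ₛ (h +ₛ k)) r ≡ ((f *ₛ h) +ₛ (f *ₛ k)) r
  *ₛ-distribˡ f h k r = trans (*ₛ≡⊛ f (h +ₛ k) r) (trans (⊛-distribˡ f h k r)
    (sym (cong₂ ℤ._+_ (*ₛ≡⊛ f h r) (*ₛ≡⊛ f k r))))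

  transparentRing : CommutativeRing 0ℓ 0ℓ
  transparentRing = record
    { Carrier = Series ; _≈_ = λ f h → ∀ r → f r ≡ h r
    ; _+_ = _+ₛ_ ; _*_ = _*ₛ_ ; -_ = negₛ ; 0# = 0ₛ ; 1# = 1ₛ
    ; isCommutativeRing = record
      { isRing = record
        { +-isAbelianGroup = PS.+-isAbelianGroup
        ; *-cong = *ₛ-cong
        ; *-assoc = *ₛ-assoc
        ; *-identity = *ₛ-identityˡ , λ f r → trans (*ₛ-comm f 1ₛ r) (*ₛ-identityˡ f r)
        ; distrib = *ₛ-distribˡ , λ f h k r → trans (*ₛ-comm (h +ₛ k) f r)
            (trans (*ₛ-distribˡ f h k r) (cong₂ ℤ._+_ (*ₛ-comm f h r) (*ₛ-comm f k r))) }
      ; *-comm = *ₛ-comm } }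

  mono-+ₗ : ∀ k f d → (mono k ⊛ f) (k ℕ.+ d) ≡ f d
  mono-+ₗ zero    f d = trans (⊛-cong {mono 0} {one} {f} mono-one (λ _ → refl) d) (⊛-identityˡ f d)
    where
    mono-one : ∀ r → mono 0 r ≡ one r
    mono-one zero    = refl
    mono-one (suc r) = refl
  mono-+ₗ (suc k) f d = trans (ℤₚ.+-identityˡ _) (mono-+ₗ k f d)

  mono-<ₗ : ∀ k f d → d < k → (mono k ⊛ f) d ≡ + 0
  mono-<ₗ (suc k) f zero    l       = refl
  mono-<ₗ (suc k) f (suc d) (s≤s l) = trans (ℤₚ.+-identityˡ _) (mono-<ₗ k f d l)

  shift-+ : ∀ k f d → (mono k *ₛ f) (k ℕ.+ d) ≡ f d
  shift-+ k f d = trans (*ₛ≡⊛ (mono k) f (k ℕ.+ d)) (mono-+ₗ k f d)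

  shift-< : ∀ k f d → d < k → (mono k *ₛ f) d ≡ + 0
  shift-< k f d l = trans (*ₛ≡⊛ (mono k) f d) (mono-<ₗ k f d l)

  shift-≥ : ∀ k f d → k ≤ d → (mono k *ₛ f) d ≡ f (d ∸ k)
  shift-≥ k f d l = trans (cong (mono k *ₛ f) (sym (ℕₚ.m+[n∸m]≡n l))) (shift-+ k f (d ∸ k))

  ≡ᵇ-+ : ∀ k a b → (k ℕ.+ a ≡ᵇ k ℕ.+ b) ≡ (a ≡ᵇ b)
  ≡ᵇ-+ zero    a b = refl
  ≡ᵇ-+ (suc k) a b = ≡ᵇ-+ k a b

  <⇒≡ᵇ-false : ∀ {d k} → d < k → (d ≡ᵇ k) ≡ false
  <⇒≡ᵇ-false {zero}  {suc k} _       = refl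
  <⇒≡ᵇ-false {suc d} {suc k} (s≤s l) = <⇒≡ᵇ-false l

  mono-+ : ∀ a b r → mono (a ℕ.+ b) r ≡ (mono a *ₛ mono b) r
  mono-+ a b r with a ℕ.≤? r
  ... | yes l = sym (trans (shift-≥ a (mono b) r l) (sym (trans
    (cong (mono (a ℕ.+ b)) (sym (ℕₚ.m+[n∸m]≡n l))) (cong (if_then + 1 else + 0) (≡ᵇ-+ a (r ∸ a) b)))))
  ... | no ¬l = trans (cong (if_then + 1 else + 0) (<⇒≡ᵇ-false (ℕₚ.<-≤-trans (ℕₚ.≰⇒> ¬l) (ℕₚ.m≤m+n a b))))
    (sym (shift-< a (mono b) r (ℕₚ.≰⇒> ¬l)))

  mono-cancel : ∀ a {f h : Series} → (∀ r → (mono a *ₛ f) r ≡ (mono a *ₛ h) r) → ∀ r → f r ≡ h r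
  mono-cancel a {f} {h} e r = trans (sym (shift-+ a f r)) (trans (e (a ℕ.+ r)) (shift-+ a h r))

  -- D divides r exactly when it divides r - D, so the coefficients of the two summands cancel
  -- except at r = 0.
  geom-step : ∀ d r → ((1ₛ -ₛ mono (suc d)) *ₛ geom (suc d)) r ≡ 1ₛ r
  geom-step d r = trans (expand r) (step r)
    where
    open IntegerCoefficients transparentRing using (module Solver)
    open Solver using (solve; _:*_; _:-_; con; _:=_)
    D = suc d
    expand : ∀ r → ((1ₛ -ₛ mono D) *ₛ geom D) r ≡ geom D r ℤ.- (mono D *ₛ geom D) r
    expand = solve 2 (λ x g → (con (+ 1) :- x) :* g := g :- x :* g) (λ _ → refl) (mono D) (geom D)
    yes≡ : ∀ r → D ∣ r → geom D r ≡ + 1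
    yes≡ r p with D ∣? r
    ... | yes _ = refl
    ... | no ¬p = contradiction p ¬p
    no≡ : ∀ r → ¬ D ∣ r → geom D r ≡ + 0
    no≡ r ¬p with D ∣? r
    ... | yes p = contradiction p ¬p
    ... | no _  = refl
    same : ∀ r → D ≤ r → geom D r ≡ geom D (r ∸ D)
    same r l with D ∣? (r ∸ D)
    ... | yes p = yes≡ r (subst (D ∣_) (ℕₚ.m+[n∸m]≡n l) (∣m∣n⇒∣m+n ∣-refl p))
    ... | no ¬p = no≡ r λ p → ¬p (∣m+n∣m⇒∣n (subst (D ∣_) (sym (ℕₚ.m+[n∸m]≡n l)) p) ∣-refl)
    step : ∀ r → geom D r ℤ.- (mono D *ₛ geom D) r ≡ 1ₛ r
    step r with D ℕ.≤? r
    step zero    | no _  = trans (cong₂ ℤ._-_ (yes≡ 0 (D ∣0))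
      (shift-< D (geom D) 0 (s≤s z≤n))) refl
    step (suc r) | no ¬l = trans (cong₂ ℤ._-_ (no≡ (suc r) (λ p → ¬l (∣⇒≤ p)))
      (shift-< D (geom D) (suc r) (ℕₚ.≰⇒> ¬l))) refl
    step zero    | yes ()
    step (suc r) | yes l = trans (cong₂ ℤ._-_ (same (suc r) l) (shift-≥ D (geom D) (suc r) l))
      (ℤₚ.+-inverseʳ (geom D (suc r ∸ D)))

  -- Opaque copies of the operations, so that products can be matched against each other.
  infixl 6 _⊞_
  infixl 7 _⊠_
  abstract
    _⊞_ _⊠_ : Series → Series → Series
    _⊞_ = _+ₛ_
    _⊠_ = _*ₛ_

    ⊟_ : Series → Series
    ⊟_ = negₛ

    +ₛ≡⊞ : ∀ f h → f +ₛ h ≡ f ⊞ h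
    +ₛ≡⊞ f h = refl

    *ₛ≡⊠ : ∀ f h → f *ₛ h ≡ f ⊠ h
    *ₛ≡⊠ f h = refl

    negₛ≡⊟ : ∀ f → negₛ f ≡ ⊟ f
    negₛ≡⊟ f = refl

    -ₛ≡⊟ : ∀ f h → f -ₛ h ≡ f ⊞ ⊟ h
    -ₛ≡⊟ f h = refl

    isCommutativeRing : IsCommutativeRing (λ f h → ∀ r → f r ≡ h r) _⊞_ _⊠_ ⊟_ 0ₛ 1ₛ
    isCommutativeRing = CommutativeRing.isCommutativeRing transparentRing

    mono-⊠ : ∀ a b r → mono (a ℕ.+ b) r ≡ (mono a ⊠ mono b) r
    mono-⊠ = mono-+

    mono-⊠-cancel : ∀ a {f h} → (∀ r → (mono a ⊠ f) r ≡ (mono a ⊠ h) r) → ∀ r → f r ≡ h r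
    mono-⊠-cancel = mono-cancel

    geom-⊠ : ∀ d r → ((1ₛ ⊞ ⊟ mono (suc d)) ⊠ geom (suc d)) r ≡ 1ₛ r
    geom-⊠ = geom-step

  seriesRing : CommutativeRing 0ℓ 0ℓ
  seriesRing = record { isCommutativeRing = isCommutativeRing }

  series : QRing
  series = record
    { base     = seriesRing
    ; X        = mono
    ; X-0      = λ { zero → refl ; (suc r) → refl }
    ; X-+      = mono-⊠
    ; X-cancel = mono-⊠-cancel
    ; g        = geom
    ; g-suc    = geom-⊠
    }

-- Intervals as unions of chains

applyUpTo-+ : {A : Set} (f : ℕ → A) (a b : ℕ) → applyUpTo f (a ℕ.+ b) ≡ applyUpTo f a ++ applyUpTo (λ i → f (a ℕ.+ i)) b
applyUpTo-+ f zero    b = refl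
applyUpTo-+ f (suc a) b = cong (f 0 ∷_) (applyUpTo-+ (λ i → f (suc i)) a b)

applyUpTo-cong : {A : Set} {f h : ℕ → A} → (∀ i → f i ≡ h i) → ∀ b → applyUpTo f b ≡ applyUpTo h b
applyUpTo-cong e zero    = refl
applyUpTo-cong e (suc b) = cong₂ _∷_ (e 0) (applyUpTo-cong (λ i → e (suc i)) b)

applyUpTo-↭ : (f : ℕ → ℕ) (n : ℕ) → applyUpTo f n ↭ map f (downFrom n)
applyUpTo-↭ f n = ↭-trans (↭-sym (↭-reverse (applyUpTo f n)))
  (Perm.↭-reflexive (trans (reverse-applyUpTo f n) (sym (map-downFrom f n))))

module IntervalChains (Q : QRing) (c : ℕ) (c>0 : 0 < c) where
  open HallLittlewood Q c c>0 using (chain; chains)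

  columns : ℕ → ℕ → List ℕ → List ℕ
  columns y L []       = []
  columns y L (z ∷ zs) = chain (y ℕ.+ z) L ++ columns y L zs

  columns-zero : ∀ y zs → columns y 0 zs ≡ []
  columns-zero y []       = refl
  columns-zero y (z ∷ zs) = columns-zero y zs

  columns-suc : ∀ y L zs → columns y (suc L) zs ↭ map (y ℕ.+_) zs ++ columns (y ℕ.+ c) L zs
  columns-suc y L []       = ↭-refl
  columns-suc y L (z ∷ zs) = prep (y ℕ.+ z) (↭-trans
    (++⁺ (Perm.↭-reflexive (cong (λ x → chain x L) (lemma y z c))) (columns-suc y L zs))
    (shifts (chain (y ℕ.+ c ℕ.+ z) L) (map (y ℕ.+_) zs)))
    where
    lemma : ∀ y z c → y ℕ.+ z ℕ.+ c ≡ y ℕ.+ c ℕ.+ z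
    lemma = solve-∀

  interval-columns : ∀ L y → applyUpTo (y ℕ.+_) (L ℕ.* c) ↭ columns y L (downFrom c)
  interval-columns zero    y = Perm.↭-reflexive (sym (columns-zero y (downFrom c)))
  interval-columns (suc L) y = ↭-trans (Perm.↭-reflexive (applyUpTo-+ (y ℕ.+_) c (L ℕ.* c)))
    (↭-trans (++⁺ (applyUpTo-↭ (y ℕ.+_) c) (↭-trans
      (Perm.↭-reflexive (applyUpTo-cong (λ i → sym (ℕₚ.+-assoc y c i)) (L ℕ.* c))) (interval-columns L (y ℕ.+ c))))
      (↭-sym (columns-suc y L (downFrom c))))

  chains-columns : ∀ L zs → chains L (map (_, 0) zs) ≡ columns 0 L zs
  chains-columns L []       = refl
  chains-columns L (z ∷ zs) = cong₂ _++_ (cong (λ y → chain y L) (trans (cong (z ℕ.+_) (ℕₚ.*-zeroʳ c)) (ℕₚ.+-identityʳ z)))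
    (chains-columns L zs)

  -- The exponents of finitely many variables fill L complete rows modulo c; the ρ remaining ones
  -- form the far list.
  interval-chains : ∀ L ρ → upTo (L ℕ.* c ℕ.+ ρ) ↭ chains L (map (_, 0) (downFrom c)) ++ applyUpTo (L ℕ.* c ℕ.+_) ρ
  interval-chains L ρ = ↭-trans (Perm.↭-reflexive (applyUpTo-+ (λ i → i) (L ℕ.* c) ρ))
    (++⁺ʳ _ (↭-trans (interval-columns L 0) (Perm.↭-reflexive (sym (chains-columns L (downFrom c))))))

-- The limit over the number of variables

module HallLittlewoodLimit (Q : QRing) (m n : ℕ) (m>0 : 0 < m) (n>0 : 0 < n) where
  open QRing Q
  open CommutativeRing base renaming (refl to ≈-refl; sym to ≈-sym; trans to ≈-trans)
  open Antisymmetry base using (pow; pow-inverse)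
  open HallLittlewood Q n n>0
  open Strands Q n n>0
  open Limit Q m n n>0 using (P)
  open IntegerCoefficients base using (module Solver)
  open Solver using (solve; _:*_; _:=_)

  -- ∏_{j ≤ k} (1 - t) / (1 - t^j) with t = q^n
  inverseV : ℕ → Carrier
  inverseV k = pow (1# - X n) k * diagonal k

  inverseV-poch : ∀ k → inverseV k * (poch k * pow (g n) k) ≈ 1#
  inverseV-poch k = ≈-trans (solve 4 (λ a d p b → (a :* d) :* (p :* b) := (a :* b) :* (p :* d)) ≈-refl _ _ _ _)
    (≈-trans (*-cong (pow-inverse g-c k) (poch-diagonal k)) (*-identityˡ 1#))

  module _ (d : ℕ) (d>0 : 0 < d) where
    open Congruence Q 1# d
    open Approximation d m m>0
    open Weighted m

    -- By `path-sum`, the path sum left by `HL-approximation` is (t; t)_r `P r`; the two factors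
    -- `inverseV` cancel this (t; t)_r and the remaining normalisations. Since no part exceeds r, L
    -- = r + d complete rows suffice.
    HL-limit : ∀ r j → (r ℕ.+ d) ℕ.* n ≤ r ℕ.+ j →
      (inverseV r * inverseV j) * HL (replicate r m ++ replicate j 0) (upTo (r ℕ.+ j)) ∼ P r
    HL-limit r j le = ∼-trans
      (∼-* ∼-refl (HL-approximation d>0 (r ℕ.+ d) r (applyUpTo (L ℕ.* n ℕ.+_) ρ) ℕₚ.≤-refl far r j S₀
        valid small bounded (↭-trans (Perm.↭-reflexive (cong upTo N≡)) (IntervalChains.interval-chains Q n n>0 L ρ))
        (upTo⁺ (r ℕ.+ j)) (length-upTo (r ℕ.+ j))))
      (lift (≈-trans (*-congˡ (*-congˡ (*-congˡ (≈-sym (path-sum (downFrom n) apart r)))))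
        (≈-trans (solve 7 (λ a b p q g φ G → (a :* b) :* ((p :* q) :* (g :* (φ :* G))) := (b :* (p :* q)) :* ((a :* (φ :* g)) :* G))
            ≈-refl (inverseV r) (inverseV j) _ _ _ _ (P r))
          (≈-trans (*-cong (inverseV-poch j) (≈-trans (*-congʳ (inverseV-poch r)) (*-identityˡ _))) (*-identityˡ _)))))
      where
      L = r ℕ.+ d
      ρ = (r ℕ.+ j) ∸ L ℕ.* n
      S₀ = map (_, 0) (downFrom n)
      N≡ : r ℕ.+ j ≡ L ℕ.* n ℕ.+ ρ
      N≡ = sym (ℕₚ.m+[n∸m]≡n le)
      apart : AllPairs Apart (downFrom n)
      apart = downFrom-apart n n ℕₚ.≤-refl
      valid : Valid S₀
      valid = valid-strands S₀ (residues-zeros (downFrom n)) apart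
      small : ∀ {a} → a ∈ S₀ → proj₁ a < n
      small a∈ = ∈-downFrom⁻ (subst (_ ∈_) (residues-zeros (downFrom n)) (∈-map⁺ proj₁ a∈))
      zero-parts : ∀ zs {a : Strand} → a ∈ map (_, 0) zs → proj₂ a ≡ 0
      zero-parts (z ∷ zs) (here refl) = refl
      zero-parts (z ∷ zs) (there m)   = zero-parts zs m
      bounded : ∀ {a} → a ∈ S₀ → proj₂ a ℕ.+ r ≤ r
      bounded a∈ = ℕₚ.≤-reflexive (cong (ℕ._+ r) (zero-parts (downFrom n) a∈))
      far : ∀ {y} → y ∈ applyUpTo (L ℕ.* n ℕ.+_) ρ → n ℕ.* r ℕ.+ d ≤ y
      far y∈ with ∈-applyUpTo⁻ (L ℕ.* n ℕ.+_) y∈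
      ... | i , _ , refl = ℕₚ.≤-trans (ℕₚ.+-monoʳ-≤ (n ℕ.* r) (ℕₚ.m≤n*m d n ⦃ ℕ.>-nonZero n>0 ⦄))
        (ℕₚ.≤-trans (ℕₚ.≤-reflexive (lemma n r d)) (ℕₚ.m≤m+n _ i))
        where
        lemma : ∀ n r d → n ℕ.* r ℕ.+ n ℕ.* d ≡ (r ℕ.+ d) ℕ.* n
        lemma = solve-∀

-- Infinite products and the symmetry of the right-hand side

module FinitePochhammer (Q : QRing) where
  open QRing Q
  open Monomials Q
  open CommutativeRing base renaming (refl to ≈-refl; sym to ≈-sym; trans to ≈-trans)
  open Reflection base

  finite : (c : ℕ) → 0 < c → ℕ → ℕ → Carrier
  finite c c>0 = Expansion.partialPoch Q c c>0

  one>0 : 0 < 1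
  one>0 = s≤s z≤n

  finite-+ : ∀ a j → finite 1 one>0 1 (j ℕ.+ a) ≈ finite 1 one>0 1 a * initial (λ d → 1# - X (d ℕ.+ a)) j
  finite-+ a zero    = ≈-sym (*-identityʳ _)
  finite-+ a (suc j) = ≈-trans (*-cong (finite-+ a j) (+-congˡ (-‿cong (X≡ (cong suc (ℕₚ.+-identityʳ (j ℕ.+ a)))))))
    (*-assoc _ _ _)

  -- Splitting the factors of (q; q)_{cM} by residue classes modulo c.
  finite-split : ∀ c (c>0 : 0 < c) M → finite 1 one>0 1 (M ℕ.* c) ≈ initial (λ d → finite c c>0 d M) c
  finite-split c c>0 zero    = ≈-sym (ones c)
    where
    ones : ∀ k → initial (λ _ → 1#) k ≈ 1#
    ones zero    = ≈-refl
    ones (suc k) = ≈-trans (*-identityʳ _) (ones k)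
  finite-split c c>0 (suc M) = ≈-trans (finite-+ (M ℕ.* c) c) (≈-trans (*-congʳ (finite-split c c>0 M))
    (≈-trans (*-congˡ (reflexive (cong (λ e → initial (λ d → 1# - X (d ℕ.+ e)) c) (ℕₚ.*-comm M c))))
      (≈-sym (initial-* _ _ c))))

-- w c b stands for (q^b; q^c)_∞, which is characterised by its finite truncations, and I for 1/(q; q)_∞.
module InfiniteProducts (Q : QRing)
  (w : ℕ → ℕ → CommutativeRing.Carrier (QRing.base Q))
  (w-limit : ∀ c (c>0 : 0 < c) d M → d ≤ M → ∀ b → 0 < b →
    Congruence._∼_ Q (CommutativeRing.1# (QRing.base Q)) d (w c b) (FinitePochhammer.finite Q c c>0 b M))
  (separated : ∀ {x y} → (∀ d → Congruence._∼_ Q (CommutativeRing.1# (QRing.base Q)) d x y) →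
    CommutativeRing._≈_ (QRing.base Q) x y)
  (I : CommutativeRing.Carrier (QRing.base Q))
  (I-inverse : CommutativeRing._≈_ (QRing.base Q) (CommutativeRing._*_ (QRing.base Q) I (w 1 1)) (CommutativeRing.1# (QRing.base Q)))
  where
  open QRing Q
  open Divisibility Q
  open CommutativeRing base renaming (refl to ≈-refl; sym to ≈-sym; trans to ≈-trans)
  open Folds base
  open Antisymmetry base using (pow; pow-*; pow-cong; pow-one; pow-inverse; pow-+)
  open Reflection base
  open FinitePochhammer Q
  open IntegerCoefficients base using (module Solver)
  open Solver using (solve; _:*_; _:-_; :-_; _:=_)
  module Mod = Congruence Q 1#

  theta : ℕ → ℕ → Carrier
  theta n c = Pairs (λ b a → paired c (w c) (b ∸ a)) (downFrom n)

  rhs : ℕ → ℕ → Carrier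
  rhs a κ = pow (w κ κ) (a ∸ 1) * pow I a * theta a κ

  initial-∼ : ∀ d {u v : ℕ → Carrier} → (∀ b → 0 < b → Mod._∼_ d (u b) (v b)) → ∀ k → Mod._∼_ d (initial u k) (initial v k)
  initial-∼ d h zero    = Mod.∼-refl d
  initial-∼ d h (suc k) = Mod.∼-* d (initial-∼ d h k) (h (suc k) (s≤s z≤n))

  -- The limit of `finite-split`: (q; q)_∞ is truncated after d c factors, so that d of them fall
  -- into each class.
  euler : ∀ c → 0 < c → w 1 1 ≈ initial (w c) c
  euler c c>0 = separated λ d → Mod.∼-trans d
    (w-limit 1 one>0 d (d ℕ.* c) (ℕₚ.m≤m*n d c ⦃ ℕ.>-nonZero c>0 ⦄) 1 one>0)
    (Mod.∼-trans d (Mod.lift d (finite-split c c>0 d))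
      (initial-∼ d (λ b b>0 → Mod.∼-sym d (w-limit c c>0 d d ℕₚ.≤-refl b b>0)) c))

  euler-pred : ∀ c → 0 < c → w 1 1 ≈ initial (w c) (c ∸ 1) * w c c
  euler-pred (suc c) c>0 = euler (suc c) c>0

  -- The larger side has k further factors (q^κ; q^κ)_∞, k further factors 1/(q; q)_∞ and, by
  -- `Pairs-paired`, k factors `F`; by `euler-pred` each such triple has product 1.
  rhs-symmetric′ : ∀ m k → 0 < m → rhs (m ℕ.+ k) (m ℕ.+ (m ℕ.+ k)) ≈ rhs m (m ℕ.+ (m ℕ.+ k))
  rhs-symmetric′ m@(suc m′) k m>0 = ≈-trans
    (*-cong (*-cong (pow-+ (w κ κ) m′ k) (pow-+ I m k)) (Pairs-paired κ (w κ) m k (ℕₚ.+-assoc m m k)))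
    (≈-trans (solve 6 (λ a b c d t f → (a :* b) :* (c :* d) :* (t :* f) := (a :* c :* t) :* (d :* (f :* b)))
        ≈-refl _ (pow (w κ κ) k) _ (pow I k) _ (pow F k))
      (≈-trans (*-congˡ (≈-trans (*-congˡ (≈-sym (pow-* F (w κ κ) k)))
          (≈-trans (≈-sym (pow-* I _ k)) (≈-trans (pow-cong (≈-trans (*-congˡ (≈-sym (euler-pred κ (s≤s z≤n)))) I-inverse) k)
            (pow-one k)))))
        (*-identityʳ _)))
    where
    κ = m ℕ.+ (m ℕ.+ k)
    F = initial (w κ) (κ ∸ 1)

  rhs-symmetric : ∀ m n → 0 < m → 0 < n → rhs n (m ℕ.+ n) ≈ rhs m (m ℕ.+ n)
  rhs-symmetric m n m>0 n>0 with ℕₚ.≤-total m n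
  ... | inj₁ le with k , refl ← ℕₚ.m≤n⇒∃[o]m+o≡n le = rhs-symmetric′ m k m>0
  ... | inj₂ le with k , refl ← ℕₚ.m≤n⇒∃[o]m+o≡n le =
    ≈-sym (≈-trans (reflexive (cong (rhs (n ℕ.+ k)) (ℕₚ.+-comm (n ℕ.+ k) n)))
      (≈-trans (rhs-symmetric′ n k n>0) (reflexive (cong (rhs n) (ℕₚ.+-comm n (n ℕ.+ k))))))

  Prod-constant : ∀ x n → Prod (λ _ → x) (downFrom n) ≈ pow x n
  Prod-constant x zero    = ≈-refl
  Prod-constant x (suc n) = *-congˡ (Prod-constant x n)

  full-limit : ∀ c (c>0 : 0 < c) μ n → n ≤ c → ∀ d M → d ≤ M →
    Mod._∼_ d (Truncation.full Q c c>0 μ M (downFrom n)) (pow (w c c) n * theta n c)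
  full-limit c c>0 μ n le d M dM = ∼-* (∼-trans
      (Prod-∼ (downFrom n) λ _ _ → ∼-sym (w-limit c c>0 d M dM c c>0)) (lift (Prod-constant (w c c) n)))
    (Pairs-∼ (downFrom n) (downFrom-descending n c le) λ b a _ _ (ab , bc) →
      ∼-* (∼-sym (w-limit c c>0 d (suc M) (ℕₚ.m≤n⇒m≤1+n dM) (b ∸ a) (ℕₚ.m<n⇒0<n∸m ab)))
          (∼-sym (w-limit c c>0 d M dM (c ∸ (b ∸ a)) (ℕₚ.m<n⇒0<n∸m (ℕₚ.≤-<-trans (ℕₚ.m∸n≤m b a) bc)))))
    where open Congruence Q 1# d

  -- The extreme case of the reflection, with modulus n itself, where all factors pair off.
  theta-diagonal : ∀ n → 0 < n → pow (w n n) n * theta n n ≈ pow (w 1 1) n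
  theta-diagonal n n>0 = ≈-trans (*-congˡ (≈-trans (Pairs-paired n (w n) 0 n refl) (*-identityˡ _)))
    (≈-trans (≈-sym (pow-* _ _ n)) (pow-cong (≈-trans (*-comm _ _) (≈-sym (euler-pred n n>0))) n))

  module _ (m n : ℕ) (n>0 : 0 < n) where
    open Limit Q m n n>0
    open Duality Q m n n>0 using (κ>0)

    normalised : ℕ → Carrier
    normalised r = Divisible.quotient (P-divisible r)

    -- Divided by its monomial, `main-congruence` tends to p (q; q)_∞^n (q^κ; q^κ)_∞ = (q^κ;
    -- q^κ)_∞^n times the theta product. The truncation φ of (q^κ; q^κ)_∞ is kept finite until the
    -- end because `δ` is its exact inverse.
    normalised-limit : ∀ d r → d ≤ r → n ℕ.* d ≤ r → Mod._∼_ d (normalised r) (rhs n (m ℕ.+ n))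
    normalised-limit d r dr ndr = ∼-trans (lift start) (∼-trans (∼-* p∼ ∼-refl) finish)
      where
      open Congruence Q 1# d
      κ = m ℕ.+ n
      e = m ℕ.* triangle r
      p₀ = normalised r
      φ = S₂.poch r
      δ = S₂.diagonal r
      f₁ = T₁.full r (downFrom n)
      f₂ = T₂.full r (downFrom n)
      reduced : p₀ * (f₁ * φ) ∼ f₂
      reduced = congruent (Divisible-*ˡ 1# (Divisible-cancel e (Divisible-resp
        (≈-trans (+-congʳ (*-congʳ (Divisible.equality (P-divisible r))))
          (solve 5 (λ x p f φ h → (x :* p) :* (f :* φ) :- x :* h := x :* (p :* (f :* φ) :- h)) ≈-refl (X e) p₀ f₁ φ f₂))
        (main-congruence d r ndr))))
      φ∼ : w κ κ ∼ φ
      φ∼ = ∼-trans (w-limit κ κ>0 d r dr κ κ>0) (lift (≈-sym (T₂.poch-partialPoch r)))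
      p∼ : p₀ * (pow (w 1 1) n * φ) ∼ (pow (w κ κ) n * theta n κ)
      p∼ = ∼-trans (∼-* ∼-refl (∼-* (∼-sym (∼-trans (full-limit n n>0 m n ℕₚ.≤-refl d r dr)
             (lift (theta-diagonal n n>0)))) ∼-refl))
        (∼-trans reduced (full-limit κ κ>0 0 n (ℕₚ.m≤n+m n m) d r dr))
      start : p₀ ≈ p₀ * (pow (w 1 1) n * φ) * (δ * pow I n)
      start = ≈-sym (≈-trans (solve 5 (λ p a φ δ b → p :* (a :* φ) :* (δ :* b) := p :* ((φ :* δ) :* (b :* a))) ≈-refl p₀ _ φ δ _)
        (≈-trans (*-congˡ (≈-trans (*-cong (S₂.poch-diagonal r) (pow-inverse I-inverse n)) (*-identityˡ 1#))) (*-identityʳ p₀)))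
      one-factor : ∀ k → 0 < k → pow (w κ κ) k * δ ∼ pow (w κ κ) (k ∸ 1)
      one-factor (suc k) _ = ∼-trans (∼-* (∼-* φ∼ ∼-refl) ∼-refl) (lift
        (≈-trans (solve 3 (λ φ q δ → φ :* q :* δ := (φ :* δ) :* q) ≈-refl φ _ δ)
          (≈-trans (*-congʳ (S₂.poch-diagonal r)) (*-identityˡ _))))
      finish : (pow (w κ κ) n * theta n κ) * (δ * pow I n) ∼ rhs n κ
      finish = ∼-trans (lift (solve 4 (λ a t δ b → (a :* t) :* (δ :* b) := (a :* δ) :* b :* t) ≈-refl _ _ δ _))
        (∼-* (∼-* (one-factor n n>0) ∼-refl) ∼-refl)

-- Coefficients and products of formal power series

module SeriesProducts where
  open SeriesConvolution
  open QRing series using (g-suc)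
  open Monomials series using (X≡)
  open Divisibility series
  open CommutativeRing seriesRing renaming (refl to ≈-refl; sym to ≈-sym; trans to ≈-trans)
  open Folds seriesRing
  open Antisymmetry seriesRing using (pow)
  open Reflection seriesRing using (paired)
  open FinitePochhammer series using (finite; one>0)
  open IntegerCoefficients seriesRing using (module Solver)
  open Solver using (solve; _:*_; _:-_; :-_; con; _:=_)
  module Mod = Congruence series 1ₛ

  at : ∀ {f h : Series} → f ≡ h → ∀ i → f i ≡ h i
  at e i = cong (λ f → f i) e

  Divisible⇒coefficient : ∀ {d f} → Divisible d f → ∀ i → i < d → f i ≡ + 0
  Divisible⇒coefficient {d} (divisible h e) i l = trans (e i) (trans (at (sym (*ₛ≡⊠ (mono d) h)) i) (shift-< d h i l))

  coefficients⇒Divisible : ∀ d f → (∀ i → i < d → f i ≡ + 0) → Divisible d f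
  coefficients⇒Divisible d f z = divisible (λ k → f (d ℕ.+ k)) equal
    where
    h = λ k → f (d ℕ.+ k)
    equal : ∀ i → f i ≡ (mono d ⊠ h) i
    equal i with d ℕ.≤? i
    ... | yes l = sym (trans (at (sym (*ₛ≡⊠ (mono d) h)) i) (trans (shift-≥ d h i l) (cong f (ℕₚ.m+[n∸m]≡n l))))
    ... | no ¬l = trans (z i (ℕₚ.≰⇒> ¬l)) (sym (trans (at (sym (*ₛ≡⊠ (mono d) h)) i) (shift-< d h i (ℕₚ.≰⇒> ¬l))))

  ∼⇒coefficient : ∀ {d f h} → Mod._∼_ d f h → ∀ i → i < d → f i ≡ h i
  ∼⇒coefficient {d} {f} {h} (Mod.congruent p) i l = ℤₚ.i-j≡0⇒i≡j (f i) (h i)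
    (trans (at (-ₛ≡⊟ f h) i) (Divisible⇒coefficient (Divisible-resp (*-identityˡ (f - h)) p) i l))

  coefficients⇒∼ : ∀ d f h → (∀ i → i < d → f i ≡ h i) → Mod._∼_ d f h
  coefficients⇒∼ d f h e = Mod.congruent (Divisible-resp (≈-sym (*-identityˡ (f - h)))
    (coefficients⇒Divisible d (f - h) λ i l → trans (at (sym (-ₛ≡⊟ f h)) i) (ℤₚ.i≡j⇒i-j≡0 (e i l))))

  separated : ∀ {f h} → (∀ d → Mod._∼_ d f h) → f ≈ h
  separated e i = ∼⇒coefficient (e (suc i)) i ℕₚ.≤-refl

  prodₛ≡Prod : ∀ {A : Set} (F : A → Series) L → prodₛ (map F L) ≡ Prod F L
  prodₛ≡Prod F []      = refl
  prodₛ≡Prod F (x ∷ L) = trans (*ₛ≡⊠ (F x) (prodₛ (map F L))) (cong (F x ⊠_) (prodₛ≡Prod F L))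

  Prod-upTo : ∀ (F : ℕ → Series) M → Prod F (upTo (suc M)) ≈ Prod F (upTo M) * F M
  Prod-upTo F M = ≈-trans (reflexive (cong (Prod F) (sym (upTo-∷ʳ M))))
    (≈-trans (Prod-++ F (upTo M) (M ∷ [])) (*-congˡ (*-identityʳ (F M))))

  NearOne : (ℕ → Series) → Set
  NearOne F = ∀ k → Divisible (suc k) (F k - 1#)

  -- A factor of index M > i is 1 modulo q^(M + 1) and leaves coefficient i unchanged, so that
  -- coefficient is already final in the truncation defining `prodInf`.
  prodInf-limit : ∀ F → NearOne F → ∀ d M → d ≤ M → Mod._∼_ d (prodInf F) (Prod F (upTo M))
  prodInf-limit F near d M dM = coefficients⇒∼ d _ _ λ i l →
    trans (at (prodₛ≡Prod F (upTo (suc i))) i) (sym (stable i M (ℕₚ.<-≤-trans l dM)))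
    where
    grow : ∀ i M → i < M → Mod._∼_ (suc i) (Prod F (upTo (suc M))) (Prod F (upTo M))
    grow i M l = Mod.∼-trans _ (Mod.lift _ (Prod-upTo F M)) (Mod.∼-trans _
      (Mod.∼-* _ (Mod.∼-refl _) (Mod.congruent (Divisible-≤ (ℕₚ.m≤n⇒m≤1+n l) (Divisible-*ˡ 1# (near M)))))
      (Mod.lift _ (*-identityʳ _)))
    stable : ∀ i M → i < M → Prod F (upTo M) i ≡ Prod F (upTo (suc i)) i
    stable i (suc M) (s≤s l) with ℕₚ.m≤n⇒m<n∨m≡n l
    ... | inj₂ refl = refl
    ... | inj₁ i<M  = trans (∼⇒coefficient (grow i M i<M) i ℕₚ.≤-refl) (stable i M i<M)

  w : ℕ → ℕ → Series
  w c b = pochInf b c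

  Prod-finite : ∀ c (c>0 : 0 < c) b M → Prod (λ k → 1ₛ -ₛ mono (b ℕ.+ c ℕ.* k)) (upTo M) ≈ finite c c>0 b M
  Prod-finite c c>0 b zero    = ≈-refl
  Prod-finite c c>0 b (suc M) = ≈-trans (Prod-upTo _ M) (*-cong (Prod-finite c c>0 b M) (reflexive (-ₛ≡⊟ 1ₛ (mono (b ℕ.+ c ℕ.* M)))))

  w-limit : ∀ c (c>0 : 0 < c) d M → d ≤ M → ∀ b → 0 < b → Mod._∼_ d (w c b) (finite c c>0 b M)
  w-limit c c>0 d M dM b b>0 = Mod.∼-trans d
    (prodInf-limit _ (λ k → Divisible-resp (≈-trans (minus (mono (b ℕ.+ c ℕ.* k))) (+-congʳ (reflexive (sym (-ₛ≡⊟ 1ₛ _)))))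
      (Divisible-neg (Divisible-≤ (ℕₚ.+-mono-≤ b>0 (ℕₚ.m≤n*m k c ⦃ ℕ.>-nonZero c>0 ⦄)) (Divisible-X _)))) d M dM)
    (Mod.lift d (Prod-finite c c>0 b M))
    where
    minus : ∀ x → - x ≈ (1# - x) - 1#
    minus = solve 1 (λ x → :- x := (con (+ 1) :- x) :- con (+ 1)) ≈-refl

  geom-near : NearOne (λ k → geom (suc k))
  geom-near k = Divisible-resp (≈-trans (split (mono (suc k)) (geom (suc k))) (+-congˡ (-‿cong (g-suc k))))
    (Divisible-*ʳ (geom (suc k)) (Divisible-X (suc k)))
    where
    split : ∀ x h → x * h ≈ h - (1# - x) * h
    split = solve 2 (λ x h → x :* h := h :- (con (+ 1) :- x) :* h) ≈-refl

  invPochQ-inverse : invPochQ * w 1 1 ≈ 1#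
  invPochQ-inverse = separated λ d → Mod.∼-trans d
    (Mod.∼-* d (prodInf-limit _ geom-near d d ℕₚ.≤-refl) (Mod.∼-trans d (w-limit 1 one>0 d d ℕₚ.≤-refl 1 one>0)
      (Mod.lift d (≈-sym (Prod-finite 1 one>0 1 d)))))
    (Mod.lift d (≈-trans (≈-sym (Prod-* _ _ (upTo d))) (≈-trans (Prod-cong (upTo d) λ k _ →
        ≈-trans (*-comm (geom (suc k)) _) (≈-trans (*-congʳ (≈-trans (reflexive (-ₛ≡⊟ 1ₛ _)) (+-congˡ (-‿cong (X≡ (cong suc (ℕₚ.+-identityʳ k))))))) (g-suc k)))
      (Prod-1 (upTo d)))))

  module Products = InfiniteProducts series w w-limit separated invPochQ invPochQ-inverse

  powₛ≡pow : ∀ f k → powₛ f k ≡ pow f k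
  powₛ≡pow f zero    = refl
  powₛ≡pow f (suc k) = trans (*ₛ≡⊠ f (powₛ f k)) (cong (f ⊠_) (powₛ≡pow f k))

  Prod-concatMap : ∀ {A B : Set} (F : B → Series) (h : A → List B) L →
    Prod F (concatMap h L) ≈ Prod (λ x → Prod F (h x)) L
  Prod-concatMap F h []      = ≈-refl
  Prod-concatMap F h (x ∷ L) = ≈-trans (Prod-++ F (h x) (concatMap h L)) (*-congˡ (Prod-concatMap F h L))

  Prod-map : ∀ {A B : Set} (F : B → Series) (h : A → B) L → Prod F (map h L) ≡ Prod (λ x → F (h x)) L
  Prod-map F h []      = refl
  Prod-map F h (x ∷ L) = cong (F (h x) ⊠_) (Prod-map F h L)

  Prod-if : ∀ {A : Set} (F : A → Series) (b : Bool) x → Prod F (if b then x ∷ [] else []) ≈ (if b then F x else 1#)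
  Prod-if F true  x = *-identityʳ (F x)
  Prod-if F false x = ≈-refl

  module _ (F : ℕ → Series) where

    ordered : ℕ → ℕ → Series
    ordered i j = if i <ᵇ j then F (j ∸ i) else 1#

    ordered-< : ∀ {i j} → i < j → ordered i j ≈ F (j ∸ i)
    ordered-< {i} {j} l = reflexive (cong (λ b → if b then F (j ∸ i) else 1#) (dec-true (i ℕ.<? j) l))

    ordered-≥ : ∀ {i j} → j ≤ i → ordered i j ≈ 1#
    ordered-≥ {i} {j} l = reflexive (cong (λ b → if b then F (j ∸ i) else 1#) (dec-false (i ℕ.<? j) (ℕₚ.≤⇒≯ l)))

    square : List ℕ → List ℕ → Series
    square K L = Prod (λ i → Prod (ordered i) L) K

    square-downFrom : ∀ n → square (downFrom n) (downFrom n) ≈ Pairs (λ b a → F (b ∸ a)) (downFrom n)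
    square-downFrom zero    = ≈-refl
    square-downFrom (suc n) = ≈-trans
      (*-cong (≈-trans (*-congʳ (ordered-≥ {n} {n} ℕₚ.≤-refl)) (≈-trans (*-identityˡ _) (≈-trans
          (Prod-cong (downFrom n) λ j m → ordered-≥ (ℕₚ.<⇒≤ (∈-downFrom⁻ m))) (Prod-1 (downFrom n)))))
        (≈-trans (Prod-* _ _ (downFrom n)) (*-cong (Prod-cong (downFrom n) λ i m → ordered-< (∈-downFrom⁻ m)) (square-downFrom n))))
      (*-identityˡ _)

    square-↭ : ∀ {K L} → K ↭ L → square K K ≈ square L L
    square-↭ {K} {L} e = ≈-trans (Prod-↭ _ e) (Prod-cong L λ i _ → Prod-↭ (ordered i) e)

    Prod-pairsLt : ∀ n → Prod (λ p → F (proj₂ p ∸ proj₁ p)) (pairsLt n) ≈ Pairs (λ b a → F (b ∸ a)) (downFrom n)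
    Prod-pairsLt n = ≈-trans (Prod-concatMap _ _ indices) (≈-trans
      (Prod-cong indices λ i _ → ≈-trans (Prod-concatMap _ _ indices) (≈-trans
        (Prod-cong indices λ j _ → Prod-if (λ p → F (proj₂ p ∸ proj₁ p)) (i <ᵇ j) (i , j))
        (reflexive (Prod-map (ordered i) suc (upTo n)))))
      (≈-trans (reflexive (Prod-map _ suc (upTo n)))
        (≈-trans (square-↭ ((↭-trans (applyUpTo-↭ (λ i → i) n) (Perm.↭-reflexive (map-id (downFrom n))))))
          (square-downFrom n))))
      where indices = map suc (upTo n)

  rhsₛ≈rhs : ∀ a κ → rhsₛ a κ ≈ Products.rhs a κ
  rhsₛ≈rhs a κ = ≈-trans (reflexive (trans (*ₛ≡⊠ _ _) (cong₂ _⊠_ (*ₛ≡⊠ (powₛ (pochInf κ κ) (a ∸ 1)) (powₛ invPochQ a)) refl)))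
    (*-cong (reflexive (cong₂ _⊠_ (powₛ≡pow (pochInf κ κ) (a ∸ 1)) (powₛ≡pow invPochQ a)))
      (≈-trans (reflexive (prodₛ≡Prod _ (pairsLt a))) (≈-trans
        (Prod-cong (pairsLt a) λ p _ → reflexive (*ₛ≡⊠ (w κ (proj₂ p ∸ proj₁ p)) (w κ (κ ∸ (proj₂ p ∸ proj₁ p)))))
        (Prod-pairsLt (paired κ (w κ)) a))))

-- Sums over permutations as iterated selections

module Permutations where
  open SeriesConvolution
  open SeriesProducts
  open CommutativeRing seriesRing hiding (zero) renaming (refl to ≈-refl; sym to ≈-sym; trans to ≈-trans)
  open Folds seriesRing
  open QRing series using (X; X-0; X-+)
  open IntegerCoefficients seriesRing using (module Solver)
  open Solver using (solve; _:+_; _:*_; _:=_)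

  sumₛ≡Sum : ∀ {A : Set} (F : A → Series) L → sumₛ (map F L) ≡ Sum F L
  sumₛ≡Sum F []      = refl
  sumₛ≡Sum F (x ∷ L) = trans (+ₛ≡⊞ (F x) (sumₛ (map F L))) (cong (F x ⊞_) (sumₛ≡Sum F L))

  Sum-++ : ∀ {A : Set} (F : A → Series) K L → Sum F (K ++ L) ≈ Sum F K + Sum F L
  Sum-++ F []      L = ≈-sym (+-identityˡ _)
  Sum-++ F (x ∷ K) L = ≈-trans (+-congˡ (Sum-++ F K L)) (≈-sym (+-assoc _ _ _))

  Sum-concatMap : ∀ {A B : Set} (F : B → Series) (h : A → List B) L →
    Sum F (concatMap h L) ≈ Sum (λ x → Sum F (h x)) L
  Sum-concatMap F h []      = ≈-refl
  Sum-concatMap F h (x ∷ L) = ≈-trans (Sum-++ F (h x) (concatMap h L)) (+-congˡ (Sum-concatMap F h L))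

  Sum-map : ∀ {A B : Set} (F : B → Series) (h : A → B) L → Sum F (map h L) ≡ Sum (λ x → F (h x)) L
  Sum-map F h []      = refl
  Sum-map F h (x ∷ L) = cong (F (h x) ⊞_) (Sum-map F h L)

  Sum-cong-All : ∀ {A : Set} {P : A → Set} {F G : A → Series} L → All P L →
    (∀ x → P x → F x ≈ G x) → Sum F L ≈ Sum G L
  Sum-cong-All []      []       h = ≈-refl
  Sum-cong-All (x ∷ L) (p ∷ ps) h = +-cong (h x p) (Sum-cong-All L ps h)

  Sum-*ˡ : ∀ {A : Set} a (F : A → Series) L → Sum (λ x → a * F x) L ≈ a * Sum F L
  Sum-*ˡ a F []      = ≈-sym (zeroʳ a)
  Sum-*ˡ a F (x ∷ L) = ≈-trans (+-congˡ (Sum-*ˡ a F L)) (≈-sym (distribˡ a _ _))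

  ∏ ∑ : ∀ n → (Fin n → Series) → Series
  ∏ zero    f = 1#
  ∏ (suc n) f = f zero * ∏ n (λ i → f (suc i))
  ∑ zero    f = 0#
  ∑ (suc n) f = f zero + ∑ n (λ i → f (suc i))

  ∏-cong : ∀ n {f h : Fin n → Series} → (∀ i → f i ≈ h i) → ∏ n f ≈ ∏ n h
  ∏-cong zero    e = ≈-refl
  ∏-cong (suc n) e = *-cong (e zero) (∏-cong n λ i → e (suc i))

  ∑-cong : ∀ n {f h : Fin n → Series} → (∀ i → f i ≈ h i) → ∑ n f ≈ ∑ n h
  ∑-cong zero    e = ≈-refl
  ∑-cong (suc n) e = +-cong (e zero) (∑-cong n λ i → e (suc i))

  ∑-zero : ∀ n → ∑ n (λ _ → 0#) ≈ 0#
  ∑-zero zero    = ≈-refl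
  ∑-zero (suc n) = ≈-trans (+-identityˡ _) (∑-zero n)

  ∑-+ : ∀ n f h → ∑ n (λ i → f i + h i) ≈ ∑ n f + ∑ n h
  ∑-+ zero    f h = ≈-sym (+-identityˡ _)
  ∑-+ (suc n) f h = ≈-trans (+-congˡ (∑-+ n _ _))
    (solve 4 (λ a b c d → (a :+ b) :+ (c :+ d) := (a :+ c) :+ (b :+ d)) ≈-refl _ _ _ _)

  Prod-tabulate : ∀ {A : Set} (F : A → Series) n (h : Fin n → A) → Prod F (tabulate h) ≡ ∏ n (λ i → F (h i))
  Prod-tabulate F zero    h = refl
  Prod-tabulate F (suc n) h = cong (F (h zero) ⊠_) (Prod-tabulate F n (λ i → h (suc i)))

  Sum-tabulate : ∀ {A : Set} (F : A → Series) n (h : Fin n → A) → Sum F (tabulate h) ≡ ∑ n (λ i → F (h i))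
  Sum-tabulate F zero    h = refl
  Sum-tabulate F (suc n) h = cong (F (h zero) ⊞_) (Sum-tabulate F n (λ i → h (suc i)))

  Sum-∑ : ∀ {A : Set} n (F : Fin n → A → Series) L → Sum (λ x → ∑ n (λ k → F k x)) L ≈ ∑ n (λ k → Sum (F k) L)
  Sum-∑ n F []      = ≈-sym (∑-zero n)
  Sum-∑ n F (x ∷ L) = ≈-trans (+-congˡ (Sum-∑ n F L)) (≈-sym (∑-+ n _ _))

  ∏-punchIn : ∀ n (f : Fin (suc n) → Series) k → f k * ∏ n (λ j → f (punchIn k j)) ≈ ∏ (suc n) f
  ∏-punchIn n       f zero    = ≈-refl
  ∏-punchIn (suc n) f (suc k) = ≈-trans
    (solve 3 (λ a b c → a :* (b :* c) := b :* (a :* c)) ≈-refl _ _ _)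
    (*-congˡ (∏-punchIn n (λ i → f (suc i)) k))

  Sel-tabulate : ∀ {A : Set} n (F : A → List A → Series) (x : Fin (suc n) → A) →
    Sel F (tabulate x) ≈ ∑ (suc n) (λ k → F (x k) (tabulate (λ j → x (punchIn k j))))
  Sel-tabulate zero    F x = ≈-refl
  Sel-tabulate (suc n) F x = +-congˡ (Sel-tabulate n (λ y ys → F y (x zero ∷ ys)) (λ i → x (suc i)))

  -- Stands in for bijectivity: a permutation of the later positions enters `term-suc` only through
  -- a product over all of them.
  Invariant : ∀ {n} → (Fin n → Fin n) → Set
  Invariant {n} σ = ∀ f → ∏ n (λ i → f (σ i)) ≈ ∏ n f

  perms-invariant : ∀ n → All Invariant (perms n)
  perms-invariant zero    = (λ f → ≈-refl) ∷ []
  perms-invariant (suc n) = concat⁺ (map⁺ (All.map (λ {σ} inv → map⁺ (All.universal (λ k f →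
    ≈-trans (*-congˡ (inv (λ j → f (punchIn k j)))) (∏-punchIn n f k)) (allFin (suc n)))) (perms-invariant n)))

  sumFin-suc : ∀ n f → sumFin (suc n) f ≡ f zero ℕ.+ sumFin n (λ i → f (suc i))
  sumFin-suc n f = cong (λ L → f zero ℕ.+ Data.List.foldr ℕ._+_ 0 L)
    (trans (map-tabulate suc f) (sym (map-tabulate (λ i → i) (λ i → f (suc i)))))

  pairProduct : ∀ n → (Fin n → Fin n → Series) → Series
  pairProduct n h = Prod (λ p → h (proj₁ p) (proj₂ p)) (pairsFin n)

  guarded : ∀ {n} → (Fin n → Fin n → Series) → Fin n → Fin n → Series
  guarded h i j = if toℕ i <ᵇ toℕ j then h i j else 1#

  pairProduct-∏ : ∀ n h → pairProduct n h ≈ ∏ n (λ i → ∏ n (guarded h i))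
  pairProduct-∏ n h = ≈-trans (Prod-concatMap _ _ (allFin n)) (≈-trans
    (Prod-cong (allFin n) λ i _ → ≈-trans (Prod-concatMap _ _ (allFin n)) (≈-trans
      (Prod-cong (allFin n) λ j _ → Prod-if (λ p → h (proj₁ p) (proj₂ p)) (toℕ i <ᵇ toℕ j) (i , j))
      (reflexive (Prod-tabulate (guarded h i) n (λ j → j)))))
    (reflexive (Prod-tabulate (λ i → ∏ n (guarded h i)) n (λ i → i))))

  pairProduct-suc : ∀ n h →
    pairProduct (suc n) h ≈ ∏ n (λ j → h zero (suc j)) * pairProduct n (λ i j → h (suc i) (suc j))
  pairProduct-suc n h = ≈-trans (pairProduct-∏ (suc n) h)
    (*-cong (*-identityˡ _) (≈-trans (∏-cong n λ i → *-identityˡ _) (≈-sym (pairProduct-∏ n (λ i j → h (suc i) (suc j))))))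

  module _ (D : ℕ → ℕ → Series) where

    term : ∀ n → (e x : Fin n → ℕ) → (Fin n → Fin n) → Series
    term n e x w = X (sumFin n (λ k → e k ℕ.* x (w k))) * pairProduct n (λ i j → D (x (w i)) (x (w j)))

    HLD : List ℕ → List ℕ → Series
    HLD []       L = 1#
    HLD (e ∷ es) L = Sel (λ y r → X (e ℕ.* y) * Prod (D y) r * HLD es r) L

    -- Position 0 is paired with all values other than k, in the order given by σ; invariance
    -- removes σ from that product.
    term-suc : ∀ n e x k σ → Invariant σ → term (suc n) e x (insertPerm k σ) ≈
      (X (e zero ℕ.* x k) * ∏ n (λ j → D (x k) (x (punchIn k j))))
        * term n (λ i → e (suc i)) (λ j → x (punchIn k j)) σ
    term-suc n e x k σ inv = ≈-trans (*-cong
        (≈-trans (reflexive (cong X (sumFin-suc n (λ i → e i ℕ.* x (insertPerm k σ i))))) (X-+ (e zero ℕ.* x k) _))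
        (≈-trans (pairProduct-suc n _) (*-congʳ (inv (λ j → D (x k) (x (punchIn k j)))))))
      (solve 4 (λ a b c d → (a :* b) :* (c :* d) := (a :* c) :* (b :* d)) ≈-refl _ _ _ _)

    -- A permutation consists of its value k at the first position and a permutation of the other
    -- values, and summing over k is a selection from the list of variables.
    permutation-sum : ∀ n e x → Sum (term n e x) (perms n) ≈ HLD (tabulate e) (tabulate x)
    permutation-sum zero    e x = ≈-trans (+-identityʳ _) (≈-trans (*-congʳ X-0) (*-identityˡ 1#))
    permutation-sum (suc n) e x = ≈-trans (Sum-concatMap _ _ (perms n)) (≈-trans
      (Sum-cong-All (perms n) (perms-invariant n) λ σ inv → ≈-trans
        (reflexive (trans (Sum-map _ _ (allFin (suc n))) (Sum-tabulate _ (suc n) (λ k → k))))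
        (∑-cong (suc n) λ k → term-suc n e x k σ inv))
      (≈-trans (Sum-∑ (suc n) (λ k σ → a k * rest k σ) (perms n)) (≈-trans
        (∑-cong (suc n) λ k → ≈-trans (Sum-*ˡ (a k) (rest k) (perms n)) (*-cong
          (*-congˡ {X (e zero ℕ.* x k)} (reflexive (sym (Prod-tabulate (D (x k)) n (λ j → x (punchIn k j))))))
          (permutation-sum n (λ i → e (suc i)) (λ j → x (punchIn k j)))))
        (≈-sym (Sel-tabulate n (λ y r → X (e zero ℕ.* y) * Prod (D y) r * HLD (tabulate (λ i → e (suc i))) r) x)))))
      where
      a : Fin (suc n) → Series
      a k = X (e zero ℕ.* x k) * ∏ n (λ j → D (x k) (x (punchIn k j)))
      rest : Fin (suc n) → (Fin n → Fin n) → Series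
      rest k = term n (λ i → e (suc i)) (λ j → x (punchIn k j))

-- Comparison with the definitions in the statement

open import Data.Nat.Combinatorics using (_C_; nCk+nC[k+1]≡[n+1]C[k+1]; nC1≡n)

module Specialisation (m n : ℕ) (m>0 : 0 < m) (n>0 : 0 < n) where
  open SeriesConvolution
  open SeriesProducts
  open Permutations
  open CommutativeRing seriesRing hiding (zero) renaming (refl to ≈-refl; sym to ≈-sym; trans to ≈-trans)
  open Folds seriesRing
  open Antisymmetry seriesRing using (pow)
  open QRing series using (X; g)
  open Monomials series
  open Divisibility series
  open Divisible
  open HallLittlewood series n n>0
  open Strands series n n>0 using (diagonal)
  open HallLittlewoodLimit series m n m>0 n>0 using (inverseV; HL-limit)
  open Limit series m n n>0 using (P; P-divisible)
  open IntegerCoefficients seriesRing using (module Solver)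
  open Solver using (solve; _:*_; _:-_; :-_; _:=_)

  -- An index shift, as in `divBinom`, divides by q^c provided the coefficients it drops vanish.
  shift-quotient : ∀ c f → Divisible c f → X c * (λ k → f (k ℕ.+ c)) ≈ f
  shift-quotient c f p = ≈-trans (*-congˡ {X c} λ k → trans (equality p (k ℕ.+ c))
      (trans (at (sym (*ₛ≡⊠ (mono c) (quotient p))) (k ℕ.+ c))
        (trans (cong (mono c *ₛ quotient p) (ℕₚ.+-comm k c)) (shift-+ c (quotient p) k))))
    (≈-sym (equality p))

  ∣-∣-< : ∀ {a b} → a < b → ℕ.∣ a - b ∣ ≡ b ∸ a
  ∣-∣-< l = ℕₚ.m≤n⇒∣m-n∣≡n∸m (ℕₚ.<⇒≤ l)

  divBinom-< : ∀ a b f → a < b → Divisible a f → (X a - X b) * divBinom a b f ≈ f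
  divBinom-< a b f l p = ≈-trans (*-cong (difference-< l) (reflexive unfold))
    (≈-trans (solve 4 (λ x e f g → (x :* e) :* (f :* g) := (x :* f) :* (e :* g)) ≈-refl (X a) _ f↓ _)
      (≈-trans (*-cong (shift-quotient a f p) (g-inverse (ℕₚ.m<n⇒0<n∸m l))) (*-identityʳ f)))
    where
    f↓ : Series
    f↓ k = f (k ℕ.+ a)
    unfold : divBinom a b f ≡ f↓ ⊠ geom (b ∸ a)
    unfold = trans (cong (λ t → if t then (λ k → f (k ℕ.+ (a ⊓ b))) *ₛ geom ℕ.∣ a - b ∣
                          else negₛ ((λ k → f (k ℕ.+ (a ⊓ b))) *ₛ geom ℕ.∣ a - b ∣)) (dec-true (a ℕ.<? b) l))
      (trans (cong₂ (λ c d → (λ k → f (k ℕ.+ c)) *ₛ geom d) (ℕₚ.m≤n⇒m⊓n≡m (ℕₚ.<⇒≤ l)) (∣-∣-< l))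
        (*ₛ≡⊠ f↓ (geom (b ∸ a))))

  divBinom-> : ∀ a b f → b < a → Divisible b f → (X a - X b) * divBinom a b f ≈ f
  divBinom-> a b f l p = ≈-trans (*-cong flipped (reflexive unfold))
    (≈-trans (solve 4 (λ x e f g → (:- (x :* e)) :* (:- (f :* g)) := (x :* f) :* (e :* g)) ≈-refl (X b) _ f↓ _)
      (≈-trans (*-cong (shift-quotient b f p) (g-inverse (ℕₚ.m<n⇒0<n∸m l))) (*-identityʳ f)))
    where
    f↓ : Series
    f↓ k = f (k ℕ.+ b)
    flipped : X a - X b ≈ - (X b * (1# - X (a ∸ b)))
    flipped = ≈-trans (solve 2 (λ x y → x :- y := :- (y :- x)) ≈-refl (X a) (X b)) (-‿cong (difference-< l))
    unfold : divBinom a b f ≡ ⊟ (f↓ ⊠ geom (a ∸ b))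
    unfold = trans (cong (λ t → if t then (λ k → f (k ℕ.+ (a ⊓ b))) *ₛ geom ℕ.∣ a - b ∣
                          else negₛ ((λ k → f (k ℕ.+ (a ⊓ b))) *ₛ geom ℕ.∣ a - b ∣)) (dec-false (a ℕ.<? b) (ℕₚ.<⇒≯ l)))
      (trans (cong₂ (λ c d → negₛ ((λ k → f (k ℕ.+ c)) *ₛ geom d)) (ℕₚ.m≥n⇒m⊓n≡n (ℕₚ.<⇒≤ l))
          (trans (ℕₚ.∣-∣-comm a b) (∣-∣-< l)))
        (trans (negₛ≡⊟ _) (cong ⊟_ (*ₛ≡⊠ f↓ (geom (a ∸ b))))))

  ratio : ℕ → ℕ → Series
  ratio a b = divBinom a b (mono a -ₛ mono (b ℕ.+ n))

  -- The numerator q^a - q^(b + n) is divisible by q^min(a, b), so `divBinom` is a true quotient,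
  -- and quotients by q^a - q^b are unique.
  ratio≈φ : ∀ {a b} → a ≢ b → ratio a b ≈ φ a b
  ratio≈φ {a} {b} ne = cancel ne (≈-trans spec (≈-sym (φ-spec ne)))
    where
    numerator : mono a -ₛ mono (b ℕ.+ n) ≈ X a - X (b ℕ.+ n)
    numerator = reflexive (-ₛ≡⊟ (mono a) (mono (b ℕ.+ n)))
    numerator-divisible : ∀ c → c ≤ a → c ≤ b ℕ.+ n → Divisible c (mono a -ₛ mono (b ℕ.+ n))
    numerator-divisible c l l′ = Divisible-resp (≈-sym numerator)
      (Divisible-+ (Divisible-≤ l (Divisible-X a)) (Divisible-neg (Divisible-≤ l′ (Divisible-X (b ℕ.+ n)))))
    spec : (X a - X b) * ratio a b ≈ X a - X (b ℕ.+ n)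
    spec with ℕₚ.<-cmp a b
    ... | tri< l _ _ = ≈-trans (divBinom-< a b _ l (numerator-divisible a ℕₚ.≤-refl (ℕₚ.≤-trans (ℕₚ.<⇒≤ l) (ℕₚ.m≤m+n b n)))) numerator
    ... | tri≈ _ e _ = contradiction e ne
    ... | tri> _ _ l = ≈-trans (divBinom-> a b _ l (numerator-divisible b (ℕₚ.<⇒≤ l) (ℕₚ.m≤m+n b n))) numerator

  HLD≈HL : ∀ es L → AllPairs _≢_ L → HLD ratio es L ≈ HL es L
  HLD≈HL []       L v = ≈-refl
  HLD≈HL (e ∷ es) L v = Sel-cong L λ x r p → step x r (AllPairs-↭ (λ ne q → ne (sym q)) p v)
    where
    step : ∀ x r → AllPairs _≢_ (x ∷ r) → X (e ℕ.* x) * Prod (ratio x) r * HLD ratio es r ≈ X (e ℕ.* x) * Prod (φ x) r * HL es r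
    step x r (d ∷ v) = *-cong (*-congˡ {X (e ℕ.* x)} (Prod-cong-All r d λ y _ → ratio≈φ)) (HLD≈HL es r v)

  parts-tabulate : ∀ r j → tabulate {n = r ℕ.+ j} (λ k → part (replicate r m) (toℕ k)) ≡ replicate r m ++ replicate j 0
  parts-tabulate zero    zero    = refl
  parts-tabulate zero    (suc j) = cong (0 ∷_) (parts-tabulate zero j)
  parts-tabulate (suc r) j       = cong (m ∷_) (parts-tabulate r j)

  positions-tabulate : ∀ (f : ℕ → ℕ) N → tabulate {n = N} (λ i → f (toℕ i)) ≡ applyUpTo f N
  positions-tabulate f zero    = refl
  positions-tabulate f (suc N) = cong (f 0 ∷_) (positions-tabulate (λ i → f (suc i)) N)

  mult-rect : ∀ r j i → mult (rect m r) (r ℕ.+ j) i ≡ (if m ≡ᵇ i then r else 0) ℕ.+ (if 0 ≡ᵇ i then j else 0)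
  mult-rect zero    zero    i with m ≡ᵇ i | 0 ≡ᵇ i
  ... | true  | true  = refl
  ... | true  | false = refl
  ... | false | true  = refl
  ... | false | false = refl
  mult-rect zero    (suc j) i = trans (sumFin-suc j (λ k → if 0 ≡ᵇ i then 1 else 0))
    (trans (cong ((if 0 ≡ᵇ i then 1 else 0) ℕ.+_) (mult-rect zero j i)) (count (m ≡ᵇ i) (0 ≡ᵇ i)))
    where
    count : ∀ a b → (if b then 1 else 0) ℕ.+ ((if a then 0 else 0) ℕ.+ (if b then j else 0)) ≡ (if a then 0 else 0) ℕ.+ (if b then suc j else 0)
    count true  true  = refl
    count true  false = refl
    count false true  = refl
    count false false = refl
  mult-rect (suc r) j       i = trans (sumFin-suc (r ℕ.+ j) (λ k → if part (m ∷ rect m r) (toℕ k) ≡ᵇ i then 1 else 0))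
    (trans (cong ((if m ≡ᵇ i then 1 else 0) ℕ.+_) (mult-rect r j i)) (count (m ≡ᵇ i)))
    where
    count : ∀ a → (if a then 1 else 0) ℕ.+ ((if a then r else 0) ℕ.+ (if 0 ≡ᵇ i then j else 0)) ≡ (if a then suc r else 0) ℕ.+ (if 0 ≡ᵇ i then j else 0)
    count true  = refl
    count false = refl

  block : ℕ → Series
  block k = prodₛ (map (λ j → (1ₛ -ₛ mono n) *ₛ geom (n ℕ.* suc j)) (upTo k))

  block≈ : ∀ k → block k ≈ inverseV k
  block≈ k = ≈-trans (reflexive (prodₛ≡Prod _ (upTo k))) (go k)
    where
    F : ℕ → Series
    F j = (1ₛ -ₛ mono n) *ₛ geom (n ℕ.* suc j)
    go : ∀ k → Prod F (upTo k) ≈ inverseV k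
    go zero    = ≈-sym (*-identityˡ 1#)
    go (suc k) = ≈-trans (Prod-upTo F k) (≈-trans
      (*-cong (go k) (reflexive (trans (*ₛ≡⊠ _ _) (cong (_⊠ geom (n ℕ.* suc k)) (-ₛ≡⊟ 1ₛ (mono n))))))
      (solve 4 (λ p d e g → (p :* d) :* (e :* g) := (e :* p) :* (d :* g)) ≈-refl (pow (1# - X n) k) (diagonal k) (1# - X n) (g (n ℕ.* suc k))))

  prodₛ-concatMap : ∀ {A : Set} (h : A → List Series) L → prodₛ (concatMap h L) ≈ Prod (λ x → prodₛ (h x)) L
  prodₛ-concatMap h []      = ≈-refl
  prodₛ-concatMap h (x ∷ L) = ≈-trans (append (h x) (concatMap h L)) (*-congˡ {prodₛ (h x)} (prodₛ-concatMap h L))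
    where
    append : ∀ K L → prodₛ (K ++ L) ≈ prodₛ K * prodₛ L
    append []      L = ≈-sym (*-identityˡ (prodₛ L))
    append (f ∷ K) L = ≈-trans (reflexive (*ₛ≡⊠ f (prodₛ (K ++ L)))) (≈-trans (*-congˡ {f} (append K L))
      (≈-trans (≈-sym (*-assoc f (prodₛ K) (prodₛ L))) (*-congʳ (reflexive (sym (*ₛ≡⊠ f (prodₛ K)))))))

  largest : ∀ r → foldr _⊔_ 0 (rect m (suc r)) ≡ m
  largest zero    = ℕₚ.⊔-identityʳ m
  largest (suc r) = trans (cong (m ⊔_) (largest r)) (ℕₚ.⊔-idem m)

  <⇒≡ᵇ : ∀ {i k} → i < k → (k ≡ᵇ i) ≡ false
  <⇒≡ᵇ {zero}  {suc k} _       = refl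
  <⇒≡ᵇ {suc i} {suc k} (s≤s l) = <⇒≡ᵇ l

  ≡ᵇ-refl : ∀ k → (k ≡ᵇ k) ≡ true
  ≡ᵇ-refl zero    = refl
  ≡ᵇ-refl (suc k) = ≡ᵇ-refl k

  invV≈ : ∀ r j → invV (rect m r) (r ℕ.+ j) n ≈ inverseV r * inverseV j
  invV≈ r j = ≈-trans (prodₛ-concatMap factors values)
    (≈-trans (Prod-cong values λ i _ → block≈ (mult (rect m r) (r ℕ.+ j) i)) (cases r m m>0 refl))
    where
    values = upTo (suc (foldr _⊔_ 0 (rect m r)))
    factors : ℕ → List Series
    factors i = map (λ k → (1ₛ -ₛ mono n) *ₛ geom (n ℕ.* suc k)) (upTo (mult (rect m r) (r ℕ.+ j) i))
    G : ℕ → ℕ → Series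
    G r i = inverseV (mult (rect m r) (r ℕ.+ j) i)
    at-zero : ∀ r → G r 0 ≈ inverseV j
    at-zero r = reflexive (cong inverseV (trans (mult-rect r j 0)
      (cong (λ b → (if b then r else 0) ℕ.+ j) (<⇒≡ᵇ m>0))))
    cases : ∀ r k → 0 < k → k ≡ m → Prod (G r) (upTo (suc (foldr _⊔_ 0 (rect m r)))) ≈ inverseV r * inverseV j
    -- For r = 0 the largest part is 0, so the product over values has only the factor for the
    -- zeros.
    cases zero    k        _ e = ≈-trans (*-identityʳ _) (≈-trans (at-zero 0)
      (≈-sym (≈-trans (*-congʳ (*-identityˡ 1#)) (*-identityˡ _))))
    cases (suc r) (suc k)  _ e = ≈-trans
      (reflexive (cong (λ M → Prod (G (suc r)) (upTo (suc M))) (trans (largest r) (sym e))))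
      (≈-trans (Prod-upTo (G (suc r)) (suc k)) (≈-trans (*-comm _ _) (*-cong top
        (≈-trans (*-cong (at-zero (suc r)) (≈-trans (Prod-cong (applyUpTo suc k) middle) (Prod-1 (applyUpTo suc k)))) (*-identityʳ _)))))
      where
      top : G (suc r) (suc k) ≈ inverseV (suc r)
      top = reflexive (cong inverseV (trans (mult-rect (suc r) j (suc k)) (trans (ℕₚ.+-identityʳ _)
        (cong (λ b → if b then suc r else 0) (trans (cong (_≡ᵇ suc k) (sym e)) (≡ᵇ-refl k))))))
      middle : ∀ i → i ∈ applyUpTo suc k → G (suc r) i ≈ 1#
      middle i i∈ with ∈-applyUpTo⁻ suc i∈
      ... | i′ , l , refl = ≈-trans (reflexive (cong inverseV (trans (mult-rect (suc r) j (suc i′)) (trans (ℕₚ.+-identityʳ _)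
        (cong (λ b → if b then suc r else 0) (trans (cong (_≡ᵇ suc i′) (sym e)) (<⇒≡ᵇ l))))))) (*-identityˡ 1#)

  HLspec≈ : ∀ r j → HLspec (rect m r) (r ℕ.+ j) n ≈
    (inverseV r * inverseV j) * HL (replicate r m ++ replicate j 0) (upTo (r ℕ.+ j))
  HLspec≈ r j = ≈-trans (reflexive (trans
      (cong (λ b → if b then invV (rect m r) N n *ₛ sumₛ (map (hlTerm (rect m r) N n) (perms N)) else 0ₛ)
        (dec-true (length (rect m r) ℕ.≤? N) (subst (_≤ N) (sym (length-replicate r)) (ℕₚ.m≤m+n r j))))
      (*ₛ≡⊠ (invV (rect m r) N n) _)))
    (*-cong (invV≈ r j) (≈-trans (reflexive (sumₛ≡Sum _ (perms N))) (≈-trans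
      (Sum-cong-All (perms N) (perms-invariant N) λ w _ → reflexive (trans (*ₛ≡⊠ _ _)
        (cong (X (sumFin N (λ k → e k ℕ.* toℕ (w k))) ⊠_) (prodₛ≡Prod _ (pairsFin N)))))
      (≈-trans (permutation-sum ratio N e toℕ)
        (≈-trans (reflexive (cong₂ (HLD ratio) (parts-tabulate r j) (positions-tabulate (λ i → i) N)))
          (HLD≈HL (replicate r m ++ replicate j 0) (upTo N) (upTo⁺ N)))))))
    where
    N = r ℕ.+ j
    e : Fin N → ℕ
    e k = part (replicate r m) (toℕ k)

  -- Coefficient d is read off modulo q^(d + 1), which explains the precision `suc d` and the bound
  -- on N.
  HLspec-converges : ∀ r → Converges (λ N → HLspec (rect m r) N n) (P r)
  HLspec-converges r d = (r ℕ.+ suc d) ℕ.* n , λ N le → subst (λ N → HLspec (rect m r) N n d ≡ P r d)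
    (ℕₚ.m+[n∸m]≡n (r≤ N le)) (trans (HLspec≈ r (N ∸ r) d)
      (∼⇒coefficient (HL-limit (suc d) (s≤s z≤n) r (N ∸ r) (subst ((r ℕ.+ suc d) ℕ.* n ≤_) (sym (ℕₚ.m+[n∸m]≡n (r≤ N le))) le)) d ℕₚ.≤-refl))
    where
    r≤ : ∀ N → (r ℕ.+ suc d) ℕ.* n ≤ N → r ≤ N
    r≤ N le = ℕₚ.≤-trans (ℕₚ.m≤m+n r (suc d)) (ℕₚ.≤-trans (ℕₚ.m≤m*n (r ℕ.+ suc d) n ⦃ ℕ.>-nonZero n>0 ⦄) le)

  C2≡triangle : ∀ r → r C 2 ≡ triangle r
  C2≡triangle zero    = refl
  C2≡triangle (suc r) = trans (sym (nCk+nC[k+1]≡[n+1]C[k+1] r 1))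
    (trans (cong₂ ℕ._+_ (nC1≡n r) (C2≡triangle r)) (ℕₚ.+-comm r (triangle r)))

  embed-below : ∀ f e → (∀ i → i < e → f i ≡ + 0) → ∀ d → embed f (e ℤ.⊖ suc d) ≡ + 0
  embed-below f e z d with e ℕ.≤? d
  ... | yes l = trans (cong (embed f) (ℤₚ.⊖-< (s≤s l))) (negative (suc d ∸ e) (ℕₚ.m<n⇒0<n∸m (s≤s l)))
    where
    negative : ∀ k → 0 < k → embed f (ℤ.- (+ k)) ≡ + 0
    negative (suc k) _ = refl
  ... | no ¬l = trans (cong (embed f) (ℤₚ.⊖-≥ (ℕₚ.≰⇒> ¬l))) (z (e ∸ suc d) (ℕₚ.∸-monoʳ-< (s≤s z≤n) (ℕₚ.≰⇒> ¬l)))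

  -- In negative degrees the terms vanish for every r, since the removed monomial divides `P r`; in
  -- degree d the coefficient is that of the quotient, known modulo q^(d + 1).
  normalised-converges : ConvergesL (λ r → shiftL (m ℕ.* (r C 2)) (P r)) (embed (rhsₛ n (m ℕ.+ n)))
  normalised-converges -[1+ d ] = 0 , λ r _ → embed-below (P r) (m ℕ.* (r C 2))
    (Divisible⇒coefficient (subst (λ t → Divisible (m ℕ.* t) (P r)) (sym (C2≡triangle r)) (P-divisible r))) d
  normalised-converges (+ d) = n ℕ.* suc d , λ r le → trans
    (cong (P r) (trans (cong (λ t → d ℕ.+ m ℕ.* t) (C2≡triangle r)) (ℕₚ.+-comm d _)))
    (trans (equality (P-divisible r) (m ℕ.* triangle r ℕ.+ d))
      (trans (at (sym (*ₛ≡⊠ (mono (m ℕ.* triangle r)) (quotient (P-divisible r)))) (m ℕ.* triangle r ℕ.+ d))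
        (trans (shift-+ (m ℕ.* triangle r) (quotient (P-divisible r)) d)
          (trans (∼⇒coefficient (Products.normalised-limit m n n>0 (suc d) r
              (ℕₚ.≤-trans (ℕₚ.m≤n*m (suc d) n ⦃ ℕ.>-nonZero n>0 ⦄) le) le) d ℕₚ.≤-refl)
            (sym (rhsₛ≈rhs n (m ℕ.+ n) d))))))

  rhsₛ-symmetric : ∀ d → rhsₛ n (m ℕ.+ n) d ≡ rhsₛ m (m ℕ.+ n) d
  rhsₛ-symmetric d = trans (rhsₛ≈rhs n (m ℕ.+ n) d)
    (trans (Products.rhs-symmetric m n m>0 n>0 d) (sym (rhsₛ≈rhs m (m ℕ.+ n) d)))

open import Data.Nat using (_+_; _*_)

theorem1p5 : (m n : ℕ) → 1 ≤ m → 1 ≤ n →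
    Σ (ℕ → Series) (λ P →
    (∀ r → Converges (λ N → HLspec (rect m r) N n) (P r))
    × ConvergesL (λ r → shiftL (m * (r C 2)) (P r)) (embed (rhsₛ n (m + n)))
    × (∀ d → rhsₛ n (m + n) d ≡ rhsₛ m (m + n) d))
theorem1p5 m n m>0 n>0 = Limit.P SeriesConvolution.series m n n>0 ,
  HLspec-converges , normalised-converges , rhsₛ-symmetric
  where open Specialisation m n m>0 n>0
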